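{- Let $\Gamma$ be a cubic vertex-transitive tricirculant. Then the order of $\Gamma$ is $6k$ for some positive integer $k$ and one of the following holds: (1) $k$ is odd and $\Gamma$ is isomorphic to one of the graphs $\mathrm{X}(k)$ or $\mathrm{Y}(k)$ defined below; (2) $\Gamma$ is a prism and $k$ is odd, or $\Gamma$ is a M\"obius ladder; (3) the order of $\Gamma$ is less than $54$ and $\Gamma$ is one of the following twenty graphs from the census of cubic vertex-transitive graphs (labelled [order, identifier]): [6,1], [6,2], [12,1], [12,2], [18,1], [18,3], [18,4], [18,5], [24,1], [30,1], [30,2], [30,5], [30,7], [30,8], [36,1], [42,3], [42,4], [42,9], [42,10], [48,1].
   Context: All graphs are finite; a cubic graph is connected and 3-regular. A connected graph is a tricirculant if it admits a cyclic group of automorphisms having exactly three orbits on the vertex set, all of equal size larger than 1. For a positive integer $k$ and $r,s\in\mathbb{Z}_{2k}$, let $T_1(k,r,s)$ be the graph with vertex set $\{u_i,v_i,w_i : i\in\mathbb{Z}_{2k}\}$ and edges $u_iu_{i+k}$, $u_iv_i$, $u_iw_i$, $v_iw_{i+r}$, $v_iw_{i+s}$ for all $i\in\mathbb{Z}_{2k}$. For odd $k$, let $r^*=\frac{k+3}{2}$ if $k\equiv 1 \pmod 4$ and $r^*=\frac{k+3}{2}+k$ if $k\equiv 3\pmod 4$, and define $\mathrm{X}(k)=T_1(k,r^*,1)$. Let $T_2(k,r,s)$ be the graph with vertex set $\{u_i,v_i,w_i : i\in\mathbb{Z}_{2k}\}$ and edges $w_iw_{i+k}$, $u_iv_i$,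 $u_iw_i$, $u_iw_{i+r}$, $v_iv_{i+s}$ for all $i\in\mathbb{Z}_{2k}$. For odd $k$, define $\mathrm{Y}(k)=T_2(k,2,1)$. -}

module Defs where

open import Data.Nat using (ℕ; zero; suc; _+_; _*_; _<_; _≤_; _%_; _/_)
open import Data.Fin using (Fin; toℕ)
open import Data.Product using (Σ; ∃; _×_; _,_; proj₁; proj₂)
open import Data.Sum using (_⊎_)
open import Data.List using (List; []; _∷_)
open import Data.List.Relation.Unary.Any using (Any)
open import Data.List.Membership.Propositional using (_∈_)
open import Relation.Binary.PropositionalEquality using (_≡_)
open import Relation.Nullary using (¬_)

Graph : ℕ → Set₁
Graph n = Fin n → Fin n → Set

IsSimple : ∀ {n} → Graph n → Set
IsSimple {n} G = (∀ u v → G u v → G v u) × (∀ v → ¬ G v v)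

data Reach {n : ℕ} (G : Graph n) : Fin n → Fin n → Set where
  here : ∀ {u} → Reach G u u
  step : ∀ {u v w} → G u v → Reach G v w → Reach G u w

Connected : ∀ {n} → Graph n → Set
Connected {n} G = ∀ (u v : Fin n) → Reach G u v

Degree3 : ∀ {n} → Graph n → Fin n → Set
Degree3 {n} G v =
  Σ (Fin n) λ a → Σ (Fin n) λ b → Σ (Fin n) λ c →
    ¬ a ≡ b × ¬ a ≡ c × ¬ b ≡ c ×
    (∀ w → (G v w → (w ≡ a ⊎ w ≡ b ⊎ w ≡ c)) × ((w ≡ a ⊎ w ≡ b ⊎ w ≡ c) → G v w))

Cubic : ∀ {n} → Graph n → Set
Cubic {n} G = IsSimple G × Connected G × (∀ v → Degree3 G v)

record _≅_ {n m : ℕ} (G : Graph n) (H : Graph m) : Set where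
  field
    to      : Fin n → Fin m
    from    : Fin m → Fin n
    from-to : ∀ x → from (to x) ≡ x
    to-from : ∀ y → to (from y) ≡ y
    pres    : ∀ u v → G u v → H (to u) (to v)
    refl'   : ∀ u v → H (to u) (to v) → G u v

infix 4 _≅_

Aut : ∀ {n} → Graph n → Set
Aut G = G ≅ G

VertexTransitive : ∀ {n} → Graph n → Set
VertexTransitive {n} G = ∀ (u v : Fin n) → Σ (Aut G) λ φ → _≅_.to φ u ≡ v

pow : ∀ {A : Set} → (A → A) → ℕ → A → A
pow f zero    x = x
pow f (suc j) x = f (pow f j x)

-- orbits of the cyclic group ⟨σ⟩ (finite, so nonnegative powers suffice)
SameOrbit : ∀ {n} → (Fin n → Fin n) → Fin n → Fin n → Set
SameOrbit σ x y = ∃ λ j → pow σ j x ≡ y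

OrbitSize : ∀ {n} → (Fin n → Fin n) → Fin n → ℕ → Set
OrbitSize {n} σ x m =
  Σ (Fin m → Fin n) λ e →
    (∀ i j → e i ≡ e j → i ≡ j) ×
    (∀ i → SameOrbit σ x (e i)) ×
    (∀ y → SameOrbit σ x y → ∃ λ i → e i ≡ y)

ThreeEqualOrbits : ∀ {n} → (Fin n → Fin n) → Set
ThreeEqualOrbits {n} σ =
  Σ (Fin 3 → Fin n) λ a → Σ ℕ λ m →
    1 < m ×
    (∀ y → ∃ λ i → SameOrbit σ (a i) y) ×
    (∀ i j → SameOrbit σ (a i) (a j) → i ≡ j) ×
    (∀ i → OrbitSize σ (a i) m)

Tricirculant : ∀ {n} → Graph n → Set
Tricirculant G = Connected G × Σ (Aut G) λ σ → ThreeEqualOrbits (_≅_.to σ)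

_mod_ : ℕ → ℕ → ℕ
a mod zero  = a
a mod suc m = a % suc m

gen : (N : ℕ) → (ℕ → ℕ → Set) → Graph N
gen N E x y = E (toℕ x) (toℕ y) ⊎ E (toℕ y) (toℕ x)

-- T₁(k,r,s): u_i = i, v_i = 2k+i, w_i = 4k+i  (i ∈ ℤ_{2k})
T1E : ℕ → ℕ → ℕ → ℕ → ℕ → Set
T1E k r s x y = ∃ λ i → i < 2 * k ×
  (  (x ≡ i × y ≡ (i + k) mod (2 * k))
   ⊎ (x ≡ i × y ≡ 2 * k + i)
   ⊎ (x ≡ i × y ≡ 4 * k + i)
   ⊎ (x ≡ 2 * k + i × y ≡ 4 * k + (i + r) mod (2 * k))
   ⊎ (x ≡ 2 * k + i × y ≡ 4 * k + (i + s) mod (2 * k)))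

T1 : (k r s : ℕ) → Graph (6 * k)
T1 k r s = gen (6 * k) (T1E k r s)

T2E : ℕ → ℕ → ℕ → ℕ → ℕ → Set
T2E k r s x y = ∃ λ i → i < 2 * k ×
  (  (x ≡ 4 * k + i × y ≡ 4 * k + (i + k) mod (2 * k))
   ⊎ (x ≡ i × y ≡ 2 * k + i)
   ⊎ (x ≡ i × y ≡ 4 * k + i)
   ⊎ (x ≡ i × y ≡ 4 * k + (i + r) mod (2 * k))
   ⊎ (x ≡ 2 * k + i × y ≡ 2 * k + (i + s) mod (2 * k)))

T2 : (k r s : ℕ) → Graph (6 * k)
T2 k r s = gen (6 * k) (T2E k r s)

Odd : ℕ → Set
Odd k = k % 2 ≡ 1

rstar : ℕ → ℕ
rstar k with k % 4
... | 1 = (k + 3) / 2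
... | _ = (k + 3) / 2 + k

X : (k : ℕ) → Graph (6 * k)
X k = T1 k (rstar k) 1

Y : (k : ℕ) → Graph (6 * k)
Y k = T2 k 2 1

PrismE : ℕ → ℕ → ℕ → Set
PrismE n x y = ∃ λ i → i < n ×
  (  (x ≡ i × y ≡ (i + 1) mod n)
   ⊎ (x ≡ n + i × y ≡ n + (i + 1) mod n)
   ⊎ (x ≡ i × y ≡ n + i))

Prism : (n : ℕ) → Graph (2 * n)
Prism n = gen (2 * n) (PrismE n)

MobiusE : ℕ → ℕ → ℕ → Set
MobiusE n x y = ∃ λ i → i < 2 * n ×
  (  (x ≡ i × y ≡ (i + 1) mod (2 * n))
   ⊎ (x ≡ i × y ≡ (i + n) mod (2 * n)))

Mobius : (n : ℕ) → Graph (2 * n)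
Mobius n = gen (2 * n) (MobiusE n)

IsPrism : ∀ {N} → Graph N → Set
IsPrism G = ∃ λ n → 3 ≤ n × G ≅ Prism n

IsMobiusLadder : ∀ {N} → Graph N → Set
IsMobiusLadder G = ∃ λ n → 2 ≤ n × G ≅ Mobius n

-- Tricirculant graphs given by connection data: vertex (a , j) with
-- a ∈ {0,1,2}, j ∈ ℤ_m is encoded as a * m + j; a triple (a , b , d)
-- contributes the edges (a , j) ~ (b , j + d) for all j ∈ ℤ_m.

TricE : ℕ → List (ℕ × ℕ × ℕ) → ℕ → ℕ → Set
TricE m cs x y = Σ ℕ λ a → Σ ℕ λ b → Σ ℕ λ d → Σ ℕ λ j →
  (a , b , d) ∈ cs × j < m × x ≡ a * m + j × y ≡ b * m + (j + d) mod m

Tric : (m : ℕ) → List (ℕ × ℕ × ℕ) → Graph (3 * m)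
Tric m cs = gen (3 * m) (TricE m cs)

-- The twenty exceptional graphs of item (3), i.e. the
-- cubic vertex-transitive tricirculants of order < 54, listed by order;
-- each as Tric m data (order 3m).
censusData : List (ℕ × List (ℕ × ℕ × ℕ))
censusData =
  -- order 6: girth 3, diameter 2, non-bipartite
  (2 , (0 , 0 , 1) ∷ (1 , 1 , 1) ∷ (2 , 2 , 1) ∷ (0 , 1 , 0) ∷ (0 , 2 , 0) ∷ (1 , 2 , 0) ∷ []) ∷
  -- order 6: girth 4, diameter 2, bipartite
  (2 , (0 , 0 , 1) ∷ (1 , 1 , 1) ∷ (2 , 2 , 1) ∷ (0 , 1 , 0) ∷ (0 , 2 , 0) ∷ (1 , 2 , 1) ∷ []) ∷
  -- order 12: girth 4, diameter 3, non-bipartite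
  (4 , (0 , 0 , 2) ∷ (1 , 1 , 2) ∷ (2 , 2 , 2) ∷ (0 , 1 , 0) ∷ (0 , 2 , 0) ∷ (1 , 2 , 1) ∷ []) ∷
  -- order 12: girth 3, diameter 3, non-bipartite
  (4 , (0 , 0 , 2) ∷ (0 , 1 , 0) ∷ (0 , 2 , 0) ∷ (1 , 2 , 0) ∷ (1 , 2 , 1) ∷ []) ∷
  -- order 18: girth 6, diameter 4, bipartite
  (6 , (0 , 0 , 1) ∷ (1 , 1 , 3) ∷ (0 , 2 , 0) ∷ (1 , 2 , 0) ∷ (1 , 2 , 2) ∷ []) ∷
  -- order 18: girth 4, diameter 5, bipartite
  (6 , (0 , 0 , 3) ∷ (1 , 1 , 3) ∷ (2 , 2 , 3) ∷ (0 , 1 , 0) ∷ (0 , 2 , 0) ∷ (1 , 2 , 1) ∷ []) ∷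
  -- order 18: girth 4, diameter 5, non-bipartite
  (6 , (0 , 0 , 3) ∷ (1 , 1 , 3) ∷ (2 , 2 , 3) ∷ (0 , 1 , 0) ∷ (0 , 2 , 0) ∷ (1 , 2 , 2) ∷ []) ∷
  -- order 18: girth 3, diameter 4, non-bipartite
  (6 , (0 , 0 , 3) ∷ (0 , 1 , 0) ∷ (0 , 2 , 0) ∷ (1 , 2 , 0) ∷ (1 , 2 , 1) ∷ []) ∷
  -- order 24: girth 4, diameter 6, non-bipartite
  (8 , (0 , 0 , 4) ∷ (1 , 1 , 4) ∷ (2 , 2 , 4) ∷ (0 , 1 , 0) ∷ (0 , 2 , 0) ∷ (1 , 2 , 1) ∷ []) ∷
  -- order 30: girth 8, diameter 4, bipartite
  (10 , (0 , 0 , 1) ∷ (1 , 1 , 3) ∷ (2 , 2 , 5) ∷ (0 , 2 , 0) ∷ (1 , 2 , 0) ∷ []) ∷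
  -- order 30: girth 6, diameter 5, bipartite
  (10 , (0 , 0 , 1) ∷ (1 , 1 , 5) ∷ (0 , 2 , 0) ∷ (1 , 2 , 0) ∷ (1 , 2 , 2) ∷ []) ∷
  -- order 30: girth 4, diameter 8, bipartite
  (10 , (0 , 0 , 5) ∷ (1 , 1 , 5) ∷ (2 , 2 , 5) ∷ (0 , 1 , 0) ∷ (0 , 2 , 0) ∷ (1 , 2 , 1) ∷ []) ∷
  -- order 30: girth 4, diameter 8, non-bipartite
  (10 , (0 , 0 , 5) ∷ (1 , 1 , 5) ∷ (2 , 2 , 5) ∷ (0 , 1 , 0) ∷ (0 , 2 , 0) ∷ (1 , 2 , 2) ∷ []) ∷
  -- order 30: girth 7, diameter 5, non-bipartite
  (10 , (0 , 0 , 5) ∷ (0 , 1 , 0) ∷ (0 , 2 , 0) ∷ (1 , 2 , 1) ∷ (1 , 2 , 4) ∷ []) ∷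
  -- order 36: girth 4, diameter 9, non-bipartite
  (12 , (0 , 0 , 6) ∷ (1 , 1 , 6) ∷ (2 , 2 , 6) ∷ (0 , 1 , 0) ∷ (0 , 2 , 0) ∷ (1 , 2 , 1) ∷ []) ∷
  -- order 42: girth 6, diameter 6, bipartite
  (14 , (0 , 0 , 1) ∷ (1 , 1 , 7) ∷ (0 , 2 , 0) ∷ (1 , 2 , 0) ∷ (1 , 2 , 2) ∷ []) ∷
  -- order 42: girth 4, diameter 11, bipartite
  (14 , (0 , 0 , 7) ∷ (1 , 1 , 7) ∷ (2 , 2 , 7) ∷ (0 , 1 , 0) ∷ (0 , 2 , 0) ∷ (1 , 2 , 1) ∷ []) ∷
  -- order 42: girth 4, diameter 11, non-bipartite
  (14 , (0 , 0 , 7) ∷ (1 , 1 , 7) ∷ (2 , 2 , 7) ∷ (0 , 1 , 0) ∷ (0 , 2 , 0) ∷ (1 , 2 , 2) ∷ []) ∷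
  -- order 42: girth 8, diameter 5, non-bipartite
  (14 , (0 , 0 , 7) ∷ (0 , 1 , 0) ∷ (0 , 2 , 0) ∷ (1 , 2 , 1) ∷ (1 , 2 , 12) ∷ []) ∷
  -- order 48: girth 4, diameter 12, non-bipartite
  (16 , (0 , 0 , 8) ∷ (1 , 1 , 8) ∷ (2 , 2 , 8) ∷ (0 , 1 , 0) ∷ (0 , 2 , 0) ∷ (1 , 2 , 1) ∷ []) ∷
  []

InCensusList : ∀ {N} → Graph N → Set
InCensusList G = Any (λ p → G ≅ Tric (proj₁ p) (proj₂ p)) censusData

{-# OPTIONS --safe #-}

-- The cyclic group acts semiregularly, so Γ is a regular ℤₘ-cover of a cubic pregraph on three
-- vertices u, v, w.  Some vertex of the pregraph carries a semi-edge, hence m = 2k, and up to the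
-- choice of labels there are four pregraphs, with voltages r, s and k.  If all three vertices carry
-- a semi-edge, then Γ consists of one strand or two strands closed up by the semi-edges: it is a
-- Möbius ladder or a prism.
-- For the other three types, vertex-transitivity makes the numbers of closed walks of each length
-- at u, v, w agree.  Such a number is a sum over those voltages α r + β s + γ k of bounded size that
-- vanish in ℤ₂ₖ, so a case analysis on the vanishing of short voltages refutes all branches except
-- those that bound k, and the families 2r = 3s + k (type 1, up to exchanging r and s) and r = ±2s
-- (type 2).  Enumerating the bounded k yields only two further graphs, of orders 12 and 30 (the
-- truncated tetrahedron and the 8-cage).  In the two families, walk counts along edges single out a
-- perfect matching; automorphisms preserve the complementary 2-factor, and following it for k or 3k
-- steps from two different vertices gives the parities of k, r and s, which leaves X(k) and Y(k).

module Submission where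

open import Defs

-- The obstacle is that k is unbounded, while a walk count depends on which of many short sums of
-- voltages vanish. Counts are therefore kept as formal sums of voltages with coefficients
-- independent of k. In a branch some voltages are known to vanish and some not to; each remaining
-- one may contribute or not, so a difference of counts lies in an interval, and the branch is
-- refuted once this interval misses 0. The branches are data: one soundness proof and the
-- evaluation of a Boolean function replace a separate argument for each leaf. Powers of the
-- adjacency matrix would be swamped by backtracking walks; subtracting twice the last but one term
-- leaves the non-backtracking walks of lengths L, L - 2, L - 4 and so on. Connectedness says that
-- r, s and k have no common divisor. It turns e r = e s = 0 modulo k into k ≤ e, and together with
-- the parities it makes s a unit of ℤ₂ₖ in both families. Multiplying all indices by its inverse
-- gives s = 1. Then r is 2 for `Y`, and for `X` it is the even solution of 2 r = 3 + k; this is the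
-- origin of r*.

module Classification where
  open import Data.Bool using (Bool; true; false; not; _∧_; _∨_; if_then_else_; T)
  open import Data.Empty using (⊥; ⊥-elim)
  open import Data.Fin as F using (Fin; toℕ; fromℕ<; cast; combine; remQuot)
  open import Data.Fin.Patterns using (0F; 1F; 2F)
  import Data.Fin.Properties as F
  open import Data.Integer as ℤ
    using (ℤ; +0; +_; -[1+_]; -_; _+_; _*_; _-_; _%ℕ_; _/ℕ_; 0ℤ; 1ℤ; ∣_∣; _⊓_; _⊔_; _≤ᵇ_)
  import Data.Integer.DivMod as ℤ
  import Data.Integer.Properties as ℤ
  open import Data.Integer.Tactic.RingSolver using (solve-∀)
  open import Data.List using (List; []; _∷_; _++_; map; null)
  open import Data.List.Membership.Propositional using (_∈_)
  open import Data.List.Membership.Propositional.Properties using (∈-map⁻; ∈-map⁺)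
  open import Data.List.Relation.Unary.All as All using (All; []; _∷_)
  open import Data.List.Relation.Unary.Any using (here; there)
  open import Data.Maybe using (Maybe; just; nothing; is-just)
  open import Data.Nat as ℕ using (ℕ; zero; suc; NonZero; _≡ᵇ_; _%_; _/_)
  import Data.Nat.Divisibility as ℕ
  open import Data.Nat.DivMod using (m<n⇒m%n≡m; m≡m%n+[m/n]*n; m*n/n≡m; m%n<n)
  open import Data.Nat.GCD using (module Bézout; module GCD)
  import Data.Nat.Properties as ℕ
  import Data.Nat.Tactic.RingSolver as ℕ using (solve-∀)
  open import Data.Product using (Σ; ∃; _×_; _,_; proj₁; proj₂)
  open import Data.Product.Properties using (≡-dec)
  open import Data.Sum using (_⊎_; inj₁; inj₂; [_,_]′)
  open import Data.Unit using (tt)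
  open import Data.Vec as V using (lookup; tabulate)
  open import Data.Vec.Properties using (lookup∘tabulate)
  open import Function using (_∘_; id)
  open import Relation.Binary.Definitions using (tri<; tri≈; tri>)
  open import Relation.Binary.PropositionalEquality
    using (_≡_; _≢_; refl; sym; trans; cong; cong₂; subst; subst₂)
  open import Relation.Nullary using (¬_; Dec; yes; no; contradiction; does)
  open import Relation.Nullary.Decidable using (toWitness; ¬?; _→-dec_; _⊎-dec_)

  -- Congruences and labelled covers

  infix 4 _≈_[_]
  -- Integers with an explicit quotient take the place of elements of ℤₘ: identities between
  -- representatives go to the ring solver, and a change of modulus is a change of quotient.
  record _≈_[_] (x y : ℤ) (m : ℕ) : Set where
    constructor by
    field
      quotient : ℤ
      equality : x ≡ y + quotient * + m

  module _ {m : ℕ} where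
    ≈-refl : ∀ {x} → x ≈ x [ m ]
    ≈-refl {x} = by 0ℤ (lem x (+ m))
      where lem : ∀ x m → x ≡ x + 0ℤ * m
            lem = solve-∀

    ≈-reflexive : ∀ {x y} → x ≡ y → x ≈ y [ m ]
    ≈-reflexive refl = ≈-refl

    ≈-sym : ∀ {x y} → x ≈ y [ m ] → y ≈ x [ m ]
    ≈-sym {x} {y} (by q refl) = by (- q) (lem y q (+ m))
      where lem : ∀ y q m → y ≡ y + q * m + - q * m
            lem = solve-∀

    ≈-trans : ∀ {x y z} → x ≈ y [ m ] → y ≈ z [ m ] → x ≈ z [ m ]
    ≈-trans {z = z} (by p refl) (by q refl) = by (q + p) (lem z p q (+ m))
      where lem : ∀ z p q m → z + q * m + p * m ≡ z + (q + p) * m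
            lem = solve-∀

    +-cong-≈ : ∀ {x y x′ y′} → x ≈ x′ [ m ] → y ≈ y′ [ m ] → x + y ≈ x′ + y′ [ m ]
    +-cong-≈ {x′ = x} {y} (by p refl) (by q refl) = by (p + q) (lem x y p q (+ m))
      where lem : ∀ x y p q m → x + p * m + (y + q * m) ≡ x + y + (p + q) * m
            lem = solve-∀

    +-congʳ-≈ : ∀ {x x′} y → x ≈ x′ [ m ] → x + y ≈ x′ + y [ m ]
    +-congʳ-≈ y p = +-cong-≈ p ≈-refl

    +-congˡ-≈ : ∀ {x x′} y → x ≈ x′ [ m ] → y + x ≈ y + x′ [ m ]
    +-congˡ-≈ y p = +-cong-≈ (≈-refl {y}) p

    *-congˡ-≈ : ∀ {x y} c → x ≈ y [ m ] → c * x ≈ c * y [ m ]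
    *-congˡ-≈ {y = y} c (by q refl) = by (c * q) (lem c y q (+ m))
      where lem : ∀ c y q m → c * (y + q * m) ≡ c * y + c * q * m
            lem = solve-∀

    neg-cong-≈ : ∀ {x y} → x ≈ y [ m ] → - x ≈ - y [ m ]
    neg-cong-≈ {y = y} (by q refl) = by (- q) (lem y q (+ m))
      where lem : ∀ y q m → - (y + q * m) ≡ - y + - q * m
            lem = solve-∀

    +-cancelˡ-≈ : ∀ c {x y} → c + x ≈ c + y [ m ] → x ≈ y [ m ]
    +-cancelˡ-≈ c {x} {y} p = ≈-trans (≈-reflexive (lem c x)) (≈-trans (+-congˡ-≈ (- c) p) (≈-reflexive (sym (lem c y))))
      where lem : ∀ c x → x ≡ - c + (c + x)
            lem = solve-∀

    residue : .{{_ : NonZero m}} → ∀ z → + (z %ℕ m) ≈ z [ m ]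
    residue z = ≈-sym (by (z /ℕ m) (ℤ.a≡a%ℕn+[a/ℕn]*n z m))

  residues-≡ : ∀ {m a b} → a ℕ.< m → b ℕ.< m → + a ≈ + b [ m ] → a ≡ b
  residues-≡ {m} {a} {b} a<m b<m (by (+ zero) e) = ℤ.+-injective (trans e (trans (cong (λ t → + b + t) (ℤ.*-zeroˡ (+ m))) (ℤ.+-identityʳ (+ b))))
  residues-≡ {m} {a} {b} a<m b<m (by (+ suc q) e) = ⊥-elim (ℕ.<⇒≱ a<m (subst (m ℕ.≤_) (sym a≡) (ℕ.≤-trans (ℕ.m≤m+n m (q ℕ.* m)) (ℕ.m≤n+m _ b))))
    where a≡ : a ≡ b ℕ.+ suc q ℕ.* m
          a≡ = ℤ.+-injective (trans e (cong (λ t → + b + t) (sym (ℤ.pos-* (suc q) m))))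
  residues-≡ {m} {a} {b} a<m b<m (by -[1+ q ] e) = ⊥-elim (ℕ.<⇒≱ b<m (subst (m ℕ.≤_) (sym b≡) (ℕ.≤-trans (ℕ.m≤m+n m (q ℕ.* m)) (ℕ.m≤n+m _ a))))
    where lem : ∀ b q m → b ≡ b + - q * m + q * m
          lem = solve-∀
          b≡ : b ≡ a ℕ.+ suc q ℕ.* m
          b≡ = ℤ.+-injective (trans (lem (+ b) (+ suc q) (+ m)) (trans (cong (_+ + suc q * + m) (sym e)) (cong (λ t → + a + t) (sym (ℤ.pos-* (suc q) m)))))

  ≈⇒%≡ : ∀ {m} .{{_ : NonZero m}} {x y} → x ≈ y [ m ] → x %ℕ m ≡ y %ℕ m
  ≈⇒%≡ {m} {x} {y} p = residues-≡ (ℤ.n%ℕd<d x m) (ℤ.n%ℕd<d y m) (≈-trans (residue x) (≈-trans p (≈-sym (residue y))))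

  %≡⇒≈ : ∀ {m} .{{_ : NonZero m}} {x y} → x %ℕ m ≡ y %ℕ m → x ≈ y [ m ]
  %≡⇒≈ {m} {x} {y} e = ≈-trans (≈-sym (residue x)) (≈-trans (≈-reflexive (cong +_ e)) (residue y))

  ≈? : ∀ m .{{_ : NonZero m}} x y → Dec (x ≈ y [ m ])
  ≈? m x y with x %ℕ m ℕ.≟ y %ℕ m
  ... | yes e = yes (%≡⇒≈ e)
  ... | no ¬e = no (λ p → ¬e (≈⇒%≡ p))

  ≈-coarsen : ∀ {m x y} c → x ≈ y [ c ℕ.* m ] → x ≈ y [ m ]
  ≈-coarsen {m} {x} {y} c (by q e) = by (q * + c) (trans e (cong (λ t → y + t) (trans (cong (q *_) (ℤ.pos-* c m)) (sym (ℤ.*-assoc q (+ c) (+ m))))))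

  ≈-half : ∀ {k x y} → x ≈ y [ 2 ℕ.* k ] → x ≈ y [ 2 ]
  ≈-half {k} {x} {y} p = ≈-coarsen k (subst (λ m → x ≈ y [ m ]) (ℕ.*-comm 2 k) p)

  even⊎odd : ∀ z → z ≈ 0ℤ [ 2 ] ⊎ z ≈ 1ℤ [ 2 ]
  even⊎odd z with z %ℕ 2 | ℤ.n%ℕd<d z 2 | residue {2} z
  ... | 0 | _ | p = inj₁ (≈-sym p)
  ... | 1 | _ | p = inj₂ (≈-sym p)
  ... | suc (suc _) | ℕ.s≤s (ℕ.s≤s ()) | _

  1≉0 : ¬ (1ℤ ≈ 0ℤ [ 2 ])
  1≉0 p with residues-≡ {2} {1} {0} (ℕ.s≤s (ℕ.s≤s ℕ.z≤n)) (ℕ.s≤s ℕ.z≤n) p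
  ... | ()

  odd*k≈k : ∀ k {c} → c ≈ 1ℤ [ 2 ] → c * + k ≈ + k [ 2 ℕ.* k ]
  odd*k≈k k {c} (by e refl) = by e (trans (lem e (+ k)) (cong (λ t → + k + e * t) (sym (ℤ.pos-* 2 k))))
    where lem : ∀ e k → (1ℤ + e * + 2) * k ≡ k + e * (+ 2 * k)
          lem = solve-∀

  even*k≈0 : ∀ k {c} → c ≈ 0ℤ [ 2 ] → c * + k ≈ 0ℤ [ 2 ℕ.* k ]
  even*k≈0 k {c} (by e refl) = by e (trans (lem e (+ k)) (cong (λ t → 0ℤ + e * t) (sym (ℤ.pos-* 2 k))))
    where lem : ∀ e k → (0ℤ + e * + 2) * k ≡ 0ℤ + e * (+ 2 * k)
          lem = solve-∀

  -- A vector α, β, γ stands for the voltage α r + β s + γ k ∈ ℤ₂ₖ.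
  record Vec : Set where
    constructor ⟨_,_,_⟩
    field
      α β γ : ℤ

  data Type : Set where
    t1 t2 t3 t4 : Type

  -- The darts of the four quotient pregraphs, with u, v, w = 0, 1, 2.  Types 1 and 2 are
  -- those of T₁ and T₂; type 3 has a semi-edge at every vertex; type 4 has edges
  -- uᵢuᵢ₊ₖ, uᵢvᵢ, uᵢwᵢ, vᵢvᵢ₊ᵣ, wᵢwᵢ₊ₛ.
  dart : Type → Fin 3 → Fin 3 → Fin 3 × Vec
  dart t1 0F 0F = 0F , ⟨ + 0 , + 0 , + 1 ⟩
  dart t1 0F 1F = 1F , ⟨ + 0 , + 0 , + 0 ⟩
  dart t1 0F 2F = 2F , ⟨ + 0 , + 0 , + 0 ⟩
  dart t1 1F 0F = 2F , ⟨ + 0 , + 1 , + 0 ⟩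
  dart t1 1F 1F = 2F , ⟨ + 1 , + 0 , + 0 ⟩
  dart t1 1F 2F = 0F , ⟨ + 0 , + 0 , + 0 ⟩
  dart t1 2F 0F = 1F , ⟨ + 0 , - (+ 1) , + 0 ⟩
  dart t1 2F 1F = 0F , ⟨ + 0 , + 0 , + 0 ⟩
  dart t1 2F 2F = 1F , ⟨ - (+ 1) , + 0 , + 0 ⟩
  dart t2 0F 0F = 1F , ⟨ + 0 , + 0 , + 0 ⟩
  dart t2 0F 1F = 2F , ⟨ + 1 , + 0 , + 0 ⟩
  dart t2 0F 2F = 2F , ⟨ + 0 , + 0 , + 0 ⟩
  dart t2 1F 0F = 0F , ⟨ + 0 , + 0 , + 0 ⟩
  dart t2 1F 1F = 1F , ⟨ + 0 , + 1 , + 0 ⟩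
  dart t2 1F 2F = 1F , ⟨ + 0 , - (+ 1) , + 0 ⟩
  dart t2 2F 0F = 2F , ⟨ + 0 , + 0 , + 1 ⟩
  dart t2 2F 1F = 0F , ⟨ + 0 , + 0 , + 0 ⟩
  dart t2 2F 2F = 0F , ⟨ - (+ 1) , + 0 , + 0 ⟩
  dart t3 0F 0F = 0F , ⟨ + 0 , + 0 , + 1 ⟩
  dart t3 0F 1F = 1F , ⟨ + 0 , + 0 , + 0 ⟩
  dart t3 0F 2F = 2F , ⟨ + 0 , + 0 , + 0 ⟩
  dart t3 1F 0F = 1F , ⟨ + 0 , + 0 , + 1 ⟩
  dart t3 1F 1F = 2F , ⟨ + 1 , + 0 , + 0 ⟩
  dart t3 1F 2F = 0F , ⟨ + 0 , + 0 , + 0 ⟩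
  dart t3 2F 0F = 2F , ⟨ + 0 , + 0 , + 1 ⟩
  dart t3 2F 1F = 0F , ⟨ + 0 , + 0 , + 0 ⟩
  dart t3 2F 2F = 1F , ⟨ - (+ 1) , + 0 , + 0 ⟩
  dart t4 0F 0F = 0F , ⟨ + 0 , + 0 , + 1 ⟩
  dart t4 0F 1F = 1F , ⟨ + 0 , + 0 , + 0 ⟩
  dart t4 0F 2F = 2F , ⟨ + 0 , + 0 , + 0 ⟩
  dart t4 1F 0F = 0F , ⟨ + 0 , + 0 , + 0 ⟩
  dart t4 1F 1F = 1F , ⟨ + 1 , + 0 , + 0 ⟩
  dart t4 1F 2F = 1F , ⟨ - (+ 1) , + 0 , + 0 ⟩
  dart t4 2F 0F = 0F , ⟨ + 0 , + 0 , + 0 ⟩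
  dart t4 2F 1F = 2F , ⟨ + 0 , + 1 , + 0 ⟩
  dart t4 2F 2F = 2F , ⟨ + 0 , - (+ 1) , + 0 ⟩

  head : Type → Fin 3 → Fin 3 → Fin 3
  head t a d = proj₁ (dart t a d)

  volt : Type → Fin 3 → Fin 3 → Vec
  volt t a d = proj₂ (dart t a d)

  value : ℕ → ℤ → ℤ → Vec → ℤ
  value k r s ⟨ a , b , c ⟩ = a * r + b * s + c * + k

  -- The second argument runs through ℤ and is periodic, so `V` is a bijection from three copies of
  -- ℤₘ onto the vertices, and indices never have to be reduced.
  record Labelling {n} (V : Fin 3 → ℤ → Fin n) (m : ℕ) : Set where
    field
      V-cong : ∀ a {i j} → i ≈ j [ m ] → V a i ≡ V a j
      V-inj  : ∀ {a b i j} → V a i ≡ V b j → a ≡ b × i ≈ j [ m ]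
      V-surj : ∀ x → ∃ λ a → ∃ λ i → V a i ≡ x

  -- The derived graph of a voltage assignment on the pregraph `t`. The darts at a vertex are only
  -- asked to reach exactly its neighbours; that they reach three different ones is derived in
  -- `nb-inj` when the graph is cubic.
  record Model (t : Type) {n} (G : Graph n) (k : ℕ) (r s : ℤ) : Set where
    field
      V         : Fin 3 → ℤ → Fin n
      labelling : Labelling V (2 ℕ.* k)
    open Labelling labelling public
    nb : Fin 3 → ℤ → Fin 3 → Fin n
    nb a i d = V (head t a d) (i + value k r s (volt t a d))
    field
      nb-edge : ∀ a i d → G (V a i) (nb a i d)
      edge-nb : ∀ a i y → G (V a i) y → ∃ λ d → y ≡ nb a i d

    nb-cong : ∀ a {i j} d → i ≈ j [ 2 ℕ.* k ] → nb a i d ≡ nb a j d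
    nb-cong a d p = V-cong _ (+-congʳ-≈ _ p)

  value-cong : ∀ k {m} {r r′ s s′} → r ≈ r′ [ m ] → s ≈ s′ [ m ] → ∀ z → value k r s z ≈ value k r′ s′ z [ m ]
  value-cong k p q ⟨ a , b , c ⟩ = +-congʳ-≈ _ (+-cong-≈ (*-congˡ-≈ a p) (*-congˡ-≈ b q))

  value-scale : ∀ k {m r r′ s s′} c → c * r ≈ r′ [ m ] → c * s ≈ s′ [ m ] → c * + k ≈ + k [ m ] →
                ∀ z → c * value k r s z ≈ value k r′ s′ z [ m ]
  value-scale k {r = r} {s = s} c p q o ⟨ a , b , d ⟩ =
    ≈-trans (≈-reflexive (lem a b d c r s (+ k)))
            (+-cong-≈ (+-cong-≈ (*-congˡ-≈ a p) (*-congˡ-≈ b q)) (*-congˡ-≈ d o))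
    where lem : ∀ a b d c r s k → c * (a * r + b * s + d * k) ≡ a * (c * r) + b * (c * s) + d * (c * k)
          lem = solve-∀

  -- A unit modulo the even number 2k is odd, and odd multiples of k are congruent to k. So
  -- rescaling by a unit keeps the semi-edges.
  unit-fixes-k : ∀ {k c c′} → c * c′ ≈ 1ℤ [ 2 ℕ.* k ] → c * + k ≈ + k [ 2 ℕ.* k ]
  unit-fixes-k {k} {c} {c′} p with even⊎odd c
  ... | inj₂ odd = odd*k≈k k odd
  ... | inj₁ even = ⊥-elim (1≉0 (≈-trans (≈-sym (≈-half {k} p))
                      (≈-trans (≈-reflexive (ℤ.*-comm c c′)) (≈-trans (*-congˡ-≈ c′ even) (≈-reflexive (ℤ.*-zeroʳ c′))))))

  module _ {t n n′ k r r′ s s′} {G : Graph n} {H : Graph n′} (M : Model t G k r s) (N : Model t H k r′ s′)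
           (c c′ : ℤ) (cc′ : c * c′ ≈ 1ℤ [ 2 ℕ.* k ]) where
    private
      module M = Model M
      module N = Model N

    rescale : Fin n → Fin n′
    rescale x = let (a , i , _) = M.V-surj x in N.V a (c * i)

    rescale-V : ∀ a i → rescale (M.V a i) ≡ N.V a (c * i)
    rescale-V a i with M.V-surj (M.V a i)
    ... | b , j , e with M.V-inj e
    ... | refl , p = N.V-cong a (*-congˡ-≈ c p)

    module _ (r-eq : c * r ≈ r′ [ 2 ℕ.* k ]) (s-eq : c * s ≈ s′ [ 2 ℕ.* k ]) where
      rescale-nb : ∀ a i d → rescale (M.nb a i d) ≡ N.nb a (c * i) d
      rescale-nb a i d = trans (rescale-V _ _) (N.V-cong _
        (≈-trans (≈-reflexive (ℤ.*-distribˡ-+ c i _))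
                 (+-congˡ-≈ (c * i) (value-scale k c r-eq s-eq (unit-fixes-k {k} {c} cc′) (volt t a d)))))

      rescale-edge : ∀ x y → G x y → H (rescale x) (rescale y)
      rescale-edge x y g with M.V-surj x
      ... | a , i , refl with M.edge-nb a i y g
      ... | d , refl = subst (H _) (sym (rescale-nb a i d)) (N.nb-edge a (c * i) d)

  module _ {t n n′ k r r′ s s′} {G : Graph n} {H : Graph n′} (M : Model t G k r s) (N : Model t H k r′ s′)
           (c c′ : ℤ) (cc′ : c * c′ ≈ 1ℤ [ 2 ℕ.* k ])
           (r-eq : c * r ≈ r′ [ 2 ℕ.* k ]) (s-eq : c * s ≈ s′ [ 2 ℕ.* k ]) where
    private
      module M = Model M
      module N = Model N
      c′c : c′ * c ≈ 1ℤ [ 2 ℕ.* k ]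
      c′c = ≈-trans (≈-reflexive (ℤ.*-comm c′ c)) cc′
      to   = rescale M N c c′ cc′
      from = rescale N M c′ c c′c

      undo : ∀ c c′ {x y} → c * c′ ≈ 1ℤ [ 2 ℕ.* k ] → c′ * x ≈ y [ 2 ℕ.* k ] → c * y ≈ x [ 2 ℕ.* k ]
      undo c c′ {x} p q = ≈-trans (*-congˡ-≈ c (≈-sym q)) (≈-trans (≈-reflexive (lem c c′ x)) (≈-trans (*-congˡ-≈ x p) (≈-reflexive (ℤ.*-identityʳ x))))
        where lem : ∀ c d x → c * (d * x) ≡ x * (c * d)
              lem = solve-∀

      from-to : ∀ x → from (to x) ≡ x
      from-to x with M.V-surj x
      ... | a , i , refl = trans (rescale-V N M c′ c c′c a (c * i)) (M.V-cong a (undo c′ c c′c ≈-refl))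

      to-from : ∀ x → to (from x) ≡ x
      to-from x with N.V-surj x
      ... | a , i , refl = trans (rescale-V M N c c′ cc′ a (c′ * i)) (N.V-cong a (undo c c′ cc′ ≈-refl))

    -- Multiplying all indices by the unit `c` carries the parameters (r, s) to (c r, c s). Every
    -- isomorphism with a named graph arises in this way.
    model-≅ : G ≅ H
    model-≅ = record
      { to = to ; from = from ; from-to = from-to ; to-from = to-from
      ; pres = rescale-edge M N c c′ cc′ r-eq s-eq
      ; refl' = λ u v h → subst₂ G (from-to u) (from-to v)
          (rescale-edge N M c′ c c′c (undo c′ c c′c r-eq) (undo c′ c c′c s-eq) (to u) (to v) h) }

  -- Walk counts and their voltage polynomials

  sum₃ : (Fin 3 → ℤ) → ℤ
  sum₃ f = f 0F + f 1F + f 2F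

  sum₃-cong : ∀ {f g} → (∀ d → f d ≡ g d) → sum₃ f ≡ sum₃ g
  sum₃-cong e = cong₂ _+_ (cong₂ _+_ (e 0F) (e 1F)) (e 2F)

  private
    permute : ∀ (g : Fin 3 → ℤ) p q r → p ≢ q → p ≢ r → q ≢ r → g p + g q + g r ≡ sum₃ g
    permute g 0F 1F 2F _ _ _ = refl
    permute g 0F 2F 1F _ _ _ = lem (g 0F) (g 1F) (g 2F)
      where lem : ∀ a b c → a + c + b ≡ a + b + c
            lem = solve-∀
    permute g 1F 0F 2F _ _ _ = lem (g 0F) (g 1F) (g 2F)
      where lem : ∀ a b c → b + a + c ≡ a + b + c
            lem = solve-∀
    permute g 1F 2F 0F _ _ _ = lem (g 0F) (g 1F) (g 2F)
      where lem : ∀ a b c → b + c + a ≡ a + b + c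
            lem = solve-∀
    permute g 2F 0F 1F _ _ _ = lem (g 0F) (g 1F) (g 2F)
      where lem : ∀ a b c → c + a + b ≡ a + b + c
            lem = solve-∀
    permute g 2F 1F 0F _ _ _ = lem (g 0F) (g 1F) (g 2F)
      where lem : ∀ a b c → c + b + a ≡ a + b + c
            lem = solve-∀
    permute g 0F 0F _ pq _ _ = contradiction refl pq
    permute g 1F 1F _ pq _ _ = contradiction refl pq
    permute g 2F 2F _ pq _ _ = contradiction refl pq
    permute g 0F 1F 0F _ pr _ = contradiction refl pr
    permute g 0F 2F 0F _ pr _ = contradiction refl pr
    permute g 1F 0F 1F _ pr _ = contradiction refl pr
    permute g 1F 2F 1F _ pr _ = contradiction refl pr
    permute g 2F 0F 2F _ pr _ = contradiction refl pr
    permute g 2F 1F 2F _ pr _ = contradiction refl pr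
    permute g 0F 1F 1F _ _ qr = contradiction refl qr
    permute g 0F 2F 2F _ _ qr = contradiction refl qr
    permute g 1F 0F 0F _ _ qr = contradiction refl qr
    permute g 1F 2F 2F _ _ qr = contradiction refl qr
    permute g 2F 0F 0F _ _ qr = contradiction refl qr
    permute g 2F 1F 1F _ _ qr = contradiction refl qr

  Inj : ∀ {A : Set} → (Fin 3 → A) → Set
  Inj e = ∀ {d d′} → e d ≡ e d′ → d ≡ d′

  -- The indices `d′` are distinct because `e` is injective, so they are a permutation of the three
  -- darts.
  sum₃-reindex : ∀ {A : Set} {e e′ : Fin 3 → A} (f : A → ℤ) → Inj e → (∀ d → ∃ λ d′ → e d ≡ e′ d′) →
                 sum₃ (f ∘ e) ≡ sum₃ (f ∘ e′)
  sum₃-reindex {e = e} {e′} f inj h = trans (sum₃-cong (λ d → cong f (proj₂ (h d))))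
    (permute (f ∘ e′) (proj₁ (h 0F)) (proj₁ (h 1F)) (proj₁ (h 2F)) (ne 0F 1F λ ()) (ne 0F 2F λ ()) (ne 1F 2F λ ()))
    where ne : ∀ d d′ → d ≢ d′ → proj₁ (h d) ≢ proj₁ (h d′)
          ne d d′ d≢d′ eq = d≢d′ (inj (trans (proj₂ (h d)) (trans (cong e′ eq) (sym (proj₂ (h d′))))))

  -- A polynomial in the adjacency matrix; up to multiples of earlier terms, count L x y is
  -- the number of non-backtracking walks of length L from x to y.
  module Count {n} (N : Fin n → Fin 3 → Fin n) where
    equal : Fin n → Fin n → ℤ
    equal x y with x F.≟ y
    ... | yes _ = 1ℤ
    ... | no  _ = 0ℤ

    count : ℕ → Fin n → Fin n → ℤ
    count 0 x y = equal x y
    count 1 x y = sum₃ (λ d → equal (N x d) y)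
    count (suc (suc L)) x y = sum₃ (λ d → count (suc L) (N x d) y) + - (+ 2) * count L x y

    module _ (θ : Fin n → Fin n) (θ-inj : ∀ {x y} → θ x ≡ θ y → x ≡ y) (N-inj : ∀ x → Inj (N x))
             (θ-N : ∀ x d → ∃ λ d′ → θ (N x d) ≡ N (θ x) d′) where
      private
        equal-θ : ∀ x y → equal (θ x) (θ y) ≡ equal x y
        equal-θ x y with θ x F.≟ θ y | x F.≟ y
        ... | yes _ | yes _ = refl
        ... | no _  | no _  = refl
        ... | yes p | no q  = contradiction (θ-inj p) q
        ... | no p  | yes q = contradiction (cong θ q) p

        sum-θ : ∀ (f : Fin n → ℤ) x → sum₃ (λ d → f (N (θ x) d)) ≡ sum₃ (λ d → f (θ (N x d)))
        sum-θ f x = sym (sum₃-reindex f (λ e → N-inj x (θ-inj e)) (θ-N x))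

      count-θ : ∀ L x y → count L (θ x) (θ y) ≡ count L x y
      count-θ 0 x y = equal-θ x y
      count-θ 1 x y = trans (sum-θ (λ z → equal z (θ y)) x) (sum₃-cong (λ d → equal-θ (N x d) y))
      count-θ (suc (suc L)) x y = cong₂ (λ a b → a + - (+ 2) * b)
        (trans (sum-θ (λ z → count (suc L) z (θ y)) x) (sum₃-cong (λ d → count-θ (suc L) (N x d) y)))
        (count-θ L x y)

  δ : (m : ℕ) .{{_ : NonZero m}} → ℤ → ℤ
  δ m z with z %ℕ m
  ... | zero  = 1ℤ
  ... | suc _ = 0ℤ

  module _ {m : ℕ} .{{_ : NonZero m}} where
    0%≡0 : ∀ {z} → z ≈ 0ℤ [ m ] → z %ℕ m ≡ 0
    0%≡0 p = trans (≈⇒%≡ p) (m<n⇒m%n≡m (ℕ.>-nonZero⁻¹ m))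

    δ-cong : ∀ {x y} → x ≈ y [ m ] → δ m x ≡ δ m y
    δ-cong {x} {y} p with x %ℕ m | y %ℕ m | ≈⇒%≡ p
    ... | zero  | zero  | _ = refl
    ... | suc _ | suc _ | _ = refl

    δ-one : ∀ {x} → x ≈ 0ℤ [ m ] → δ m x ≡ 1ℤ
    δ-one {x} p with x %ℕ m | 0%≡0 p
    ... | zero | _ = refl

    δ-zero : ∀ {x} → ¬ (x ≈ 0ℤ [ m ]) → δ m x ≡ 0ℤ
    δ-zero {x} ¬p with x %ℕ m | residue {m} x
    ... | zero  | p = contradiction (≈-sym p) ¬p
    ... | suc _ | _ = refl

    δ-values : ∀ x → δ m x ≡ 0ℤ ⊎ δ m x ≡ 1ℤ
    δ-values x with x %ℕ m
    ... | zero  = inj₂ refl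
    ... | suc _ = inj₁ refl

  infixl 6 _⊕_
  _⊕_ : Vec → Vec → Vec
  ⟨ a , b , c ⟩ ⊕ ⟨ a′ , b′ , c′ ⟩ = ⟨ a + a′ , b + b′ , c + c′ ⟩

  infixr 7 _⊛_
  _⊛_ : ℤ → Vec → Vec
  q ⊛ ⟨ a , b , c ⟩ = ⟨ q * a , q * b , q * c ⟩

  -- Since 2k = 0 in ℤ₂ₖ, only the parity of the coefficient of k matters.
  mod₂ : Vec → Vec
  mod₂ ⟨ a , b , c ⟩ = ⟨ a , b , + (c %ℕ 2) ⟩

  infix 4 _≟ᵛ_
  _≟ᵛ_ : (u v : Vec) → Maybe (u ≡ v)
  ⟨ a , b , c ⟩ ≟ᵛ ⟨ a′ , b′ , c′ ⟩ with a ℤ.≟ a′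
  ... | no _ = nothing
  ... | yes refl with b ℤ.≟ b′
  ... | no _ = nothing
  ... | yes refl with c ℤ.≟ c′
  ... | no _ = nothing
  ... | yes refl = just refl

  -- An element of the group ring of ℤ³: a formal sum of voltages before r, s and k receive values.
  Poly : Set
  Poly = List (ℤ × Vec)

  insert : ℤ → Vec → Poly → Poly
  insert c z [] = (c , z) ∷ []
  insert c z ((c′ , z′) ∷ p) with z ≟ᵛ z′
  ... | just _  = (c + c′ , z′) ∷ p
  ... | nothing = (c′ , z′) ∷ insert c z p

  -- Group-ring arithmetic: q xᵛ p + `acc`.
  addScaled : ℤ → Vec → Poly → Poly → Poly
  addScaled q v [] acc = acc
  addScaled q v ((c , z) ∷ p) acc = insert (q * c) (mod₂ (z ⊕ v)) (addScaled q v p acc)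

  -- A 3 × 3 matrix over the group ring. It is stored in vectors, not as a function, so that the
  -- recurrence reuses entries instead of recomputing them.
  Table : Set
  Table = V.Vec (V.Vec Poly 3) 3

  infix 8 _⟦_,_⟧
  _⟦_,_⟧ : Table → Fin 3 → Fin 3 → Poly
  T ⟦ x , y ⟧ = lookup (lookup T x) y

  table : (Fin 3 → Fin 3 → Poly) → Table
  table f = tabulate (λ x → tabulate (f x))

  𝟎 : Vec
  𝟎 = ⟨ + 0 , + 0 , + 0 ⟩

  module _ (t : Type) where
    stepPoly : Table → Poly → Fin 3 → Fin 3 → Poly
    stepPoly P acc x y = go 0F (go 1F (go 2F acc))
      where go : Fin 3 → Poly → Poly
            go d = addScaled 1ℤ (volt t x d) (P ⟦ head t x d , y ⟧)

    table₀ table₁ : Table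
    table₀ = table λ where
      0F 0F → (1ℤ , 𝟎) ∷ []
      1F 1F → (1ℤ , 𝟎) ∷ []
      2F 2F → (1ℤ , 𝟎) ∷ []
      _  _  → []
    table₁ = table (stepPoly table₀ [])

    next : Table → Table → Table
    next P Q = table (λ x y → stepPoly P (addScaled (- (+ 2)) 𝟎 (Q ⟦ x , y ⟧) []) x y)

    tablesFrom : ℕ → Table → Table → List Table
    tablesFrom zero    Q P = []
    tablesFrom (suc f) Q P = Q ∷ tablesFrom f P (next P Q)

    tables : ℕ → List Table
    tables f = tablesFrom f table₀ table₁

  nth : ∀ {A : Set} → List A → ℕ → Maybe A
  nth []       _       = nothing
  nth (x ∷ xs) zero    = just x
  nth (x ∷ xs) (suc i) = nth xs i

  module Evaluate (k : ℕ) .{{_ : NonZero (2 ℕ.* k)}} (r s : ℤ) where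
    val : Vec → ℤ
    val = value k r s

    -- The coefficient of the group element `g` in the image of the formal sum in the group ring of
    -- ℤ₂ₖ.
    eval : ℤ → Poly → ℤ
    eval g [] = 0ℤ
    eval g ((c , z) ∷ p) = c * δ (2 ℕ.* k) (val z - g) + eval g p

    val-⊕ : ∀ u v → val (u ⊕ v) ≡ val u + val v
    val-⊕ ⟨ a , b , c ⟩ ⟨ a′ , b′ , c′ ⟩ = lem a b c a′ b′ c′ r s (+ k)
      where lem : ∀ a b c a′ b′ c′ r s k → (a + a′) * r + (b + b′) * s + (c + c′) * k ≡
                                           a * r + b * s + c * k + (a′ * r + b′ * s + c′ * k)
            lem = solve-∀

    val-⊛ : ∀ q u → val (q ⊛ u) ≡ q * val u
    val-⊛ q ⟨ a , b , c ⟩ = lem q a b c r s (+ k)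
      where lem : ∀ q a b c r s k → q * a * r + q * b * s + q * c * k ≡ q * (a * r + b * s + c * k)
            lem = solve-∀

    val-𝟎 : val 𝟎 ≡ 0ℤ
    val-𝟎 = lem r s (+ k)
      where lem : ∀ r s k → 0ℤ * r + 0ℤ * s + 0ℤ * k ≡ 0ℤ
            lem = solve-∀

    val-mod₂ : ∀ u → val (mod₂ u) ≈ val u [ 2 ℕ.* k ]
    val-mod₂ ⟨ a , b , c ⟩ = +-congˡ-≈ (a * r + b * s) (lemma (+ (c %ℕ 2)) c (residue {2} c))
      where lem : ∀ c q k → (c + q * + 2) * k ≡ c * k + q * (+ 2 * k)
            lem = solve-∀
            lemma : ∀ x y → x ≈ y [ 2 ] → x * + k ≈ y * + k [ 2 ℕ.* k ]
            lemma _ y (by q refl) = by q (trans (lem y q (+ k)) (cong (λ t → y * + k + q * t) (sym (ℤ.pos-* 2 k))))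

    eval-insert : ∀ g c z p → eval g (insert c z p) ≡ c * δ (2 ℕ.* k) (val z - g) + eval g p
    eval-insert g c z [] = refl
    eval-insert g c z ((c′ , z′) ∷ p) with z ≟ᵛ z′
    ... | just refl = lem c c′ _ _
      where lem : ∀ c c′ d e → (c + c′) * d + e ≡ c * d + (c′ * d + e)
            lem = solve-∀
    ... | nothing = trans (cong (λ e → c′ * δ (2 ℕ.* k) (val z′ - g) + e) (eval-insert g c z p))
                    (lem (c′ * δ (2 ℕ.* k) (val z′ - g)) (c * δ (2 ℕ.* k) (val z - g)) (eval g p))
      where lem : ∀ a b c → a + (b + c) ≡ b + (a + c)
            lem = solve-∀

    eval-addScaled : ∀ g q v p acc → eval g (addScaled q v p acc) ≡ q * eval (g - val v) p + eval g acc
    eval-addScaled g q v [] acc = lem q _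
      where lem : ∀ q a → a ≡ q * 0ℤ + a
            lem = solve-∀
    eval-addScaled g q v ((c , z) ∷ p) acc =
      trans (eval-insert g (q * c) (mod₂ (z ⊕ v)) (addScaled q v p acc))
        (trans (cong₂ (λ d e → q * c * d + e) (δ-cong shift) (eval-addScaled g q v p acc)) (lem q c _ _ _))
      where
        lem : ∀ q c d e a → q * c * d + (q * e + a) ≡ q * (c * d + e) + a
        lem = solve-∀
        lem′ : ∀ z v g → z + v - g ≡ z - (g - v)
        lem′ = solve-∀
        shift : val (mod₂ (z ⊕ v)) - g ≈ val z - (g - val v) [ 2 ℕ.* k ]
        shift = ≈-trans (+-congʳ-≈ (- g) (≈-trans (val-mod₂ (z ⊕ v)) (≈-reflexive (val-⊕ z v)))) (≈-reflexive (lem′ (val z) (val v) g))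

    lookup-table : ∀ f x y → table f ⟦ x , y ⟧ ≡ f x y
    lookup-table f x y = trans (cong (λ v → lookup v y) (lookup∘tabulate (λ x → tabulate (f x)) x)) (lookup∘tabulate (f x) y)

    module _ {t n} {G : Graph n} (M : Model t G k r s) where
      open Model M

      N : Fin n → Fin 3 → Fin n
      N x = let (a , i , _) = V-surj x in nb a i

      N-V : ∀ a i d → N (V a i) d ≡ nb a i d
      N-V a i d with V-surj (V a i)
      ... | b , j , e with V-inj e
      ... | refl , p = nb-cong a d p

      open Count N

      -- By translation a count depends on j - i only, so nine formal sums describe all pairs of
      -- vertices.
      Represents : ℕ → Table → Set
      Represents L T = ∀ x y i j → count L (V x i) (V y j) ≡ eval (j - i) (T ⟦ x , y ⟧)

      private
        equal-yes : ∀ {x y} → x ≡ y → equal x y ≡ 1ℤ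
        equal-yes {x} {y} e with x F.≟ y
        ... | yes _ = refl
        ... | no ¬e = contradiction e ¬e

        equal-no : ∀ {x y} → x ≢ y → equal x y ≡ 0ℤ
        equal-no {x} {y} ¬e with x F.≟ y
        ... | yes e = contradiction e ¬e
        ... | no _  = refl

        diff≈0 : ∀ {i j} → i ≈ j [ 2 ℕ.* k ] → 0ℤ - (j - i) ≈ 0ℤ [ 2 ℕ.* k ]
        diff≈0 {i} {j} p = ≈-trans (≈-reflexive (lem i j)) (≈-trans (+-congʳ-≈ (- j) p) (≈-reflexive (ℤ.+-inverseʳ j)))
          where lem : ∀ i j → 0ℤ - (j - i) ≡ i - j
                lem = solve-∀

        ≈-diff0 : ∀ {i j} → 0ℤ - (j - i) ≈ 0ℤ [ 2 ℕ.* k ] → i ≈ j [ 2 ℕ.* k ]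
        ≈-diff0 {i} {j} p = ≈-trans (≈-reflexive (lem i j)) (≈-trans (+-congˡ-≈ j p) (≈-reflexive (ℤ.+-identityʳ j)))
          where lem : ∀ i j → i ≡ j + (0ℤ - (j - i))
                lem = solve-∀

        diagonal : ∀ x i j → equal (V x i) (V x j) ≡ eval (j - i) ((1ℤ , 𝟎) ∷ [])
        diagonal x i j with ≈? (2 ℕ.* k) i j
        ... | yes p = trans (equal-yes (V-cong x p)) (sym (cong (λ d → 1ℤ * d + 0ℤ)
                        (δ-one (≈-trans (≈-reflexive (cong (_- (j - i)) val-𝟎)) (diff≈0 p)))))
        ... | no ¬p = trans (equal-no (λ e → ¬p (proj₂ (V-inj e)))) (sym (cong (λ d → 1ℤ * d + 0ℤ)
                        (δ-zero (λ p → ¬p (≈-diff0 (≈-trans (≈-reflexive (cong (_- (j - i)) (sym val-𝟎))) p))))))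

      represents₀ : Represents 0 (table₀ t)
      represents₀ 0F 0F i j = diagonal 0F i j
      represents₀ 1F 1F i j = diagonal 1F i j
      represents₀ 2F 2F i j = diagonal 2F i j
      represents₀ 0F 1F i j = equal-no (λ e → contradiction (proj₁ (V-inj e)) λ ())
      represents₀ 0F 2F i j = equal-no (λ e → contradiction (proj₁ (V-inj e)) λ ())
      represents₀ 1F 0F i j = equal-no (λ e → contradiction (proj₁ (V-inj e)) λ ())
      represents₀ 1F 2F i j = equal-no (λ e → contradiction (proj₁ (V-inj e)) λ ())
      represents₀ 2F 0F i j = equal-no (λ e → contradiction (proj₁ (V-inj e)) λ ())
      represents₀ 2F 1F i j = equal-no (λ e → contradiction (proj₁ (V-inj e)) λ ())

      sum-step : ∀ L P → Represents L P → ∀ acc x y i j →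
                 sum₃ (λ d → count L (N (V x i) d) (V y j)) + eval (j - i) acc ≡ eval (j - i) (stepPoly t P acc x y)
      sum-step L P rep acc x y i j = trans (cong (_+ eval (j - i) acc) (sum₃-cong term)) (sym
        (trans (eval-addScaled g 1ℤ (volt t x 0F) (p 0F) acc₁)
          (trans (cong (λ h → 1ℤ * e 0F + h) (trans (eval-addScaled g 1ℤ (volt t x 1F) (p 1F) acc₂)
            (cong (λ h → 1ℤ * e 1F + h) (eval-addScaled g 1ℤ (volt t x 2F) (p 2F) acc))))
          (lem (e 0F) (e 1F) (e 2F) (eval g acc)))))
        where
          g = j - i
          p : Fin 3 → Poly
          p d = P ⟦ head t x d , y ⟧
          acc₂ = addScaled 1ℤ (volt t x 2F) (p 2F) acc
          acc₁ = addScaled 1ℤ (volt t x 1F) (p 1F) acc₂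
          e : Fin 3 → ℤ
          e d = eval (g - val (volt t x d)) (P ⟦ head t x d , y ⟧)
          lem : ∀ a b c d → 1ℤ * a + (1ℤ * b + (1ℤ * c + d)) ≡ a + b + c + d
          lem = solve-∀
          lem′ : ∀ i j v → j - (i + v) ≡ j - i - v
          lem′ = solve-∀
          term : ∀ d → count L (N (V x i) d) (V y j) ≡ e d
          term d = trans (cong (λ z → count L z (V y j)) (N-V x i d))
                     (trans (rep (head t x d) y _ j) (cong (λ h → eval h (P ⟦ head t x d , y ⟧)) (lem′ i j _)))

      represents₁ : Represents 1 (table₁ t)
      represents₁ x y i j = trans (sym (ℤ.+-identityʳ _)) (trans (sum-step 0 (table₀ t) represents₀ [] x y i j)
        (cong (eval (j - i)) (sym (lookup-table (stepPoly t (table₀ t) []) x y))))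

      represents-next : ∀ {L P Q} → Represents L Q → Represents (suc L) P → Represents (suc (suc L)) (next t P Q)
      represents-next {L} {P} {Q} repQ repP x y i j =
        trans (cong (λ e → sum₃ (λ d → count (suc L) (N (V x i) d) (V y j)) + e)
                (trans (cong (λ e → - (+ 2) * e) (repQ x y i j)) (sym (trans (eval-addScaled (j - i) (- (+ 2)) 𝟎 (Q ⟦ x , y ⟧) [])
                   (trans (ℤ.+-identityʳ _) (cong (λ h → - (+ 2) * eval h (Q ⟦ x , y ⟧)) (trans (cong (λ h → j - i - h) val-𝟎) (ℤ.+-identityʳ _))))))))
          (trans (sum-step (suc L) P repP _ x y i j) (cong (eval (j - i)) (sym (lookup-table (λ x y → stepPoly t P (addScaled (- (+ 2)) 𝟎 (Q ⟦ x , y ⟧) []) x y) x y))))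

      represents-from : ∀ f {L Q P} → Represents L Q → Represents (suc L) P →
                        ∀ i {T} → nth (tablesFrom t f Q P) i ≡ just T → Represents (i ℕ.+ L) T
      represents-from (suc f) repQ repP zero    refl = repQ
      represents-from (suc f) {L} {Q} {P} repQ repP (suc i) {T} e =
        subst (λ l → Represents l T) (ℕ.+-suc i L) (represents-from f repP (represents-next {L} {P} {Q} repQ repP) i e)

      represents : ∀ f L {T} → nth (tables t f) L ≡ just T → Represents L T
      represents f L {T} e = subst (λ l → Represents l T) (ℕ.+-identityʳ L) (represents-from f represents₀ represents₁ L e)

  -- Checking case analyses

  -- Lattice vectors known to have value 0, each with the coordinate it is used to reduce.
  Basis : Set
  Basis = List (Fin 3 × Vec)

  coord : Fin 3 → Vec → ℤ
  coord 0F = Vec.α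
  coord 1F = Vec.β
  coord 2F = Vec.γ

  quot : ℤ → ℤ → ℤ
  quot a b with ∣ b ∣
  ... | zero  = 0ℤ
  ... | suc n = a /ℕ suc n

  -- Division with remainder, pivot by pivot. The bases that occur are in echelon form with positive
  -- pivots, so this gives a normal form modulo their span; for soundness any quotient would do.
  reduce : Basis → Vec → Vec
  reduce [] z = z
  reduce ((i , p) ∷ B) z = reduce B (z ⊕ - quot (coord i z) (coord i p) ⊛ p)

  vanishes : Basis → Vec → Bool
  vanishes B z = is-just (reduce B z ≟ᵛ 𝟎)

  member : Vec → List Vec → Bool
  member z [] = false
  member z (y ∷ ys) = is-just (z ≟ᵛ y) ∨ member z ys

  reps : Basis → List Vec → List Vec
  reps B [] = []
  reps B (y ∷ ys) = reduce B y ∷ reduce B (- 1ℤ ⊛ y) ∷ reps B ys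

  -- If z vanished, so would all its multiples. Hence a multiple of z that agrees with a voltage
  -- known not to vanish shows that z does not vanish either; `classify` tries the multiples up to
  -- 6.
  anyMultiple : Basis → List Vec → ℕ → Vec → Bool
  anyMultiple B R zero    z = false
  anyMultiple B R (suc j) z = member (reduce B (+ suc j ⊛ z)) R ∨ anyMultiple B R j z

  data Status : Set where
    isZero isNonzero : Status
    unknown          : Vec → Status

  classify : Basis → List Vec → Vec → Status
  classify B R z = go (reduce B z)
    where go : Vec → Status
          go z′ = if is-just (z′ ≟ᵛ 𝟎) then isZero else if anyMultiple B R 6 z′ then isNonzero else unknown z′

  -- At the group element 0 only the vanishing of a voltage counts, and z vanishes exactly when -z
  -- does. Merging the two terms sharpens the interval.
  insert± : Vec → ℤ → Vec → Poly → Poly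
  insert± z⁻ c z [] = (c , z) ∷ []
  insert± z⁻ c z ((c′ , z′) ∷ p) =
    if is-just (z ≟ᵛ z′) ∨ is-just (z⁻ ≟ᵛ z′) then (c + c′ , z′) ∷ p else (c′ , z′) ∷ insert± z⁻ c z p

  collect : Basis → List Vec → Poly → ℤ × Poly
  collect B R [] = 0ℤ , []
  collect B R ((c , z) ∷ p) with collect B R p
  ... | c₀ , u with classify B R z
  ... | isZero     = c + c₀ , u
  ... | isNonzero  = c₀ , u
  ... | unknown z′ = c₀ , insert± (reduce B (- 1ℤ ⊛ z′)) c z′ u

  lowest highest : Poly → ℤ
  lowest [] = 0ℤ
  lowest ((c , _) ∷ p) = c ⊓ 0ℤ + lowest p
  highest [] = 0ℤ
  highest ((c , _) ∷ p) = c ⊔ 0ℤ + highest p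

  -- Each undecided indicator is treated as an independent 0 or 1, which gives bounds valid for all
  -- k, r and s of the current branch.
  interval : Basis → List Vec → Poly → ℤ × ℤ
  interval B R p with collect B R p
  ... | c₀ , u = c₀ + lowest u , c₀ + highest u

  -- A case analysis on the vanishing of voltages.  In `split z rows`, used when z vanishes, a row
  -- (i , p , c) is a new basis vector p lying in the span of the old basis plus c z.  A leaf
  -- `tally L x y` is contradictory, since the closed walk counts of length L at x and y differ;
  -- `small e` bounds k by e; `vanish v` reaches a family; `sign L τ` says that the walk count of
  -- length L is at least τ along dart 0 of every vertex and less than τ along darts 1 and 2.
  data Tree : Set where
    split : Vec → List (Fin 3 × Vec × ℤ) → Tree → Tree → Tree
    tally : ℕ → Fin 3 → Fin 3 → Tree
    small : ℕ → ℤ → ℤ → Tree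
    vanish : Vec → Tree
    sign  : ℕ → ℤ → Tree

  difference : Poly → Poly → Poly
  difference p q = p ++ addScaled (- 1ℤ) 𝟎 q []

  excludesZero : ℤ × ℤ → Bool
  excludesZero (lo , hi) = (1ℤ ≤ᵇ lo) ∨ (hi ≤ᵇ - 1ℤ)

  checkRows : Basis → Vec → List (Fin 3 × Vec × ℤ) → Bool
  checkRows B z [] = true
  checkRows B z ((_ , p , c) ∷ rows) = vanishes B (p ⊕ - c ⊛ z) ∧ checkRows B z rows

  newBasis : List (Fin 3 × Vec × ℤ) → Basis
  newBasis [] = []
  newBasis ((i , p , _) ∷ rows) = (i , p) ∷ newBasis rows

  -- The largest k for which the parameters are enumerated.
  limit : Type → ℕ
  limit t1 = 9
  limit t2 = 10
  limit t3 = 0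
  limit t4 = 5

  module Check (t : Type) (ts : List Table) (allowed : List Vec) where
    -- Shifting by the voltage of the dart turns a count between neighbours into a coefficient at 0,
    -- where `interval` applies.
    alongDart : Table → Fin 3 → Fin 3 → Poly
    alongDart T x d = addScaled 1ℤ (- 1ℤ ⊛ volt t x d) (T ⟦ x , head t x d ⟧) []

    checkCount : Basis → List Vec → Fin 3 → Fin 3 → Maybe Table → Bool
    checkCount B R x y nothing  = false
    checkCount B R x y (just T) = excludesZero (interval B R (difference (T ⟦ x , x ⟧) (T ⟦ y , y ⟧)))

    sigAt : Basis → List Vec → ℤ → Table → Fin 3 → Bool
    sigAt B R τ T x = (τ ≤ᵇ proj₁ (interval B R (alongDart T x 0F)))
                    ∧ (ℤ.suc (proj₂ (interval B R (alongDart T x 1F))) ≤ᵇ τ)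
                    ∧ (ℤ.suc (proj₂ (interval B R (alongDart T x 2F))) ≤ᵇ τ)

    checkSig : Basis → List Vec → ℤ → Maybe Table → Bool
    checkSig B R τ nothing  = false
    checkSig B R τ (just T) = sigAt B R τ T 0F ∧ sigAt B R τ T 1F ∧ sigAt B R τ T 2F

    check : Basis → List Vec → Tree → Bool
    check B N (split z rows Z NZ) = checkRows B z rows ∧ check (newBasis rows) N Z ∧ check B (z ∷ N) NZ
    check B N (tally L x y)       = checkCount B (reps B N) x y (nth ts L)
    -- Here e r and e s are multiples of k. As r and s generate ℤₖ by connectedness, k divides e.
    check B N (small e γ γ′)      = (e ℕ.≤ᵇ limit t) ∧ (1 ℕ.≤ᵇ e) ∧ vanishes B ⟨ + e , 0ℤ , γ ⟩ ∧ vanishes B ⟨ 0ℤ , + e , γ′ ⟩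
    check B N (vanish v)             = member v allowed ∧ vanishes B v
    -- Signatures are accepted only in the second round, where the relation of the family is already
    -- in the basis and `allowed` is empty.
    check B N (sign L τ)           = null allowed ∧ checkSig B (reps B N) τ (nth ts L)

  -- Soundness of the checker

  ∧-true : ∀ {a b} → a ∧ b ≡ true → a ≡ true × b ≡ true
  ∧-true {true} {true} _ = refl , refl

  ∨-true : ∀ {a b} → a ∨ b ≡ true → a ≡ true ⊎ b ≡ true
  ∨-true {true}  _ = inj₁ refl
  ∨-true {false} p = inj₂ p

  ≤ᵇ-true : ∀ {i j} → (i ≤ᵇ j) ≡ true → i ℤ.≤ j
  ≤ᵇ-true e = ℤ.≤ᵇ⇒≤ (subst T (sym e) tt)

  ℕ≤ᵇ-true : ∀ {i j} → (i ℕ.≤ᵇ j) ≡ true → i ℕ.≤ j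
  ℕ≤ᵇ-true {i} {j} e = ℕ.≤ᵇ⇒≤ i j (subst T (sym e) tt)

  ≟ᵛ-true : ∀ {u v} → is-just (u ≟ᵛ v) ≡ true → u ≡ v
  ≟ᵛ-true {u} {v} e with u ≟ᵛ v
  ... | just p = p

  member-true : ∀ {z ys} → member z ys ≡ true → z ∈ ys
  member-true {z} {y ∷ ys} e with ∨-true {is-just (z ≟ᵛ y)} e
  ... | inj₁ p = here (≟ᵛ-true p)
  ... | inj₂ p = there (member-true p)

  module Soundness (k : ℕ) .{{_ : NonZero (2 ℕ.* k)}} (r s : ℤ) where
    open Evaluate k r s

    Zero : Vec → Set
    Zero v = val v ≈ 0ℤ [ 2 ℕ.* k ]

    ev : Poly → ℤ
    ev = eval 0ℤ

    ev-cons : ∀ c z p → ev ((c , z) ∷ p) ≡ c * δ (2 ℕ.* k) (val z) + ev p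
    ev-cons c z p = cong (λ v → c * δ (2 ℕ.* k) v + ev p) (ℤ.+-identityʳ (val z))

    val-neg : ∀ z → val (- 1ℤ ⊛ z) ≡ - val z
    val-neg z = trans (val-⊛ (- 1ℤ) z) (ℤ.-1*i≡-i (val z))

    Zero-⊛ : ∀ q {z} → Zero z → Zero (q ⊛ z)
    Zero-⊛ q {z} p = ≈-trans (≈-reflexive (val-⊛ q z)) (≈-trans (*-congˡ-≈ q p) (≈-reflexive (ℤ.*-zeroʳ q)))

    Zero-neg : ∀ {z} → Zero (- 1ℤ ⊛ z) → Zero z
    Zero-neg {z} p = ≈-trans (≈-reflexive (trans (sym (ℤ.neg-involutive (val z))) (cong -_ (sym (val-neg z))))) (neg-cong-≈ p)

    AllZero : Basis → Set
    AllZero = All (λ (_ , p) → Zero p)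

    module _ {B : Basis} (B0 : AllZero B) where
      reduce-val : ∀ z → val (reduce B z) ≈ val z [ 2 ℕ.* k ]
      reduce-val = go B0
        where
          go : ∀ {B} → AllZero B → ∀ z → val (reduce B z) ≈ val z [ 2 ℕ.* k ]
          go [] z = ≈-refl
          go {(i , p) ∷ B} (p0 ∷ B0) z = ≈-trans (go B0 _) (≈-trans (≈-reflexive (val-⊕ z _))
            (≈-trans (+-congˡ-≈ (val z) (Zero-⊛ (- quot (coord i z) (coord i p)) {p} p0)) (≈-reflexive (ℤ.+-identityʳ (val z)))))

      vanishes-true : ∀ {z} → vanishes B z ≡ true → Zero z
      vanishes-true {z} e = ≈-trans (≈-sym (reduce-val z)) (≈-reflexive (trans (cong val (≟ᵛ-true e)) val-𝟎))

      reps-nonzero : ∀ {N} → All (λ v → ¬ Zero v) N → All (λ v → ¬ Zero v) (reps B N)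
      reps-nonzero [] = []
      reps-nonzero {y ∷ _} (n ∷ ns) = (λ p → n (≈-trans (≈-sym (reduce-val y)) p))
        ∷ (λ p → n (Zero-neg {y} (≈-trans (≈-sym (reduce-val (- 1ℤ ⊛ y))) p))) ∷ reps-nonzero ns

      module _ {R : List Vec} (R≉0 : All (λ v → ¬ Zero v) R) where
        anyMultiple-true : ∀ j z → anyMultiple B R j z ≡ true → ¬ Zero z
        anyMultiple-true (suc j) z e p with ∨-true {member (reduce B (+ suc j ⊛ z)) R} e
        ... | inj₁ m = All.lookup R≉0 (member-true m) (≈-trans (reduce-val (+ suc j ⊛ z)) (Zero-⊛ (+ suc j) {z} p))
        ... | inj₂ e′ = anyMultiple-true j z e′ p

        Sound : Vec → Status → Set
        Sound z isZero       = Zero z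
        Sound z isNonzero    = ¬ Zero z
        Sound z (unknown z′) = val z′ ≈ val z [ 2 ℕ.* k ]

        classify-sound : ∀ z → Sound z (classify B R z)
        classify-sound z with is-just (reduce B z ≟ᵛ 𝟎) in e₁
        ... | true = vanishes-true e₁
        ... | false with anyMultiple B R 6 (reduce B z) in e₂
        ... | true  = λ p → anyMultiple-true 6 (reduce B z) e₂ (≈-trans (reduce-val z) p)
        ... | false = reduce-val z

        ev-insert± : ∀ c z p → ev (insert± (reduce B (- 1ℤ ⊛ z)) c z p) ≡ c * δ (2 ℕ.* k) (val z) + ev p
        ev-insert± c z [] = ev-cons c z []
        ev-insert± c z ((c′ , z′) ∷ p) with is-just (z ≟ᵛ z′) ∨ is-just (reduce B (- 1ℤ ⊛ z) ≟ᵛ z′) in e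
        ... | true = trans (ev-cons (c + c′) z′ p) (trans (lem c c′ _ (ev p))
                       (cong₂ (λ d f → c * d + f) (sym same) (sym (ev-cons c′ z′ p))))
          where
            lem : ∀ c c′ d e → (c + c′) * d + e ≡ c * d + (c′ * d + e)
            lem = solve-∀
            δ-neg : ∀ x → δ (2 ℕ.* k) (- x) ≡ δ (2 ℕ.* k) x
            δ-neg x with ≈? (2 ℕ.* k) x 0ℤ
            ... | yes q = trans (δ-one (neg-cong-≈ q)) (sym (δ-one q))
            ... | no ¬q = trans (δ-zero (λ q → ¬q (≈-trans (≈-reflexive (sym (ℤ.neg-involutive x))) (neg-cong-≈ q)))) (sym (δ-zero ¬q))
            same : δ (2 ℕ.* k) (val z) ≡ δ (2 ℕ.* k) (val z′)
            same with ∨-true {is-just (z ≟ᵛ z′)} e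
            ... | inj₁ q = cong (δ (2 ℕ.* k) ∘ val) (≟ᵛ-true q)
            ... | inj₂ q = trans (sym (δ-neg (val z))) (δ-cong (≈-trans (≈-reflexive (sym (val-neg z)))
                             (≈-trans (≈-sym (reduce-val (- 1ℤ ⊛ z))) (≈-reflexive (cong val (≟ᵛ-true q))))))
        ... | false = trans (ev-cons c′ z′ (insert± (reduce B (- 1ℤ ⊛ z)) c z p)) (trans (cong (λ f → c′ * δ (2 ℕ.* k) (val z′) + f) (ev-insert± c z p))
                        (trans (lem (c′ * δ (2 ℕ.* k) (val z′)) (c * δ (2 ℕ.* k) (val z)) (ev p))
                          (cong (λ f → c * δ (2 ℕ.* k) (val z) + f) (sym (ev-cons c′ z′ p)))))
          where
            lem : ∀ a b c → a + (b + c) ≡ b + (a + c)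
            lem = solve-∀

        collect-sound : ∀ p → ev p ≡ proj₁ (collect B R p) + ev (proj₂ (collect B R p))
        collect-sound [] = refl
        collect-sound ((c , z) ∷ p) with collect B R p | collect-sound p
        ... | c₀ , u | ih with classify B R z | classify-sound z
        ... | isZero | p0 = trans (ev-cons c z p) (trans (cong₂ (λ d f → c * d + f) (δ-one p0) ih) (lem c c₀ (ev u)))
          where lem : ∀ c d e → c * 1ℤ + (d + e) ≡ c + d + e
                lem = solve-∀
        ... | isNonzero | p≉0 = trans (ev-cons c z p) (trans (cong₂ (λ d f → c * d + f) (δ-zero p≉0) ih) (lem c c₀ (ev u)))
          where lem : ∀ c d e → c * 0ℤ + (d + e) ≡ d + e
                lem = solve-∀
        ... | unknown z′ | q = trans (ev-cons c z p) (trans (cong₂ (λ d f → c * d + f) (δ-cong (≈-sym q)) ih)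
                (trans (lem (c * δ (2 ℕ.* k) (val z′)) c₀ (ev u)) (cong (λ f → c₀ + f) (sym (ev-insert± c z′ u)))))
          where lem : ∀ a d e → a + (d + e) ≡ d + (a + e)
                lem = solve-∀

        lowest≤ : ∀ p → lowest p ℤ.≤ ev p
        lowest≤ [] = ℤ.≤-refl
        lowest≤ ((c , z) ∷ p) with δ-values {2 ℕ.* k} (val z)
        ... | inj₁ e = subst (c ⊓ 0ℤ + lowest p ℤ.≤_) (sym (trans (ev-cons c z p) (cong (λ d → d + ev p) (trans (cong (c *_) e) (ℤ.*-zeroʳ c)))))
                         (ℤ.+-mono-≤ (ℤ.i⊓j≤j c 0ℤ) (lowest≤ p))
        ... | inj₂ e = subst (c ⊓ 0ℤ + lowest p ℤ.≤_) (sym (trans (ev-cons c z p) (cong (λ d → d + ev p) (trans (cong (c *_) e) (ℤ.*-identityʳ c)))))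
                         (ℤ.+-mono-≤ (ℤ.i⊓j≤i c 0ℤ) (lowest≤ p))

        ≤highest : ∀ p → ev p ℤ.≤ highest p
        ≤highest [] = ℤ.≤-refl
        ≤highest ((c , z) ∷ p) with δ-values {2 ℕ.* k} (val z)
        ... | inj₁ e = subst (ℤ._≤ c ⊔ 0ℤ + highest p) (sym (trans (ev-cons c z p) (cong (λ d → d + ev p) (trans (cong (c *_) e) (ℤ.*-zeroʳ c)))))
                         (ℤ.+-mono-≤ (ℤ.i≤j⊔i c 0ℤ) (≤highest p))
        ... | inj₂ e = subst (ℤ._≤ c ⊔ 0ℤ + highest p) (sym (trans (ev-cons c z p) (cong (λ d → d + ev p) (trans (cong (c *_) e) (ℤ.*-identityʳ c)))))
                         (ℤ.+-mono-≤ (ℤ.i≤i⊔j c 0ℤ) (≤highest p))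

        interval-sound : ∀ p → proj₁ (interval B R p) ℤ.≤ ev p × ev p ℤ.≤ proj₂ (interval B R p)
        interval-sound p with collect B R p | collect-sound p
        ... | c₀ , u | e = subst (c₀ + lowest u ℤ.≤_) (sym e) (ℤ.+-monoʳ-≤ c₀ (lowest≤ u))
                         , subst (ℤ._≤ c₀ + highest u) (sym e) (ℤ.+-monoʳ-≤ c₀ (≤highest u))

    ev-++ : ∀ p q → ev (p ++ q) ≡ ev p + ev q
    ev-++ [] q = sym (ℤ.+-identityˡ (ev q))
    ev-++ ((c , z) ∷ p) q = trans (cong (λ e → c * δ (2 ℕ.* k) (val z - 0ℤ) + e) (ev-++ p q)) (sym (ℤ.+-assoc (c * δ (2 ℕ.* k) (val z - 0ℤ)) (ev p) (ev q)))

    ev-difference : ∀ p q → ev p ≡ ev q → ev (difference p q) ≡ 0ℤ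
    ev-difference p q e = trans (ev-++ p (addScaled (- 1ℤ) 𝟎 q [])) (trans (cong₂ _+_ e (trans (eval-addScaled 0ℤ (- 1ℤ) 𝟎 q [])
      (cong (λ v → - 1ℤ * eval (0ℤ - v) q + 0ℤ) val-𝟎))) (lem (ev q)))
      where lem : ∀ a → a + (- 1ℤ * a + 0ℤ) ≡ 0ℤ
            lem = solve-∀

    module _ (t : Type) (ts : List Table) (allowed : List Vec) where
      open Check t ts allowed

      Signature : ℕ → ℤ → Set
      Signature L τ = ∃ λ T → nth ts L ≡ just T × (∀ x → τ ℤ.≤ eval (val (volt t x 0F)) (T ⟦ x , head t x 0F ⟧)
        × (∀ d → d ≢ 0F → eval (val (volt t x d)) (T ⟦ x , head t x d ⟧) ℤ.< τ))

      data Outcome : Set where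
        bounded  : ∀ e → 1 ℕ.≤ e → e ℕ.≤ limit t → + e * r ≈ 0ℤ [ k ] → + e * s ≈ 0ℤ [ k ] → Outcome
        relation : ∀ v → v ∈ allowed → Zero v → Outcome
        signed   : null allowed ≡ true → ∀ L τ → Signature L τ → Outcome

      ev-alongDart : ∀ T x d → ev (alongDart T x d) ≡ eval (val (volt t x d)) (T ⟦ x , head t x d ⟧)
      ev-alongDart T x d = trans (eval-addScaled 0ℤ 1ℤ (- 1ℤ ⊛ volt t x d) p [])
        (trans (cong (λ v → 1ℤ * eval (0ℤ - v) p + 0ℤ) (val-neg (volt t x d)))
          (trans (lem (eval (0ℤ - - val (volt t x d)) p)) (cong (λ g → eval g p) (lem′ (val (volt t x d))))))
        where p = T ⟦ x , head t x d ⟧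
              lem : ∀ a → 1ℤ * a + 0ℤ ≡ a
              lem = solve-∀
              lem′ : ∀ a → 0ℤ - - a ≡ a
              lem′ = solve-∀

      module _ (equalCounts : ∀ L T → nth ts L ≡ just T → ∀ x y → ev (T ⟦ x , x ⟧) ≡ ev (T ⟦ y , y ⟧)) where
        private
          rows-zero : ∀ {B z} → AllZero B → Zero z → ∀ rows → checkRows B z rows ≡ true → AllZero (newBasis rows)
          rows-zero B0 z0 [] e = []
          rows-zero {B} {z} B0 z0 ((i , p , c) ∷ rows) e =
            -- p = (p - c z) + c z, where the first summand lies in the span of the old basis and z
            -- vanishes in this branch.
            ≈-trans (≈-reflexive (lem (val p) (val (- c ⊛ z))))
              (≈-trans (+-cong-≈ (≈-trans (≈-reflexive (sym (val-⊕ p (- c ⊛ z)))) (vanishes-true B0 {p ⊕ - c ⊛ z} (proj₁ (∧-true {vanishes B (p ⊕ - c ⊛ z)} e))))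
                                 (neg-cong-≈ (Zero-⊛ (- c) {z} z0)))
                       ≈-refl)
            ∷ rows-zero B0 z0 rows (proj₂ (∧-true {vanishes B (p ⊕ - c ⊛ z)} e))
            where lem : ∀ a b → a ≡ a + b + - b
                  lem = solve-∀

          sound-count : ∀ {B N} → AllZero B → All (λ v → ¬ Zero v) N → ∀ L x y →
                        checkCount B (reps B N) x y (nth ts L) ≡ true → ⊥
          sound-count {B} {N} B0 N≉0 L x y e with nth ts L in eq
          ... | just T with interval-sound B0 (reps-nonzero B0 N≉0) (difference (T ⟦ x , x ⟧) (T ⟦ y , y ⟧))
                          | ev-difference (T ⟦ x , x ⟧) (T ⟦ y , y ⟧) (equalCounts L T eq x y)
          ... | lo , hi | z with ∨-true {1ℤ ≤ᵇ proj₁ (interval B (reps B N) (difference (T ⟦ x , x ⟧) (T ⟦ y , y ⟧)))} e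
          ... | inj₁ p with subst (1ℤ ℤ.≤_) z (ℤ.≤-trans (≤ᵇ-true p) lo)
          ... | ℤ.+≤+ ()
          sound-count {B} {N} B0 N≉0 L x y e | just T | lo , hi | z | inj₂ p with subst (ℤ._≤ - 1ℤ) z (ℤ.≤-trans hi (≤ᵇ-true p))
          ... | ()

          sound-sig : ∀ {B N} → AllZero B → All (λ v → ¬ Zero v) N → ∀ L τ →
                      checkSig B (reps B N) τ (nth ts L) ≡ true → Signature L τ
          sound-sig {B} {N} B0 N≉0 L τ e with nth ts L
          ... | just T = T , refl , at
            where
              Good : Fin 3 → Set
              Good x = τ ℤ.≤ eval (val (volt t x 0F)) (T ⟦ x , head t x 0F ⟧)
                     × (∀ d → d ≢ 0F → eval (val (volt t x d)) (T ⟦ x , head t x d ⟧) ℤ.< τ)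
              bound : ∀ x d → proj₁ (interval B (reps B N) (alongDart T x d)) ℤ.≤ eval (val (volt t x d)) (T ⟦ x , head t x d ⟧)
                            × eval (val (volt t x d)) (T ⟦ x , head t x d ⟧) ℤ.≤ proj₂ (interval B (reps B N) (alongDart T x d))
              bound x d with interval-sound B0 (reps-nonzero B0 N≉0) (alongDart T x d)
              ... | lo , hi = subst (_ ℤ.≤_) (ev-alongDart T x d) lo , subst (ℤ._≤ _) (ev-alongDart T x d) hi
              upper : ∀ x d → (ℤ.suc (proj₂ (interval B (reps B N) (alongDart T x d))) ≤ᵇ τ) ≡ true →
                      eval (val (volt t x d)) (T ⟦ x , head t x d ⟧) ℤ.< τ
              upper x d p = ℤ.suc[i]≤j⇒i<j (ℤ.≤-trans (ℤ.suc-mono (proj₂ (bound x d))) (≤ᵇ-true p))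
              good : ∀ x → sigAt B (reps B N) τ T x ≡ true → Good x
              good x e with ∧-true {τ ≤ᵇ proj₁ (interval B (reps B N) (alongDart T x 0F))} e
              ... | e₀ , e₁₂ with ∧-true {ℤ.suc (proj₂ (interval B (reps B N) (alongDart T x 1F))) ≤ᵇ τ} e₁₂
              ... | e₁ , e₂ = ℤ.≤-trans (≤ᵇ-true e₀) (proj₁ (bound x 0F)) , λ where
                    0F 0≢0 → contradiction refl 0≢0
                    1F _ → upper x 1F e₁
                    2F _ → upper x 2F e₂
              at : ∀ x → Good x
              at 0F = good 0F (proj₁ (∧-true {sigAt B (reps B N) τ T 0F} e))
              at 1F = good 1F (proj₁ (∧-true {sigAt B (reps B N) τ T 1F} (proj₂ (∧-true {sigAt B (reps B N) τ T 0F} e))))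
              at 2F = good 2F (proj₂ (∧-true {sigAt B (reps B N) τ T 1F} (proj₂ (∧-true {sigAt B (reps B N) τ T 0F} e))))

          -- Passing from modulus 2k to modulus k absorbs the multiple γ of k.
          multiple≈0 : ∀ a b c γ → val ⟨ a , b , γ ⟩ ≈ 0ℤ [ 2 ℕ.* k ] → a * r + b * s ≡ c → c ≈ 0ℤ [ k ]
          multiple≈0 a b c γ p refl = ≈-trans (by (- γ) (lem (a * r + b * s) γ (+ k))) (≈-coarsen 2 p)
            where lem : ∀ x g k → x ≡ x + g * k + - g * k
                  lem = solve-∀

        sound : ∀ {B N} → AllZero B → All (λ v → ¬ Zero v) N → ∀ tree → check B N tree ≡ true → Outcome
        sound {B} {N} B0 N≉0 (split z rows Z NZ) e with ∧-true {checkRows B z rows} e | ≈? (2 ℕ.* k) (val z) 0ℤ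
        ... | e₁ , e₂ | yes z0 = sound (rows-zero B0 z0 rows e₁) N≉0 Z (proj₁ (∧-true {check (newBasis rows) N Z} e₂))
        ... | e₁ , e₂ | no z≉0 = sound B0 (z≉0 ∷ N≉0) NZ (proj₂ (∧-true {check (newBasis rows) N Z} e₂))
        sound B0 N≉0 (tally L x y) e = ⊥-elim (sound-count B0 N≉0 L x y e)
        sound {B} B0 N≉0 (small m γ γ′) e with ∧-true {m ℕ.≤ᵇ limit t} e
        ... | e₁ , e′ with ∧-true {1 ℕ.≤ᵇ m} e′
        ... | e₂ , e″ with ∧-true {vanishes B ⟨ + m , 0ℤ , γ ⟩} e″
        ... | e₃ , e₄ = bounded m (ℕ≤ᵇ-true e₂) (ℕ≤ᵇ-true e₁)
                (multiple≈0 (+ m) 0ℤ (+ m * r) γ (vanishes-true B0 {⟨ + m , 0ℤ , γ ⟩} e₃) (lem (+ m * r) s))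
                (multiple≈0 0ℤ (+ m) (+ m * s) γ′ (vanishes-true B0 {⟨ 0ℤ , + m , γ′ ⟩} e₄) (lem′ (+ m * s) r))
          where lem : ∀ a s → a + 0ℤ * s ≡ a
                lem = solve-∀
                lem′ : ∀ a r → 0ℤ * r + a ≡ a
                lem′ = solve-∀
        sound {B} B0 N≉0 (vanish v) e with ∧-true {member v allowed} e
        ... | e₁ , e₂ = relation v (member-true e₁) (vanishes-true B0 e₂)
        sound B0 N≉0 (sign L τ) e = signed (proj₁ (∧-true {null allowed} e)) L τ (sound-sig B0 N≉0 L τ (proj₂ (∧-true {null allowed} e)))

  -- The case analyses

  private
    pattern +1 = + 1
    pattern +2 = + 2
    pattern +3 = + 3
    pattern +4 = + 4
    pattern +5 = + 5
    pattern +6 = + 6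
    pattern +7 = + 7
    pattern +8 = + 8
    pattern +9 = + 9
    pattern +10 = + 10
    pattern +12 = + 12
    pattern −1 = -[1+ 0 ]
    pattern −2 = -[1+ 1 ]
    pattern −3 = -[1+ 2 ]
    pattern −4 = -[1+ 3 ]
    pattern −5 = -[1+ 4 ]
    pattern −6 = -[1+ 5 ]
    pattern −7 = -[1+ 6 ]
    pattern −8 = -[1+ 7 ]
    pattern −9 = -[1+ 8 ]
    pattern −10 = -[1+ 9 ]
    pattern −12 = -[1+ 11 ]

  -- The trees were found by a computer search.
  tree1A : Tree
  tree1A =
    (split ⟨ +0 , −1 , +1 ⟩ ((1F , ⟨ +0 , +1 , +1 ⟩ , −1) ∷ (2F , ⟨ +0 , +0 , +2 ⟩ , +0) ∷ [])
     (split ⟨ −2 , +0 , +0 ⟩ ((0F , ⟨ +2 , +0 , +0 ⟩ , −1) ∷ (1F , ⟨ +0 , +1 , +1 ⟩ , +0) ∷ (2F , ⟨ +0 , +0 , +2 ⟩ , +0) ∷ [])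
      (vanish ⟨ +2 , −3 , +1 ⟩)
      (tally 4 0F 1F))
     (split ⟨ −1 , +0 , +1 ⟩ ((0F , ⟨ +1 , +0 , +1 ⟩ , −1) ∷ (2F , ⟨ +0 , +0 , +2 ⟩ , +0) ∷ [])
      (split ⟨ +0 , −2 , +0 ⟩ ((0F , ⟨ +1 , +0 , +1 ⟩ , +0) ∷ (1F , ⟨ +0 , +2 , +0 ⟩ , −1) ∷ (2F , ⟨ +0 , +0 , +2 ⟩ , +0) ∷ [])
       (vanish ⟨ −3 , +2 , +1 ⟩)
       (tally 4 0F 1F))
      (split ⟨ −2 , +2 , +0 ⟩ ((0F , ⟨ +2 , −2 , +0 ⟩ , −1) ∷ (2F , ⟨ +0 , +0 , +2 ⟩ , +0) ∷ [])
       (tally 4 0F 1F)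
       (split ⟨ −3 , +3 , +0 ⟩ ((0F , ⟨ +3 , −3 , +0 ⟩ , −1) ∷ (2F , ⟨ +0 , +0 , +2 ⟩ , +0) ∷ [])
        (tally 6 0F 1F)
        (split ⟨ −1 , +2 , +0 ⟩ ((0F , ⟨ +1 , −2 , +0 ⟩ , −1) ∷ (2F , ⟨ +0 , +0 , +2 ⟩ , +0) ∷ [])
         (tally 5 0F 1F)
         (split ⟨ −2 , +1 , +0 ⟩ ((0F , ⟨ +2 , −1 , +0 ⟩ , −1) ∷ (2F , ⟨ +0 , +0 , +2 ⟩ , +0) ∷ [])
          (tally 5 0F 1F)
          (split ⟨ −1 , −1 , +0 ⟩ ((0F , ⟨ +1 , +1 , +0 ⟩ , −1) ∷ (2F , ⟨ +0 , +0 , +2 ⟩ , +0) ∷ [])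
           (tally 10 0F 1F)
           (split ⟨ −1 , +3 , +0 ⟩ ((0F , ⟨ +1 , −3 , +0 ⟩ , −1) ∷ (2F , ⟨ +0 , +0 , +2 ⟩ , +0) ∷ [])
            (split ⟨ +0 , −10 , +0 ⟩ ((0F , ⟨ +1 , +7 , +0 ⟩ , −1) ∷ (1F , ⟨ +0 , +10 , +0 ⟩ , −1) ∷ (2F , ⟨ +0 , +0 , +2 ⟩ , +0) ∷ [])
             (tally 10 0F 1F)
             (split ⟨ +0 , −7 , +1 ⟩ ((0F , ⟨ +1 , +4 , +1 ⟩ , −1) ∷ (1F , ⟨ +0 , +7 , +1 ⟩ , −1) ∷ (2F , ⟨ +0 , +0 , +2 ⟩ , +0) ∷ [])
              (vanish ⟨ −3 , +2 , +1 ⟩)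
              (split ⟨ +0 , −8 , +0 ⟩ ((0F , ⟨ +1 , +5 , +0 ⟩ , −1) ∷ (1F , ⟨ +0 , +8 , +0 ⟩ , −1) ∷ (2F , ⟨ +0 , +0 , +2 ⟩ , +0) ∷ [])
               (tally 8 0F 1F)
               (split ⟨ +0 , −9 , +1 ⟩ ((0F , ⟨ +1 , +6 , +1 ⟩ , −1) ∷ (1F , ⟨ +0 , +9 , +1 ⟩ , −1) ∷ (2F , ⟨ +0 , +0 , +2 ⟩ , +0) ∷ [])
                (small 9 +1 +1)
                (tally 10 0F 1F)))))
            (split ⟨ −1 , +2 , +1 ⟩ ((0F , ⟨ +1 , −2 , +1 ⟩ , −1) ∷ (2F , ⟨ +0 , +0 , +2 ⟩ , +0) ∷ [])
             (split ⟨ +0 , −4 , +0 ⟩ ((0F , ⟨ +1 , +2 , +1 ⟩ , −1) ∷ (1F , ⟨ +0 , +4 , +0 ⟩ , −1) ∷ (2F , ⟨ +0 , +0 , +2 ⟩ , +0) ∷ [])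
              (vanish ⟨ −3 , +2 , +1 ⟩)
              (tally 8 0F 1F))
             (split ⟨ −2 , +1 , +1 ⟩ ((0F , ⟨ +2 , −1 , +1 ⟩ , −1) ∷ (2F , ⟨ +0 , +0 , +2 ⟩ , +0) ∷ [])
              (split ⟨ +0 , −2 , +0 ⟩ ((0F , ⟨ +2 , +1 , +1 ⟩ , −1) ∷ (1F , ⟨ +0 , +2 , +0 ⟩ , −1) ∷ (2F , ⟨ +0 , +0 , +2 ⟩ , +0) ∷ [])
               (vanish ⟨ +2 , −3 , +1 ⟩)
               (tally 8 0F 1F))
              (split ⟨ −3 , +1 , +0 ⟩ ((0F , ⟨ +3 , −1 , +0 ⟩ , −1) ∷ (2F , ⟨ +0 , +0 , +2 ⟩ , +0) ∷ [])
               (split ⟨ +1 , +3 , +0 ⟩ ((0F , ⟨ +1 , +3 , +0 ⟩ , +1) ∷ (1F , ⟨ +0 , +10 , +0 ⟩ , +3) ∷ (2F , ⟨ +0 , +0 , +2 ⟩ , +0) ∷ [])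
                (tally 10 0F 1F)
                (split ⟨ +1 , +2 , +1 ⟩ ((0F , ⟨ +1 , +2 , +1 ⟩ , +1) ∷ (1F , ⟨ +0 , +7 , +1 ⟩ , +3) ∷ (2F , ⟨ +0 , +0 , +2 ⟩ , +0) ∷ [])
                 (vanish ⟨ +2 , −3 , +1 ⟩)
                 (split ⟨ +0 , −3 , +1 ⟩ ((0F , ⟨ +3 , +2 , +1 ⟩ , −1) ∷ (1F , ⟨ +0 , +3 , +1 ⟩ , −1) ∷ (2F , ⟨ +0 , +0 , +2 ⟩ , +0) ∷ [])
                  (small 9 +1 +1)
                  (tally 10 0F 1F))))
               (split ⟨ −2 , +3 , +1 ⟩ ((0F , ⟨ +2 , −3 , +1 ⟩ , −1) ∷ (2F , ⟨ +0 , +0 , +2 ⟩ , +0) ∷ [])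
                (vanish ⟨ +2 , −3 , +1 ⟩)
                (split ⟨ −3 , +2 , +1 ⟩ ((0F , ⟨ +3 , −2 , +1 ⟩ , −1) ∷ (2F , ⟨ +0 , +0 , +2 ⟩ , +0) ∷ [])
                 (vanish ⟨ −3 , +2 , +1 ⟩)
                 (split ⟨ −4 , +4 , +0 ⟩ ((0F , ⟨ +4 , −4 , +0 ⟩ , −1) ∷ (2F , ⟨ +0 , +0 , +2 ⟩ , +0) ∷ [])
                  (split ⟨ +1 , +2 , +1 ⟩ ((0F , ⟨ +1 , +2 , +1 ⟩ , +1) ∷ (1F , ⟨ +0 , +12 , +0 ⟩ , +4) ∷ (2F , ⟨ +0 , +0 , +2 ⟩ , +0) ∷ [])
                   (tally 10 0F 1F)
                   (split ⟨ +2 , −5 , +1 ⟩ ((0F , ⟨ +2 , +1 , +1 ⟩ , −1) ∷ (1F , ⟨ +0 , +6 , +0 ⟩ , −2) ∷ (2F , ⟨ +0 , +0 , +2 ⟩ , +0) ∷ [])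
                    (tally 10 0F 1F)
                    (split ⟨ +0 , −2 , +0 ⟩ ((0F , ⟨ +4 , +0 , +0 ⟩ , −2) ∷ (1F , ⟨ +0 , +2 , +0 ⟩ , −1) ∷ (2F , ⟨ +0 , +0 , +2 ⟩ , +0) ∷ [])
                     (small 4 +0 +0)
                     (split ⟨ +2 , −4 , +0 ⟩ ((0F , ⟨ +2 , +0 , +0 ⟩ , −1) ∷ (1F , ⟨ +0 , +4 , +0 ⟩ , −2) ∷ (2F , ⟨ +0 , +0 , +2 ⟩ , +0) ∷ [])
                      (small 4 +0 +0)
                      (tally 10 0F 1F)))))
                  (tally 8 0F 1F)))))))))))))))

  -- At the root only 2k = 0 is known.
  basis1A : Basis
  basis1A = (2F , ⟨ +0 , +0 , +2 ⟩) ∷ []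

  tree2A : Tree
  tree2A =
    (split ⟨ −1 , +0 , +1 ⟩ ((0F , ⟨ +1 , +0 , +1 ⟩ , −1) ∷ (2F , ⟨ +0 , +0 , +2 ⟩ , +0) ∷ [])
     (tally 3 0F 2F)
     (split ⟨ +0 , −3 , +0 ⟩ ((1F , ⟨ +0 , +3 , +0 ⟩ , −1) ∷ (2F , ⟨ +0 , +0 , +2 ⟩ , +0) ∷ [])
      (tally 3 0F 1F)
      (split ⟨ −2 , +0 , +0 ⟩ ((0F , ⟨ +2 , +0 , +0 ⟩ , −1) ∷ (2F , ⟨ +0 , +0 , +2 ⟩ , +0) ∷ [])
       (split ⟨ +0 , −4 , +0 ⟩ ((0F , ⟨ +2 , +0 , +0 ⟩ , +0) ∷ (1F , ⟨ +0 , +4 , +0 ⟩ , −1) ∷ (2F , ⟨ +0 , +0 , +2 ⟩ , +0) ∷ [])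
        (small 4 +0 +0)
        (tally 4 0F 1F))
       (split ⟨ −1 , +2 , +0 ⟩ ((0F , ⟨ +1 , −2 , +0 ⟩ , −1) ∷ (2F , ⟨ +0 , +0 , +2 ⟩ , +0) ∷ [])
        (vanish ⟨ +1 , −2 , +0 ⟩)
        (split ⟨ −1 , −2 , +0 ⟩ ((0F , ⟨ +1 , +2 , +0 ⟩ , −1) ∷ (2F , ⟨ +0 , +0 , +2 ⟩ , +0) ∷ [])
         (vanish ⟨ +1 , +2 , +0 ⟩)
         (split ⟨ +0 , −4 , +0 ⟩ ((1F , ⟨ +0 , +4 , +0 ⟩ , −1) ∷ (2F , ⟨ +0 , +0 , +2 ⟩ , +0) ∷ [])
          (tally 4 0F 1F)
          (tally 6 0F 2F)))))))

  basis2A : Basis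
  basis2A = (2F , ⟨ +0 , +0 , +2 ⟩) ∷ []

  -- A single leaf survives, namely 5 r = 5 s = k. It forces k ≤ 5, and the 8-cage lies there.
  tree4A : Tree
  tree4A =
    (split ⟨ −3 , +0 , +0 ⟩ ((0F , ⟨ +3 , +0 , +0 ⟩ , −1) ∷ (2F , ⟨ +0 , +0 , +2 ⟩ , +0) ∷ [])
     (tally 3 0F 1F)
     (split ⟨ +0 , −3 , +0 ⟩ ((1F , ⟨ +0 , +3 , +0 ⟩ , −1) ∷ (2F , ⟨ +0 , +0 , +2 ⟩ , +0) ∷ [])
      (tally 3 0F 2F)
      (split ⟨ −4 , +0 , +0 ⟩ ((0F , ⟨ +4 , +0 , +0 ⟩ , −1) ∷ (2F , ⟨ +0 , +0 , +2 ⟩ , +0) ∷ [])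
       (tally 4 0F 1F)
       (split ⟨ +0 , −4 , +0 ⟩ ((1F , ⟨ +0 , +4 , +0 ⟩ , −1) ∷ (2F , ⟨ +0 , +0 , +2 ⟩ , +0) ∷ [])
        (tally 4 0F 2F)
        (split ⟨ −5 , +0 , +0 ⟩ ((0F , ⟨ +5 , +0 , +0 ⟩ , −1) ∷ (2F , ⟨ +0 , +0 , +2 ⟩ , +0) ∷ [])
         (tally 5 0F 1F)
         (split ⟨ +0 , −5 , +0 ⟩ ((1F , ⟨ +0 , +5 , +0 ⟩ , −1) ∷ (2F , ⟨ +0 , +0 , +2 ⟩ , +0) ∷ [])
          (tally 5 0F 2F)
          (split ⟨ +0 , −3 , +1 ⟩ ((1F , ⟨ +0 , +3 , +1 ⟩ , −1) ∷ (2F , ⟨ +0 , +0 , +2 ⟩ , +0) ∷ [])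
           (tally 6 0F 2F)
           (split ⟨ −3 , +0 , +1 ⟩ ((0F , ⟨ +3 , +0 , +1 ⟩ , −1) ∷ (2F , ⟨ +0 , +0 , +2 ⟩ , +0) ∷ [])
            (tally 6 0F 1F)
            (split ⟨ −6 , +0 , +0 ⟩ ((0F , ⟨ +6 , +0 , +0 ⟩ , −1) ∷ (2F , ⟨ +0 , +0 , +2 ⟩ , +0) ∷ [])
             (tally 6 0F 1F)
             (split ⟨ +0 , −6 , +0 ⟩ ((1F , ⟨ +0 , +6 , +0 ⟩ , −1) ∷ (2F , ⟨ +0 , +0 , +2 ⟩ , +0) ∷ [])
              (tally 6 0F 2F)
              (split ⟨ −4 , +0 , +1 ⟩ ((0F , ⟨ +4 , +0 , +1 ⟩ , −1) ∷ (2F , ⟨ +0 , +0 , +2 ⟩ , +0) ∷ [])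
               (split ⟨ +1 , +1 , +1 ⟩ ((0F , ⟨ +1 , +1 , +1 ⟩ , +1) ∷ (1F , ⟨ +0 , +4 , +1 ⟩ , +4) ∷ (2F , ⟨ +0 , +0 , +2 ⟩ , +0) ∷ [])
                (tally 7 0F 1F)
                (split ⟨ +1 , −1 , +1 ⟩ ((0F , ⟨ +1 , +3 , +0 ⟩ , −3) ∷ (1F , ⟨ +0 , +4 , +1 ⟩ , −4) ∷ (2F , ⟨ +0 , +0 , +2 ⟩ , +0) ∷ [])
                 (tally 7 0F 1F)
                 (tally 7 0F 1F)))
               (split ⟨ −1 , +1 , +1 ⟩ ((0F , ⟨ +1 , −1 , +1 ⟩ , −1) ∷ (2F , ⟨ +0 , +0 , +2 ⟩ , +0) ∷ [])
                (tally 7 0F 1F)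
                (split ⟨ −1 , −1 , +1 ⟩ ((0F , ⟨ +1 , +1 , +1 ⟩ , −1) ∷ (2F , ⟨ +0 , +0 , +2 ⟩ , +0) ∷ [])
                 (tally 7 0F 1F)
                 (split ⟨ +0 , −4 , +1 ⟩ ((1F , ⟨ +0 , +4 , +1 ⟩ , −1) ∷ (2F , ⟨ +0 , +0 , +2 ⟩ , +0) ∷ [])
                  (tally 7 0F 2F)
                  (split ⟨ −2 , +1 , +0 ⟩ ((0F , ⟨ +2 , −1 , +0 ⟩ , −1) ∷ (2F , ⟨ +0 , +0 , +2 ⟩ , +0) ∷ [])
                   (tally 7 0F 1F)
                   (split ⟨ −2 , −1 , +0 ⟩ ((0F , ⟨ +2 , +1 , +0 ⟩ , −1) ∷ (2F , ⟨ +0 , +0 , +2 ⟩ , +0) ∷ [])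
                    (tally 7 0F 1F)
                    (split ⟨ −7 , +0 , +0 ⟩ ((0F , ⟨ +7 , +0 , +0 ⟩ , −1) ∷ (2F , ⟨ +0 , +0 , +2 ⟩ , +0) ∷ [])
                     (tally 7 0F 1F)
                     (split ⟨ −1 , +2 , +0 ⟩ ((0F , ⟨ +1 , −2 , +0 ⟩ , −1) ∷ (2F , ⟨ +0 , +0 , +2 ⟩ , +0) ∷ [])
                      (tally 7 0F 2F)
                      (split ⟨ −1 , −2 , +0 ⟩ ((0F , ⟨ +1 , +2 , +0 ⟩ , −1) ∷ (2F , ⟨ +0 , +0 , +2 ⟩ , +0) ∷ [])
                       (tally 7 0F 2F)
                       (split ⟨ +0 , −7 , +0 ⟩ ((1F , ⟨ +0 , +7 , +0 ⟩ , −1) ∷ (2F , ⟨ +0 , +0 , +2 ⟩ , +0) ∷ [])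
                        (tally 7 0F 2F)
                        (split ⟨ −5 , +0 , +1 ⟩ ((0F , ⟨ +5 , +0 , +1 ⟩ , −1) ∷ (2F , ⟨ +0 , +0 , +2 ⟩ , +0) ∷ [])
                         (split ⟨ +0 , −5 , +1 ⟩ ((0F , ⟨ +5 , +0 , +1 ⟩ , +0) ∷ (1F , ⟨ +0 , +5 , +1 ⟩ , −1) ∷ (2F , ⟨ +0 , +0 , +2 ⟩ , +0) ∷ [])
                          (small 5 +1 +1)
                          (split ⟨ +1 , +2 , +1 ⟩ ((0F , ⟨ +1 , +2 , +1 ⟩ , +1) ∷ (1F , ⟨ +0 , +10 , +0 ⟩ , +5) ∷ (2F , ⟨ +0 , +0 , +2 ⟩ , +0) ∷ [])
                           (tally 8 0F 2F)
                           (split ⟨ +1 , −2 , +1 ⟩ ((0F , ⟨ +1 , +8 , +1 ⟩ , −4) ∷ (1F , ⟨ +0 , +10 , +0 ⟩ , −5) ∷ (2F , ⟨ +0 , +0 , +2 ⟩ , +0) ∷ [])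
                            (tally 8 0F 2F)
                            (tally 8 0F 1F))))
                         (split ⟨ −1 , +1 , +0 ⟩ ((0F , ⟨ +1 , −1 , +0 ⟩ , −1) ∷ (2F , ⟨ +0 , +0 , +2 ⟩ , +0) ∷ [])
                          (tally 8 0F 1F)
                          (split ⟨ −1 , −1 , +0 ⟩ ((0F , ⟨ +1 , +1 , +0 ⟩ , −1) ∷ (2F , ⟨ +0 , +0 , +2 ⟩ , +0) ∷ [])
                           (tally 8 0F 1F)
                           (split ⟨ −1 , +2 , +1 ⟩ ((0F , ⟨ +1 , −2 , +1 ⟩ , −1) ∷ (2F , ⟨ +0 , +0 , +2 ⟩ , +0) ∷ [])
                            (tally 8 0F 1F)
                            (split ⟨ −1 , −2 , +1 ⟩ ((0F , ⟨ +1 , +2 , +1 ⟩ , −1) ∷ (2F , ⟨ +0 , +0 , +2 ⟩ , +0) ∷ [])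
                             (tally 8 0F 1F)
                             (split ⟨ −3 , +1 , +0 ⟩ ((0F , ⟨ +3 , −1 , +0 ⟩ , −1) ∷ (2F , ⟨ +0 , +0 , +2 ⟩ , +0) ∷ [])
                              (split ⟨ +0 , −5 , +1 ⟩ ((0F , ⟨ +3 , +4 , +1 ⟩ , −1) ∷ (1F , ⟨ +0 , +5 , +1 ⟩ , −1) ∷ (2F , ⟨ +0 , +0 , +2 ⟩ , +0) ∷ [])
                               (tally 8 0F 1F)
                               (split ⟨ +1 , −3 , +0 ⟩ ((0F , ⟨ +1 , +5 , +0 ⟩ , −2) ∷ (1F , ⟨ +0 , +8 , +0 ⟩ , −3) ∷ (2F , ⟨ +0 , +0 , +2 ⟩ , +0) ∷ [])
                                (tally 8 0F 1F)
                                (split ⟨ +1 , +3 , +0 ⟩ ((0F , ⟨ +1 , +3 , +0 ⟩ , +1) ∷ (1F , ⟨ +0 , +10 , +0 ⟩ , +3) ∷ (2F , ⟨ +0 , +0 , +2 ⟩ , +0) ∷ [])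
                                 (tally 10 0F 1F)
                                 (tally 8 0F 2F))))
                              (split ⟨ −3 , −1 , +0 ⟩ ((0F , ⟨ +3 , +1 , +0 ⟩ , −1) ∷ (2F , ⟨ +0 , +0 , +2 ⟩ , +0) ∷ [])
                               (split ⟨ +0 , −5 , +1 ⟩ ((0F , ⟨ +3 , +1 , +0 ⟩ , +0) ∷ (1F , ⟨ +0 , +5 , +1 ⟩ , −1) ∷ (2F , ⟨ +0 , +0 , +2 ⟩ , +0) ∷ [])
                                (tally 8 0F 1F)
                                (split ⟨ +1 , +3 , +0 ⟩ ((0F , ⟨ +1 , +3 , +0 ⟩ , +1) ∷ (1F , ⟨ +0 , +8 , +0 ⟩ , +3) ∷ (2F , ⟨ +0 , +0 , +2 ⟩ , +0) ∷ [])
                                 (tally 8 0F 1F)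
                                 (split ⟨ +1 , −3 , +0 ⟩ ((0F , ⟨ +1 , +7 , +0 ⟩ , −2) ∷ (1F , ⟨ +0 , +10 , +0 ⟩ , −3) ∷ (2F , ⟨ +0 , +0 , +2 ⟩ , +0) ∷ [])
                                  (tally 10 0F 1F)
                                  (tally 8 0F 2F))))
                               (split ⟨ +0 , −5 , +1 ⟩ ((1F , ⟨ +0 , +5 , +1 ⟩ , −1) ∷ (2F , ⟨ +0 , +0 , +2 ⟩ , +0) ∷ [])
                                (tally 8 0F 1F)
                                (split ⟨ −2 , +2 , +0 ⟩ ((0F , ⟨ +2 , −2 , +0 ⟩ , −1) ∷ (2F , ⟨ +0 , +0 , +2 ⟩ , +0) ∷ [])
                                 (split ⟨ +0 , −8 , +0 ⟩ ((0F , ⟨ +2 , +6 , +0 ⟩ , −1) ∷ (1F , ⟨ +0 , +8 , +0 ⟩ , −1) ∷ (2F , ⟨ +0 , +0 , +2 ⟩ , +0) ∷ [])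
                                  (tally 10 0F 1F)
                                  (tally 8 0F 1F))
                                 (split ⟨ −2 , −2 , +0 ⟩ ((0F , ⟨ +2 , +2 , +0 ⟩ , −1) ∷ (2F , ⟨ +0 , +0 , +2 ⟩ , +0) ∷ [])
                                  (split ⟨ +0 , −8 , +0 ⟩ ((0F , ⟨ +2 , +2 , +0 ⟩ , +0) ∷ (1F , ⟨ +0 , +8 , +0 ⟩ , −1) ∷ (2F , ⟨ +0 , +0 , +2 ⟩ , +0) ∷ [])
                                   (tally 10 0F 1F)
                                   (tally 8 0F 1F))
                                  (tally 8 0F 1F)))))))))))))))))))))))))))))))

  basis4A : Basis
  basis4A = (2F , ⟨ +0 , +0 , +2 ⟩) ∷ []

  -- Second round, with 2 r = 3 s + k in force. Unless k ≤ 6, counts of length 7 separate the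
  -- semi-edges at `u` and the edges of voltage s, which form the matching, from the edges of the
  -- 2-factor.
  tree1B : Tree
  tree1B =
    (split ⟨ +1 , −5 , +0 ⟩ ((0F , ⟨ +1 , +2 , +1 ⟩ , −1) ∷ (1F , ⟨ +0 , +7 , +1 ⟩ , −2) ∷ (2F , ⟨ +0 , +0 , +2 ⟩ , +0) ∷ [])
     (tally 8 0F 1F)
     (split ⟨ +1 , −4 , +1 ⟩ ((0F , ⟨ +1 , +1 , +0 ⟩ , −1) ∷ (1F , ⟨ +0 , +5 , +1 ⟩ , −2) ∷ (2F , ⟨ +0 , +0 , +2 ⟩ , +0) ∷ [])
      (tally 8 0F 1F)
      (split ⟨ +0 , −3 , +1 ⟩ ((0F , ⟨ +2 , +0 , +0 ⟩ , −1) ∷ (1F , ⟨ +0 , +3 , +1 ⟩ , −1) ∷ (2F , ⟨ +0 , +0 , +2 ⟩ , +0) ∷ [])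
       (small 6 +0 +0)
       (split ⟨ +0 , −2 , +0 ⟩ ((0F , ⟨ +2 , +1 , +1 ⟩ , −2) ∷ (1F , ⟨ +0 , +2 , +0 ⟩ , −1) ∷ (2F , ⟨ +0 , +0 , +2 ⟩ , +0) ∷ [])
        (small 4 +0 +0)
        (sign 7 (+ 7))))))

  basis1B : Basis
  basis1B = (0F , ⟨ +2 , −3 , +1 ⟩) ∷ (2F , ⟨ +0 , +0 , +2 ⟩) ∷ []

  -- With r = 2 s every voltage is a multiple of s, up to k. A cycle of length 12 on the vertices v
  -- joins neighbours by 11 further steps and so enters the count of length 11; hence the separate
  -- branch 12 s = 0, in which s has order 12 once 6 s and 4 s are nonzero.
  tree2B : Tree
  tree2B =
    (split ⟨ +0 , −12 , +0 ⟩ ((0F , ⟨ +1 , +10 , +0 ⟩ , −1) ∷ (1F , ⟨ +0 , +12 , +0 ⟩ , −1) ∷ (2F , ⟨ +0 , +0 , +2 ⟩ , +0) ∷ [])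
     (split ⟨ +0 , +6 , +0 ⟩ ((0F , ⟨ +1 , +4 , +0 ⟩ , −1) ∷ (1F , ⟨ +0 , +6 , +0 ⟩ , −1) ∷ (2F , ⟨ +0 , +0 , +2 ⟩ , +0) ∷ [])
      (small 6 +0 +0)
      (split ⟨ +0 , +4 , +0 ⟩ ((0F , ⟨ +1 , +2 , +0 ⟩ , +1) ∷ (1F , ⟨ +0 , +4 , +0 ⟩ , +1) ∷ (2F , ⟨ +0 , +0 , +2 ⟩ , +0) ∷ [])
       (small 4 +0 +0)
       (sign 11 (+ 115))))
     (split ⟨ +0 , −10 , +0 ⟩ ((0F , ⟨ +1 , +8 , +0 ⟩ , −1) ∷ (1F , ⟨ +0 , +10 , +0 ⟩ , −1) ∷ (2F , ⟨ +0 , +0 , +2 ⟩ , +0) ∷ [])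
      (small 10 +0 +0)
      (split ⟨ +0 , −9 , +1 ⟩ ((0F , ⟨ +1 , +7 , +1 ⟩ , −1) ∷ (1F , ⟨ +0 , +9 , +1 ⟩ , −1) ∷ (2F , ⟨ +0 , +0 , +2 ⟩ , +0) ∷ [])
       (small 9 +0 +1)
       (split ⟨ +0 , −8 , +0 ⟩ ((0F , ⟨ +1 , +6 , +0 ⟩ , −1) ∷ (1F , ⟨ +0 , +8 , +0 ⟩ , −1) ∷ (2F , ⟨ +0 , +0 , +2 ⟩ , +0) ∷ [])
        (small 8 +0 +0)
        (split ⟨ +0 , −7 , +1 ⟩ ((0F , ⟨ +1 , +5 , +1 ⟩ , −1) ∷ (1F , ⟨ +0 , +7 , +1 ⟩ , −1) ∷ (2F , ⟨ +0 , +0 , +2 ⟩ , +0) ∷ [])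
         (small 7 +0 +1)
         (sign 11 (+ 115)))))))

  basis2B : Basis
  basis2B = (0F , ⟨ +1 , −2 , +0 ⟩) ∷ (2F , ⟨ +0 , +0 , +2 ⟩) ∷ []

  -- k is not a multiple of 2k. The other vectors are differences of the voltages of two darts with
  -- the same ends, which lead to distinct neighbours.
  nonzero : Type → List Vec
  nonzero t1 = ⟨ + 0 , + 0 , + 1 ⟩ ∷ ⟨ + 1 , - (+ 1) , + 0 ⟩ ∷ []
  nonzero t2 = ⟨ + 0 , + 0 , + 1 ⟩ ∷ ⟨ + 1 , + 0 , + 0 ⟩ ∷ ⟨ + 0 , + 2 , + 0 ⟩ ∷ []
  nonzero t3 = []
  nonzero t4 = ⟨ + 0 , + 0 , + 1 ⟩ ∷ ⟨ + 2 , + 0 , + 0 ⟩ ∷ ⟨ + 0 , + 2 , + 0 ⟩ ∷ []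

  -- Type 4 has no family: its entry stands for the voltage k, which never vanishes.
  families : Type → List Vec
  families t1 = ⟨ + 2 , - (+ 3) , + 1 ⟩ ∷ ⟨ - (+ 3) , + 2 , + 1 ⟩ ∷ []
  families t2 = ⟨ + 1 , + 2 , + 0 ⟩ ∷ ⟨ + 1 , - (+ 2) , + 0 ⟩ ∷ []
  families t3 = []
  families t4 = ⟨ + 0 , + 0 , + 1 ⟩ ∷ []

  checks : Type → Basis → Tree → List Vec → Bool
  checks t B T vs = Check.check t (tables t 12) vs B (nonzero t) T

  check1A : checks t1 basis1A tree1A (families t1) ≡ true
  check1A = refl
  check2A : checks t2 basis2A tree2A (families t2) ≡ true
  check2A = refl
  check4A : checks t4 basis4A tree4A (families t4) ≡ true
  check4A = refl
  check1B : checks t1 basis1B tree1B [] ≡ true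
  check1B = refl
  check2B : checks t2 basis2B tree2B [] ≡ true
  check2B = refl

  -- Enumeration of small k

  anyBelow : ℕ → (ℕ → Bool) → Bool
  anyBelow zero    f = false
  anyBelow (suc n) f = f n ∨ anyBelow n f

  allBelow : ℕ → (ℕ → Bool) → Bool
  allBelow zero    f = true
  allBelow (suc n) f = f n ∧ allBelow n f

  congruent : ℕ → ℤ → ℤ → Bool
  congruent j x y = ((x - y) %ℕ (2 ℕ.* suc j)) ≡ᵇ 0

  -- The parameters (k, r, s) with k = suc j that actually occur.
  good₁ : ℕ → ℕ → ℕ → Bool
  good₁ j r s = (r % 2 ≡ᵇ 0) ∧ congruent j (+ 2 * + r) (+ 3 * + s + + suc j)

  good₂ : ℕ → ℕ → ℕ → Bool
  good₂ j r s = (s % 2 ≡ᵇ 1) ∧ (congruent j (+ r) (+ 2 * + s) ∨ congruent j (+ r) (+ 2 * - + s))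

  -- Up to the unit c and the sign of s this is the pair (1, 3) modulo 10, which gives Tutte's
  -- 8-cage.
  good₄ : ℕ → ℕ → ℕ → Bool
  good₄ r s c = ((c ℕ.* r) % 10 ≡ᵇ 1) ∧ (((c ℕ.* s) % 10 ≡ᵇ 3) ∨ ((c ℕ.* s) % 10 ≡ᵇ 7))

  -- Odd k gives the members of the two families. For type 1 with k = 2, a vanishing r or s creates
  -- triangles and gives the truncated tetrahedron.
  expected : Type → ℕ → ℕ → ℕ → Bool
  expected t1 j r s = (j % 2 ≡ᵇ 0) ∧ (good₁ j r s ∨ good₁ j s r) ∨ (j ≡ᵇ 1) ∧ ((r ≡ᵇ 0) ∨ (s ≡ᵇ 0))
  expected t2 j r s = (j % 2 ≡ᵇ 0) ∧ good₂ j r s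
  expected t3 j r s = true
  expected t4 j r s = (j ≡ᵇ 4) ∧ anyBelow 10 (good₄ r s)

  anyZero : ℕ → ℕ → ℕ → List Vec → Bool
  anyZero j r s [] = false
  anyZero j r s (v ∷ vs) = congruent j (value (suc j) (+ r) (+ s) v) 0ℤ ∨ anyZero j r s vs

  commonDivisor : ℕ → ℕ → ℕ → ℕ → Bool
  commonDivisor j r s p = (suc j % suc (suc p) ≡ᵇ 0) ∧ (r % suc (suc p) ≡ᵇ 0) ∧ (s % suc (suc p) ≡ᵇ 0)

  degenerate : Type → ℕ → ℕ → ℕ → Bool
  -- The divisors 2 to 10 are tested, which is enough since k is at most 10 in the enumeration.
  degenerate t j r s = anyBelow 9 (commonDivisor j r s) ∨ anyZero j r s (nonzero t)

  closedCount : ℕ → ℕ → ℕ → Poly → ℤ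
  closedCount j r s = Evaluate.eval (suc j) (+ r) (+ s) 0ℤ

  irregular : List Table → ℕ → ℕ → ℕ → Bool
  irregular [] j r s = false
  irregular (T ∷ Ts) j r s = differ (closedCount j r s (T ⟦ 0F , 0F ⟧)) ∨ irregular Ts j r s
    where differ : ℤ → Bool
          differ c = not (does (c ℤ.≟ closedCount j r s (T ⟦ 1F , 1F ⟧))) ∨ not (does (c ℤ.≟ closedCount j r s (T ⟦ 2F , 2F ⟧)))

  brute : Type → List Table → Bool
  brute t Ts = allBelow (limit t) λ j → allBelow (2 ℕ.* suc j) λ r → allBelow (2 ℕ.* suc j) λ s →
    degenerate t j r s ∨ expected t j r s ∨ irregular Ts j r s

  brute₁ : brute t1 (tables t1 13) ≡ true
  brute₁ = refl

  brute₂ : brute t2 (tables t2 13) ≡ true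
  brute₂ = refl

  brute₄ : brute t4 (tables t4 13) ≡ true
  brute₄ = refl

  -- Consequences of regularity and connectedness

  private
    absolute : ∀ a → ∃ λ ε → ε * a ≡ + ∣ a ∣
    absolute (+ n) = 1ℤ , ℤ.*-identityˡ (+ n)
    absolute -[1+ n ] = - 1ℤ , ℤ.-1*i≡-i -[1+ n ]

  ∣⇒≈0 : ∀ {g} a → g ℕ.∣ ∣ a ∣ → a ≈ 0ℤ [ g ]
  ∣⇒≈0 {g} (+ n) (ℕ.divides q e) = by (+ q) (trans (cong +_ e) (trans (ℤ.pos-* q g) (sym (ℤ.+-identityˡ _))))
  ∣⇒≈0 {g} -[1+ n ] (ℕ.divides q e) = by (- + q) (trans (cong -_ (trans (cong +_ e) (ℤ.pos-* q g))) (lem (+ q) (+ g)))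
    where lem : ∀ q g → - (q * g) ≡ 0ℤ + - q * g
          lem = solve-∀

  abstract
    bezout : ∀ a b → ∃ λ g → a ≈ 0ℤ [ g ] × b ≈ 0ℤ [ g ] × ∃ λ x → ∃ λ y → x * a + y * b ≡ + g
    bezout a b with Bézout.lemma ∣ a ∣ ∣ b ∣ | absolute a | absolute b
    ... | Bézout.result g gcd (Bézout.+- x y e) | ε , εa | η , ηb =
      g , ∣⇒≈0 a (proj₁ (GCD.commonDivisor gcd)) , ∣⇒≈0 b (proj₂ (GCD.commonDivisor gcd)) , + x * ε , - + y * η ,
      trans (lem (+ x) ε a (+ y) η b) (trans (cong₂ (λ p q → + x * p - + y * q) εa ηb)
        (trans (cong₂ _-_ (sym (trans (cong +_ e) (ℤ.pos-* x _))) (sym (ℤ.pos-* y _))) (lem′ (+ g) (+ (y ℕ.* ∣ b ∣)))))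
      where lem : ∀ x ε a y η b → x * ε * a + - y * η * b ≡ x * (ε * a) - y * (η * b)
            lem = solve-∀
            lem′ : ∀ g h → g + h - h ≡ g
            lem′ = solve-∀
    ... | Bézout.result g gcd (Bézout.-+ x y e) | ε , εa | η , ηb =
      g , ∣⇒≈0 a (proj₁ (GCD.commonDivisor gcd)) , ∣⇒≈0 b (proj₂ (GCD.commonDivisor gcd)) , - + x * ε , + y * η ,
      trans (lem (+ x) ε a (+ y) η b) (trans (cong₂ (λ p q → + y * q - + x * p) εa ηb)
        (trans (cong₂ _-_ (sym (trans (cong +_ e) (ℤ.pos-* y _))) (sym (ℤ.pos-* x _))) (lem′ (+ g) (+ (x ℕ.* ∣ a ∣)))))
      where lem : ∀ x ε a y η b → - x * ε * a + y * η * b ≡ y * (η * b) - x * (ε * a)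
            lem = solve-∀
            lem′ : ∀ g h → g + h - h ≡ g
            lem′ = solve-∀

  ≈0-trans : ∀ {a g h} → a ≈ 0ℤ [ g ] → + g ≈ 0ℤ [ h ] → a ≈ 0ℤ [ h ]
  ≈0-trans {a} {g} {h} (by p e) (by q f) = by (p * q) (trans e (trans (cong (λ z → 0ℤ + p * z) f) (lem p q (+ h))))
    where lem : ∀ p q h → 0ℤ + p * (0ℤ + q * h) ≡ 0ℤ + p * q * h
          lem = solve-∀

  -- Coprimality is stated through common divisors because connectedness supplies it in this form.
  unit : ∀ a m → (∀ g → a ≈ 0ℤ [ g ] → + m ≈ 0ℤ [ g ] → g ≡ 1) → ∃ λ c → c * a ≈ 1ℤ [ m ]
  unit a m coprime with bezout a (+ m)
  ... | g , ga , gm , x , y , e with coprime g ga gm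
  ... | refl = x , by (- y) (trans (lem (x * a) y (+ m)) (cong (_+ - y * + m) e))
    where lem : ∀ a y m → a ≡ a + y * m + - y * m
          lem = solve-∀

  bezout₃ : ∀ a b m → (∀ g → a ≈ 0ℤ [ g ] → b ≈ 0ℤ [ g ] → + m ≈ 0ℤ [ g ] → g ≡ 1) →
            ∃ λ x → ∃ λ y → x * a + y * b ≈ 1ℤ [ m ]
  bezout₃ a b m coprime =
    let g , ga , gb , x , y , e = bezout a b
        c , cg = unit (+ g) m (λ h hg hm → coprime h (≈0-trans ga hg) (≈0-trans gb hg) hm)
    in c * x , c * y , ≈-trans (≈-reflexive (trans (lem c x a y b) (cong (c *_) e))) cg
    where lem : ∀ c x a y b → c * x * a + c * y * b ≡ c * (x * a + y * b)
          lem = solve-∀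

  ≈0⇒∣ : ∀ {e k} → + e ≈ 0ℤ [ k ] → k ℕ.∣ e
  ≈0⇒∣ {e} {k} (by q eq) = ℕ.divides ∣ q ∣ (trans (cong ∣_∣ (trans eq (ℤ.+-identityˡ (q * + k)))) (ℤ.abs-* q (+ k)))

  private
    -- If x r + y s = 1 then e = x (e r) + y (e s).
    annihilates : ∀ k e r s x y → e * r ≈ 0ℤ [ k ] → e * s ≈ 0ℤ [ k ] → x * r + y * s ≈ 1ℤ [ k ] → e ≈ 0ℤ [ k ]
    annihilates k e r s x y er es one = ≈-trans (≈-reflexive (sym (ℤ.*-identityʳ e))) (≈-trans (≈-sym (*-congˡ-≈ {y = 1ℤ} e one))
                (≈-trans (≈-reflexive (lem e x r y s)) (≈-trans (+-cong-≈ (*-congˡ-≈ {y = 0ℤ} x er) (*-congˡ-≈ {y = 0ℤ} y es)) (≈-reflexive (lem′ x y)))))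
      where
        lem : ∀ e x r y s → e * (x * r + y * s) ≡ x * (e * r) + y * (e * s)
        lem = solve-∀
        lem′ : ∀ x y → x * 0ℤ + y * 0ℤ ≡ 0ℤ
        lem′ = solve-∀

  annihilator-bound : ∀ e r s k → .{{NonZero e}} → (∀ g → r ≈ 0ℤ [ g ] → s ≈ 0ℤ [ g ] → + k ≈ 0ℤ [ g ] → g ≡ 1) →
                      + e * r ≈ 0ℤ [ k ] → + e * s ≈ 0ℤ [ k ] → k ℕ.≤ e
  annihilator-bound e r s k coprime er es =
    let x , y , one = bezout₃ r s k coprime in ℕ.∣⇒≤ (≈0⇒∣ (annihilates k (+ e) r s x y er es one))

  abstract
    distinct-cover : ∀ (p q r : Fin 3) → p ≢ q → p ≢ r → q ≢ r → ∀ d → d ≡ p ⊎ d ≡ q ⊎ d ≡ r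
    distinct-cover = toWitness {a? = F.all? λ p → F.all? λ q → F.all? λ r → ¬? (p F.≟ q) →-dec (¬? (p F.≟ r) →-dec
      (¬? (q F.≟ r) →-dec F.all? λ d → (d F.≟ p) ⊎-dec ((d F.≟ q) ⊎-dec (d F.≟ r))))} tt

  -- Three distinct values use up all three indices.
  onto-distinct⇒Inj : ∀ {A : Set} (e : Fin 3 → A) {a b c} → a ≢ b → a ≢ c → b ≢ c →
                      (∃ λ d → a ≡ e d) → (∃ λ d → b ≡ e d) → (∃ λ d → c ≡ e d) → Inj e
  onto-distinct⇒Inj e ab ac bc (p , refl) (q , refl) (r , refl) {d} {d′} eq
    with distinct-cover p q r (λ x → ab (cong e x)) (λ x → ac (cong e x)) (λ x → bc (cong e x)) d
       | distinct-cover p q r (λ x → ab (cong e x)) (λ x → ac (cong e x)) (λ x → bc (cong e x)) d′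
  ... | inj₁ refl        | inj₁ refl        = refl
  ... | inj₁ refl        | inj₂ (inj₁ refl) = contradiction eq ab
  ... | inj₁ refl        | inj₂ (inj₂ refl) = contradiction eq ac
  ... | inj₂ (inj₁ refl) | inj₁ refl        = contradiction (sym eq) ab
  ... | inj₂ (inj₁ refl) | inj₂ (inj₁ refl) = refl
  ... | inj₂ (inj₁ refl) | inj₂ (inj₂ refl) = contradiction eq bc
  ... | inj₂ (inj₂ refl) | inj₁ refl        = contradiction (sym eq) ac
  ... | inj₂ (inj₂ refl) | inj₂ (inj₁ refl) = contradiction (sym eq) bc
  ... | inj₂ (inj₂ refl) | inj₂ (inj₂ refl) = refl

  module Regular {t n} {G : Graph n} {k} .{{_ : NonZero (2 ℕ.* k)}} {r s} (M : Model t G k r s) (cubic : Cubic G) where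
    open Model M
    open Evaluate k r s hiding (N)

    nb-inj : ∀ a i → Inj (nb a i)
    nb-inj a i with proj₂ (proj₂ cubic) (V a i)
    ... | x , y , z , xy , xz , yz , h =
      onto-distinct⇒Inj (nb a i) xy xz yz (hit x (inj₁ refl)) (hit y (inj₂ (inj₁ refl))) (hit z (inj₂ (inj₂ refl)))
      where hit : ∀ v → v ≡ x ⊎ v ≡ y ⊎ v ≡ z → ∃ λ d → v ≡ nb a i d
            hit v p = edge-nb a i v (proj₂ (h v) p)

    dart-inj : ∀ a {d d′} → head t a d ≡ head t a d′ → val (volt t a d) ≈ val (volt t a d′) [ 2 ℕ.* k ] → d ≡ d′
    dart-inj a {d} {d′} p q = nb-inj a 0ℤ (trans (V-cong _ (+-congˡ-≈ 0ℤ q)) (cong (λ b → V b _) p))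

    N : Fin n → Fin 3 → Fin n
    N = Evaluate.N k r s M

    N-inj : ∀ x → Inj (N x)
    N-inj x with V-surj x
    ... | a , i , _ = nb-inj a i

    N-edge : ∀ x d → G x (N x d)
    N-edge x d with V-surj x
    ... | a , i , refl = nb-edge a i d

    edge-N : ∀ {x y} → G x y → ∃ λ d → y ≡ N x d
    edge-N {x} {y} g with V-surj x
    ... | a , i , refl = edge-nb a i y g

    -- A common divisor g of r, s and k divides all voltages, so a walk from index 0 stays on
    -- indices divisible by g. It has to reach index 1.
    coprime : ∀ g → r ≈ 0ℤ [ g ] → s ≈ 0ℤ [ g ] → + k ≈ 0ℤ [ g ] → g ≡ 1
    coprime g r0 s0 k0 with V-surj (V 0F 1ℤ)
    ... | b , j , e = one (reach (proj₁ (proj₂ cubic) (V 0F 0ℤ) (V 0F 1ℤ)) refl ≈-refl refl)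
      where
        val0 : ∀ z → val z ≈ 0ℤ [ g ]
        val0 ⟨ a , b , c ⟩ = ≈-trans (+-cong-≈ (+-cong-≈ (*-congˡ-≈ a r0) (*-congˡ-≈ b s0)) (*-congˡ-≈ c k0)) (≈-reflexive (lem a b c))
          where lem : ∀ a b c → a * 0ℤ + b * 0ℤ + c * 0ℤ ≡ 0ℤ
                lem = solve-∀
        2k0 : + (2 ℕ.* k) ≈ 0ℤ [ g ]
        2k0 = ≈-trans (≈-reflexive (ℤ.pos-* 2 k)) (*-congˡ-≈ (+ 2) k0)
        down : ∀ {i j} → i ≈ j [ 2 ℕ.* k ] → i ≈ j [ g ]
        down {i} {j} (by q e) = ≈-trans (≈-reflexive e) (≈-trans (+-congˡ-≈ j (≈-trans (*-congˡ-≈ q 2k0) (≈-reflexive (ℤ.*-zeroʳ q)))) (≈-reflexive (ℤ.+-identityʳ j)))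
        reach : ∀ {x y a i c j} → Reach G x y → x ≡ V a i → i ≈ 0ℤ [ g ] → y ≡ V c j → j ≈ 0ℤ [ g ]
        reach here refl i0 e = ≈-trans (≈-sym (down (proj₂ (V-inj e)))) i0
        reach {a = a} {i} (step {v = v} gxv rest) refl i0 e with edge-nb a i v gxv
        ... | d , refl = reach rest refl (≈-trans (+-cong-≈ i0 (val0 (volt t a d))) ≈-refl) e
        one : 1ℤ ≈ 0ℤ [ g ] → g ≡ 1
        one p = ℕ.∣1⇒≡1 (≈0⇒∣ p)

    module _ (vt : VertexTransitive G) where
      open Count N

      θ-N : ∀ (θ : Aut G) x d → ∃ λ d′ → _≅_.to θ (N x d) ≡ N (_≅_.to θ x) d′
      θ-N θ x d = edge-N (_≅_.pres θ _ _ (N-edge x d))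

      to-inj : ∀ (θ : Aut G) {x y} → _≅_.to θ x ≡ _≅_.to θ y → x ≡ y
      to-inj θ {x} {y} e = trans (sym (_≅_.from-to θ x)) (trans (cong (_≅_.from θ) e) (_≅_.from-to θ y))

      count-aut : ∀ (θ : Aut G) L x y → count L (_≅_.to θ x) (_≅_.to θ y) ≡ count L x y
      count-aut θ = count-θ (_≅_.to θ) (to-inj θ) N-inj (θ-N θ)

      equalCounts : ∀ f L T → nth (tables t f) L ≡ just T → ∀ x y → eval 0ℤ (T ⟦ x , x ⟧) ≡ eval 0ℤ (T ⟦ y , y ⟧)
      equalCounts f L T e x y with vt (V x 0ℤ) (V y 0ℤ)
      ... | θ , eq = trans (sym (represents M f L e x x 0ℤ 0ℤ))
            (trans (sym (count-aut θ L (V x 0ℤ) (V x 0ℤ)))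
              (trans (cong (λ z → count L z z) eq) (represents M f L e y y 0ℤ 0ℤ)))

  ∈⇒nth : ∀ {A : Set} {x : A} {xs} → x ∈ xs → ∃ λ i → nth xs i ≡ just x
  ∈⇒nth (here refl) = 0 , refl
  ∈⇒nth (there p) with ∈⇒nth p
  ... | i , e = suc i , e

  -- Walks along the 2-factor

  side : Bool → Fin 3
  side true  = 1F
  side false = 2F

  along : Bool → ℤ → ℤ
  along true  x = x
  along false x = - x

  -- Darts 1 and 2 at each vertex form a 2-factor, along which `move true` and `move false`
  -- walk in opposite directions.
  module Walk (t : Type) (k : ℕ) (r s : ℤ) where
    move : Bool → Fin 3 × ℤ → Fin 3 × ℤ
    move e (a , i) = head t a (side e) , i + value k r s (volt t a (side e))

    Reversible : Set
    Reversible = ∀ e x → move (not e) (move e x) ≡ x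

  module _ {t n} {G : Graph n} {k} .{{k≢0 : NonZero (2 ℕ.* k)}} {r s : ℤ} (M : Model t G k r s) (cubic : Cubic G)
           (vt : VertexTransitive G) {ts : List Vec} where
    open Model M
    open Regular {{k≢0}} M cubic
    open Walk t k r s
    open Soundness k {{k≢0}} r s using (Signature)
    open Evaluate k {{k≢0}} r s using (val)
    open Count N

    at : Fin 3 × ℤ → Fin n
    at (a , i) = V a i

    module _ {f L τ} (σ : Signature t (tables t f) ts L τ) (rev : Reversible) where
      private
        dartCount : ∀ a i d → count L (V a i) (nb a i d) ≡ Evaluate.eval k r s (val (volt t a d)) (proj₁ σ ⟦ a , head t a d ⟧)
        dartCount a i d = trans (Evaluate.represents k r s M f L (proj₁ (proj₂ σ)) a (head t a d) i _)
          (cong (λ g → Evaluate.eval k r s g (proj₁ σ ⟦ a , head t a d ⟧)) (lem i (val (volt t a d))))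
          where lem : ∀ i v → i + v - i ≡ v
                lem = solve-∀

        -- Recognises the edges of the 2-factor by a count, which every automorphism preserves.
        Light : Fin n → Fin n → Set
        Light x y = G x y × count L x y ℤ.< τ

        light-move : ∀ e x → Light (at x) (at (move e x))
        light-move e (a , i) = nb-edge a i (side e) , subst (ℤ._< τ) (sym (dartCount a i (side e))) (proj₂ (proj₂ (proj₂ σ) a) (side e) (ne e))
          where ne : ∀ e → side e ≢ 0F
                ne true  ()
                ne false ()

        light-only : ∀ e x y → Light (at x) y → y ≡ at (move e x) ⊎ y ≡ at (move (not e) x)
        light-only e (a , i) y (g , lt) with edge-nb a i y g
        light-only e     (a , i) y (g , lt) | 0F , refl =
          contradiction (subst (ℤ._< τ) (dartCount a i 0F) lt) (ℤ.≤⇒≯ (proj₁ (proj₂ (proj₂ σ) a)))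
        light-only true  (a , i) y (g , lt) | 1F , refl = inj₁ refl
        light-only false (a , i) y (g , lt) | 1F , refl = inj₂ refl
        light-only true  (a , i) y (g , lt) | 2F , refl = inj₂ refl
        light-only false (a , i) y (g , lt) | 2F , refl = inj₁ refl

        light-aut : ∀ (θ : Aut G) {x y} → Light x y → Light (_≅_.to θ x) (_≅_.to θ y)
        light-aut θ {x} {y} (g , lt) = _≅_.pres θ x y g , subst (ℤ._< τ) (sym (count-aut vt θ L x y)) lt

        turn : ∀ e x → at (move e x) ≢ at (move (not e) x)
        turn true  (a , i) eq with nb-inj a i eq
        ... | ()
        turn false (a , i) eq with nb-inj a i eq
        ... | ()

      -- The image of the first step decides the direction. Later the image walk cannot turn back,
      -- since that would identify the images of the vertices before and after the current one.
      walk-aut : ∀ (θ : Aut G) x y → _≅_.to θ (at x) ≡ at y →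
                 ∃ λ e → ∀ j → _≅_.to θ (at (pow (move true) j x)) ≡ at (pow (move e) j y)
      walk-aut θ x y eq = choose (light-only true y (θ⟦ move true x ⟧) (subst (λ z → Light z (θ⟦ move true x ⟧)) eq (light-aut θ (light-move true x))))
        where
          θ⟦_⟧ : Fin 3 × ℤ → Fin n
          θ⟦ z ⟧ = _≅_.to θ (at z)

          Along : Bool → Fin 3 × ℤ → Fin 3 × ℤ → Set
          Along e x y = θ⟦ x ⟧ ≡ at y × θ⟦ move true x ⟧ ≡ at (move e y)

          extend : ∀ e x y → Along e x y → Along e (move true x) (move e y)
          extend e x y (p , q) = q , decide (light-only e (move e y) θ⟦ move true (move true x) ⟧
              (subst (λ z → Light z (θ⟦ move true (move true x) ⟧)) q (light-aut θ (light-move true (move true x)))))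
            where
              decide : θ⟦ move true (move true x) ⟧ ≡ at (move e (move e y)) ⊎
                       θ⟦ move true (move true x) ⟧ ≡ at (move (not e) (move e y)) →
                       θ⟦ move true (move true x) ⟧ ≡ at (move e (move e y))
              decide (inj₁ ok)   = ok
              decide (inj₂ back) = contradiction
                (trans (to-inj vt θ (trans back (trans (cong at (rev e y)) (sym p)))) (sym (cong at (rev true x))))
                (turn true (move true x))

          follow : ∀ e → θ⟦ move true x ⟧ ≡ at (move e y) → ∀ j →
                   Along e (pow (move true) j x) (pow (move e) j y)
          follow e eq₁ zero = eq , eq₁
          follow e eq₁ (suc j) = extend e (pow (move true) j x) (pow (move e) j y) (follow e eq₁ j)

          choose : _ → _
          choose (inj₁ p) = true  , λ j → proj₁ (follow true p j)
          choose (inj₂ p) = false , λ j → proj₁ (follow false p j)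

  module _ (k : ℕ) (r s : ℤ) where
    private
      shift₀ : ∀ i r s k → i + (0ℤ * r + 0ℤ * s + 0ℤ * k) ≡ i
      shift₀ = solve-∀
      shift₁ : ∀ i r s k → i + (1ℤ * r + 0ℤ * s + 0ℤ * k) ≡ i + r
      shift₁ = solve-∀
      shift₋₁ : ∀ i r s k → i + (- 1ℤ * r + 0ℤ * s + 0ℤ * k) ≡ i - r
      shift₋₁ = solve-∀
      shift₂ : ∀ i r s k → i + (0ℤ * r + 1ℤ * s + 0ℤ * k) ≡ i + s
      shift₂ = solve-∀
      shift₋₂ : ∀ i r s k → i + (0ℤ * r + - 1ℤ * s + 0ℤ * k) ≡ i - s
      shift₋₂ = solve-∀
      v₀ = value k r s 𝟎
      v₁ = value k r s ⟨ 1ℤ , 0ℤ , 0ℤ ⟩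
      w₁ = value k r s ⟨ - 1ℤ , 0ℤ , 0ℤ ⟩
      v₂ = value k r s ⟨ 0ℤ , 1ℤ , 0ℤ ⟩
      w₂ = value k r s ⟨ 0ℤ , - 1ℤ , 0ℤ ⟩
      +- : ∀ i r → i + r - r ≡ i
      +- = solve-∀
      -+ : ∀ i r → i - r + r ≡ i
      -+ = solve-∀
      o : ∀ i → i + value k r s 𝟎 ≡ i
      o i = shift₀ i r s (+ k)
      o² : ∀ i → i + value k r s 𝟎 + value k r s 𝟎 ≡ i
      o² i = trans (o (i + v₀)) (o i)
      p : ∀ i → i + value k r s ⟨ 1ℤ , 0ℤ , 0ℤ ⟩ ≡ i + r
      p i = shift₁ i r s (+ k)
      m : ∀ i → i + value k r s ⟨ - 1ℤ , 0ℤ , 0ℤ ⟩ ≡ i - r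
      m i = shift₋₁ i r s (+ k)
      P : ∀ i → i + value k r s ⟨ 0ℤ , 1ℤ , 0ℤ ⟩ ≡ i + s
      P i = shift₂ i r s (+ k)
      Q : ∀ i → i + value k r s ⟨ 0ℤ , - 1ℤ , 0ℤ ⟩ ≡ i - s
      Q i = shift₋₂ i r s (+ k)
      pm : ∀ i → i + value k r s ⟨ 1ℤ , 0ℤ , 0ℤ ⟩ + value k r s ⟨ - 1ℤ , 0ℤ , 0ℤ ⟩ ≡ i
      pm i = trans (m (i + v₁)) (trans (cong (_- r) (p i)) (+- i r))
      mp : ∀ i → i + value k r s ⟨ - 1ℤ , 0ℤ , 0ℤ ⟩ + value k r s ⟨ 1ℤ , 0ℤ , 0ℤ ⟩ ≡ i
      mp i = trans (p (i + w₁)) (trans (cong (_+ r) (m i)) (-+ i r))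
      PQ : ∀ i → i + value k r s ⟨ 0ℤ , 1ℤ , 0ℤ ⟩ + value k r s ⟨ 0ℤ , - 1ℤ , 0ℤ ⟩ ≡ i
      PQ i = trans (Q (i + v₂)) (trans (cong (_- s) (P i)) (+- i s))
      QP : ∀ i → i + value k r s ⟨ 0ℤ , - 1ℤ , 0ℤ ⟩ + value k r s ⟨ 0ℤ , 1ℤ , 0ℤ ⟩ ≡ i
      QP i = trans (P (i + w₂)) (trans (cong (_+ s) (Q i)) (-+ i s))

    -- The darts are numbered so that dart 2 at the end of dart 1 is its reverse.
    reversible₁ : Walk.Reversible t1 k r s
    reversible₁ true  (0F , i) = cong (0F ,_) (o² i)
    reversible₁ true  (1F , i) = cong (1F ,_) (pm i)
    reversible₁ true  (2F , i) = cong (2F ,_) (o² i)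
    reversible₁ false (0F , i) = cong (0F ,_) (o² i)
    reversible₁ false (1F , i) = cong (1F ,_) (o² i)
    reversible₁ false (2F , i) = cong (2F ,_) (mp i)

    reversible₂ : Walk.Reversible t2 k r s
    reversible₂ true  (0F , i) = cong (0F ,_) (pm i)
    reversible₂ true  (1F , i) = cong (1F ,_) (PQ i)
    reversible₂ true  (2F , i) = cong (2F ,_) (o² i)
    reversible₂ false (0F , i) = cong (0F ,_) (o² i)
    reversible₂ false (1F , i) = cong (1F ,_) (QP i)
    reversible₂ false (2F , i) = cong (2F ,_) (mp i)

    private
      open Walk t1 k r s renaming (move to move₁)
      open Walk t2 k r s renaming (move to move₂)

      -- In type 1 the 2-factor consists of the cycles uᵢ vᵢ wᵢ₊ᵣ uᵢ₊ᵣ ..., so three steps from any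
      -- vertex change the index by r, up to the direction.
      move₁³ : ∀ e a i → move₁ e (move₁ e (move₁ e (a , i))) ≡ (a , i + along e r)
      move₁³ true  0F i = cong (0F ,_) (trans (o (i + v₀ + v₁)) (trans (p (i + v₀)) (cong (_+ r) (o i))))
      move₁³ true  1F i = cong (1F ,_) (trans (o² (i + v₁)) (p i))
      move₁³ true  2F i = cong (2F ,_) (trans (p (i + v₀ + v₀)) (cong (_+ r) (o² i)))
      move₁³ false 0F i = cong (0F ,_) (trans (o (i + v₀ + w₁)) (trans (m (i + v₀)) (cong (_- r) (o i))))
      move₁³ false 1F i = cong (1F ,_) (trans (m (i + v₀ + v₀)) (cong (_- r) (o² i)))
      move₁³ false 2F i = cong (2F ,_) (trans (o² (i + w₁)) (m i))

      -- In type 2 the 2-factor has cycles alternating between u and w, and separate cycles inside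
      -- v.
      move₂² : ∀ e a → a ≢ 1F → ∀ i → move₂ e (move₂ e (a , i)) ≡ (a , i + along e r)
      move₂² true  0F _ i = cong (0F ,_) (trans (o (i + v₁)) (p i))
      move₂² true  1F a≢1 i = contradiction refl a≢1
      move₂² true  2F _ i = cong (2F ,_) (trans (p (i + v₀)) (cong (_+ r) (o i)))
      move₂² false 0F _ i = cong (0F ,_) (trans (m (i + v₀)) (cong (_- r) (o i)))
      move₂² false 1F a≢1 i = contradiction refl a≢1
      move₂² false 2F _ i = cong (2F ,_) (trans (o (i + w₁)) (m i))

      start : ∀ i x → i ≡ i + 0ℤ * x
      start = solve-∀

      advance : ∀ i j x → i + + j * x + x ≡ i + + suc j * x
      advance i j x = lem i (+ j) x
        where lem : ∀ i j x → i + j * x + x ≡ i + (1ℤ + j) * x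
              lem = solve-∀

    walk₁ : ∀ e a j i → pow (move₁ e) (j ℕ.* 3) (a , i) ≡ (a , i + + j * along e r)
    walk₁ e a zero i = cong (a ,_) (start i (along e r))
    walk₁ e a (suc j) i = trans (cong (λ x → move₁ e (move₁ e (move₁ e x))) (walk₁ e a j i))
      (trans (move₁³ e a (i + + j * along e r)) (cong (a ,_) (advance i j (along e r))))

    walk₂ : ∀ e a → a ≢ 1F → ∀ j i → pow (move₂ e) (j ℕ.* 2) (a , i) ≡ (a , i + + j * along e r)
    walk₂ e a a≢1 zero i = cong (a ,_) (start i (along e r))
    walk₂ e a a≢1 (suc j) i = trans (cong (λ x → move₂ e (move₂ e x)) (walk₂ e a a≢1 j i))
      (trans (move₂² e a a≢1 (i + + j * along e r)) (cong (a ,_) (advance i j (along e r))))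

    walk₂-v : ∀ e j i → pow (move₂ e) j (1F , i) ≡ (1F , i + + j * along e s)
    walk₂-v e zero i = cong (1F ,_) (start i (along e s))
    walk₂-v e (suc j) i = trans (cong (move₂ e) (walk₂-v e j i)) (trans (last e (i + + j * along e s)) (cong (1F ,_) (advance i j (along e s))))
      where last : ∀ e i → move₂ e (1F , i) ≡ (1F , i + along e s)
            last true  i = cong (1F ,_) (P i)
            last false i = cong (1F ,_) (Q i)

  -- Renumbering the darts at a vertex changes neither the graph nor the labelling, but it permutes
  -- voltages. This yields the symmetries r ↔ s of type 1 and s ↦ -s of types 2 and 4, and the
  -- passage to residues.
  redart : ∀ {t n} {G : Graph n} {k r s r′ s′} → Model t G k r s → (π : Fin 3 → Fin 3 → Fin 3) →
           (∀ a d → π a (π a d) ≡ d) → (∀ a d → head t a (π a d) ≡ head t a d) →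
           (∀ a d → value k r′ s′ (volt t a d) ≈ value k r s (volt t a (π a d)) [ 2 ℕ.* k ]) → Model t G k r′ s′
  redart {t} {G = G} {k} {r} {s} {r′} {s′} M π ππ hd vl = record
    { V = V ; labelling = labelling
    ; nb-edge = λ a i d → subst (G (V a i)) (nb≡ a i d) (nb-edge a i (π a d))
    ; edge-nb = λ a i y g → let d , e = edge-nb a i y g in
        π a d , trans e (trans (cong (nb a i) (sym (ππ a d))) (nb≡ a i (π a d))) }
    where
      open Model M
      nb≡ : ∀ a i d → nb a i (π a d) ≡ V (head t a d) (i + value k r′ s′ (volt t a d))
      nb≡ a i d = trans (V-cong _ (+-congˡ-≈ i (≈-sym (vl a d)))) (cong (λ b → V b _) (hd a d))

  residues : ∀ {t n} {G : Graph n} {k r s r′ s′} → Model t G k r s → r′ ≈ r [ 2 ℕ.* k ] → s′ ≈ s [ 2 ℕ.* k ] → Model t G k r′ s′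
  residues {t} {k = k} M p q = redart M (λ _ d → d) (λ _ _ → refl) (λ _ _ → refl) (λ a d → value-cong k p q (volt t a d))

  private
    transpose₀₁ transpose₀₂ transpose₁₂ : Fin 3 → Fin 3
    transpose₀₁ 0F = 1F
    transpose₀₁ 1F = 0F
    transpose₀₁ 2F = 2F
    transpose₀₂ 0F = 2F
    transpose₀₂ 1F = 1F
    transpose₀₂ 2F = 0F
    transpose₁₂ 0F = 0F
    transpose₁₂ 1F = 2F
    transpose₁₂ 2F = 1F

    transpose₁₂² : ∀ a → transpose₁₂ (transpose₁₂ a) ≡ a
    transpose₁₂² 0F = refl
    transpose₁₂² 1F = refl
    transpose₁₂² 2F = refl

    π₁ π₂ π₄ : Fin 3 → Fin 3 → Fin 3
    π₁ 0F d = d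
    π₁ 1F d = transpose₀₁ d
    π₁ 2F d = transpose₀₂ d
    π₂ 1F d = transpose₁₂ d
    π₂ _  d = d
    π₄ 2F d = transpose₁₂ d
    π₄ _  d = d

    every₃² : ∀ {P : Fin 3 → Fin 3 → Set} → P 0F 0F → P 0F 1F → P 0F 2F → P 1F 0F → P 1F 1F → P 1F 2F →
              P 2F 0F → P 2F 1F → P 2F 2F → ∀ a d → P a d
    every₃² p₀ p₁ p₂ q₀ q₁ q₂ r₀ r₁ r₂ 0F 0F = p₀
    every₃² p₀ p₁ p₂ q₀ q₁ q₂ r₀ r₁ r₂ 0F 1F = p₁
    every₃² p₀ p₁ p₂ q₀ q₁ q₂ r₀ r₁ r₂ 0F 2F = p₂
    every₃² p₀ p₁ p₂ q₀ q₁ q₂ r₀ r₁ r₂ 1F 0F = q₀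
    every₃² p₀ p₁ p₂ q₀ q₁ q₂ r₀ r₁ r₂ 1F 1F = q₁
    every₃² p₀ p₁ p₂ q₀ q₁ q₂ r₀ r₁ r₂ 1F 2F = q₂
    every₃² p₀ p₁ p₂ q₀ q₁ q₂ r₀ r₁ r₂ 2F 0F = r₀
    every₃² p₀ p₁ p₂ q₀ q₁ q₂ r₀ r₁ r₂ 2F 1F = r₁
    every₃² p₀ p₁ p₂ q₀ q₁ q₂ r₀ r₁ r₂ 2F 2F = r₂

    value-swap : ∀ k r s z → value k s r z ≡ value k r s ⟨ Vec.β z , Vec.α z , Vec.γ z ⟩
    value-swap k r s ⟨ a , b , c ⟩ = cong (_+ c * + k) (ℤ.+-comm (a * s) (b * r))

    value-flip : ∀ k r s z → value k r (- s) z ≡ value k r s ⟨ Vec.α z , - Vec.β z , Vec.γ z ⟩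
    value-flip k r s ⟨ a , b , c ⟩ = lem a b c r s (+ k)
      where lem : ∀ a b c r s k → a * r + b * - s + c * k ≡ a * r + - b * s + c * k
            lem = solve-∀

  swap-t₁ : ∀ {n} {G : Graph n} {k r s} → Model t1 G k r s → Model t1 G k s r
  swap-t₁ {k = k} {r} {s} M = redart M π₁
    (every₃² refl refl refl refl refl refl refl refl refl) (every₃² refl refl refl refl refl refl refl refl refl)
    (λ a d → ≈-reflexive (trans (value-swap k r s (volt t1 a d)) (cong (value k r s)
      (every₃² {λ a d → ⟨ Vec.β (volt t1 a d) , Vec.α (volt t1 a d) , Vec.γ (volt t1 a d) ⟩ ≡ volt t1 a (π₁ a d)}
        refl refl refl refl refl refl refl refl refl a d))))

  flip-t₂ : ∀ {n} {G : Graph n} {k r s} → Model t2 G k r s → Model t2 G k r (- s)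
  flip-t₂ {k = k} {r} {s} M = redart M π₂
    (every₃² refl refl refl refl refl refl refl refl refl) (every₃² refl refl refl refl refl refl refl refl refl)
    (λ a d → ≈-reflexive (trans (value-flip k r s (volt t2 a d)) (cong (value k r s)
      (every₃² {λ a d → ⟨ Vec.α (volt t2 a d) , - Vec.β (volt t2 a d) , Vec.γ (volt t2 a d) ⟩ ≡ volt t2 a (π₂ a d)}
        refl refl refl refl refl refl refl refl refl a d))))

  flip-t₄ : ∀ {n} {G : Graph n} {k r s} → Model t4 G k r s → Model t4 G k r (- s)
  flip-t₄ {k = k} {r} {s} M = redart M π₄
    (every₃² refl refl refl refl refl refl refl refl refl) (every₃² refl refl refl refl refl refl refl refl refl)
    (λ a d → ≈-reflexive (trans (value-flip k r s (volt t4 a d)) (cong (value k r s)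
      (every₃² {λ a d → ⟨ Vec.α (volt t4 a d) , - Vec.β (volt t4 a d) , Vec.γ (volt t4 a d) ⟩ ≡ volt t4 a (π₄ a d)}
        refl refl refl refl refl refl refl refl refl a d))))

  ≡ᵇ-true : ∀ {m n} → (m ≡ᵇ n) ≡ true → m ≡ n
  ≡ᵇ-true {m} {n} e = ℕ.≡ᵇ⇒≡ m n (subst T (sym e) tt)

  allBelow-true : ∀ n {f i} → allBelow n f ≡ true → i ℕ.< n → f i ≡ true
  allBelow-true (suc n) {f} {i} e i<1+n with ∧-true {f n} e | i ℕ.≟ n
  ... | p , _ | yes refl = p
  ... | _ , q | no i≢n   = allBelow-true n q (ℕ.≤∧≢⇒< (ℕ.≤-pred i<1+n) i≢n)

  anyBelow-true : ∀ n {f} → anyBelow n f ≡ true → ∃ λ i → f i ≡ true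
  anyBelow-true (suc n) {f} e with ∨-true {f n} e
  ... | inj₁ p = n , p
  ... | inj₂ q = anyBelow-true n q

  %≡ᵇ0⇒≈0 : ∀ a p → (a % suc p ≡ᵇ 0) ≡ true → + a ≈ 0ℤ [ suc p ]
  %≡ᵇ0⇒≈0 a p e = ∣⇒≈0 (+ a) (ℕ.m%n≡0⇒n∣m a (suc p) (≡ᵇ-true e))

  congruent-true : ∀ j x y → congruent j x y ≡ true → x ≈ y [ 2 ℕ.* suc j ]
  congruent-true j x y e = ≈-trans (≈-reflexive (lem x y)) (≈-trans (+-congˡ-≈ y x-y≈0) (≈-reflexive (ℤ.+-identityʳ y)))
    where
      lem : ∀ x y → x ≡ y + (x - y)
      lem = solve-∀
      x-y≈0 : x - y ≈ 0ℤ [ 2 ℕ.* suc j ]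
      x-y≈0 = ≈-trans (≈-sym (residue (x - y))) (≈-reflexive (cong +_ (≡ᵇ-true e)))

  drop-zero : ∀ {m x y z} → x ≡ y + z → z ≈ 0ℤ [ m ] → x ≈ y [ m ]
  drop-zero {y = y} refl p = ≈-trans (+-congˡ-≈ y p) (≈-reflexive (ℤ.+-identityʳ y))

  -- Case analysis and enumeration for a given graph

  module Classify {n} {G : Graph n} (cubic : Cubic G) (vt : VertexTransitive G) (j : ℕ) where
    k = suc j
    m = 2 ℕ.* k

    module _ {t r s} (M : Model t G k r s) where
      open Regular M cubic using (dart-inj)
      open Soundness k r s
      open Evaluate k r s using (val; val-⊕; val-𝟎)

      k≉0 : ¬ Zero ⟨ 0ℤ , 0ℤ , 1ℤ ⟩
      k≉0 p = ℕ.1+n≢0 (residues-≡ {m} {k} {0} (ℕ.m<m+n k (ℕ.s≤s ℕ.z≤n)) (ℕ.s≤s ℕ.z≤n) k≈0)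
        where lem : ∀ r s k → k ≡ 0ℤ * r + 0ℤ * s + 1ℤ * k
              lem = solve-∀
              k≈0 : + k ≈ 0ℤ [ m ]
              k≈0 = ≈-trans (≈-reflexive (lem r s (+ k))) p

      2k≈0 : Zero ⟨ 0ℤ , 0ℤ , + 2 ⟩
      2k≈0 = ≈-trans (≈-reflexive (lem r s (+ 2 * + k))) (even*k≈0 k (by 1ℤ refl))
        where lem : ∀ r s x → 0ℤ * r + 0ℤ * s + x ≡ x
              lem = solve-∀

      separate : ∀ {u v} w → u ≡ v ⊕ w → Zero w → val u ≈ val v [ m ]
      separate {u} {v} w e w0 = drop-zero (trans (cong val e) (val-⊕ v w)) w0

      distinct-darts : ∀ a {d d′} → d ≢ d′ → head t a d ≡ head t a d′ → ∀ w → volt t a d ≡ volt t a d′ ⊕ w → ¬ Zero w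
      distinct-darts a {d} {d′} d≢d′ h w e w0 = d≢d′ (dart-inj a h (separate {volt t a d} {volt t a d′} w e w0))

    nonzero-sound : ∀ {t r s} (M : Model t G k r s) → All (λ v → ¬ Soundness.Zero k r s v) (nonzero t)
    nonzero-sound {t1} M = k≉0 M ∷ distinct-darts M 1F {1F} {0F} (λ ()) refl ⟨ 1ℤ , - 1ℤ , 0ℤ ⟩ refl ∷ []
    nonzero-sound {t2} M = k≉0 M ∷ distinct-darts M 0F {1F} {2F} (λ ()) refl ⟨ 1ℤ , 0ℤ , 0ℤ ⟩ refl
                                 ∷ distinct-darts M 1F {1F} {2F} (λ ()) refl ⟨ 0ℤ , + 2 , 0ℤ ⟩ refl ∷ []
    nonzero-sound {t3} M = []
    nonzero-sound {t4} M = k≉0 M ∷ distinct-darts M 1F {1F} {2F} (λ ()) refl ⟨ + 2 , 0ℤ , 0ℤ ⟩ refl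
                                 ∷ distinct-darts M 2F {1F} {2F} (λ ()) refl ⟨ 0ℤ , + 2 , 0ℤ ⟩ refl ∷ []

    analyse : ∀ {t r s} (M : Model t G k r s) B → Soundness.AllZero k r s B → ∀ vs tree →
              checks t B tree vs ≡ true → Soundness.Outcome k r s t (tables t 12) vs
    analyse {t} {r} {s} M B B0 vs tree e =
      Soundness.sound k r s t (tables t 12) vs (Regular.equalCounts M cubic vt 12) {B} B0 (nonzero-sound M) tree e

    -- Connectedness excludes a common divisor, distinctness of darts excludes the vectors of
    -- `nonzero`, and transitivity excludes unequal counts; only `expected` is left. The equality of
    -- counts is required for all parameters because it is applied to the residues of r and s.
    exceptional : ∀ {t r s} → Model t G k r s → ∀ Ts →
                  (∀ {r s} → Model t G k r s → ∀ T → T ∈ Ts → ∀ x y → Evaluate.eval k r s 0ℤ (T ⟦ x , x ⟧) ≡ Evaluate.eval k r s 0ℤ (T ⟦ y , y ⟧)) →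
                  brute t Ts ≡ true → k ℕ.≤ limit t →
                  ∃ λ r′ → ∃ λ s′ → Model t G k (+ r′) (+ s′) × expected t j r′ s′ ≡ true
    exceptional {t} {r} {s} M Ts equal e k≤limit = r′ , s′ , M′ , finish (∨-true {degenerate t j r′ s′} found)
      where
        r′ = r %ℕ m
        s′ = s %ℕ m
        M′ : Model t G k (+ r′) (+ s′)
        M′ = residues M (residue r) (residue s)
        found : degenerate t j r′ s′ ∨ expected t j r′ s′ ∨ irregular Ts j r′ s′ ≡ true
        found = allBelow-true m {λ s → degenerate t j r′ s ∨ expected t j r′ s ∨ irregular Ts j r′ s}
                  (allBelow-true m {λ r → allBelow m (λ s → degenerate t j r s ∨ expected t j r s ∨ irregular Ts j r s)}
                    (allBelow-true (limit t) {λ j → allBelow (2 ℕ.* suc j) λ r → allBelow (2 ℕ.* suc j) λ s →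
                        degenerate t j r s ∨ expected t j r s ∨ irregular Ts j r s} e k≤limit)
                    (ℤ.n%ℕd<d r m))
                  (ℤ.n%ℕd<d s m)

        no-divisor : ∀ p → commonDivisor j r′ s′ p ≡ true → ⊥
        no-divisor p e with ∧-true {suc j % suc (suc p) ≡ᵇ 0} e
        ... | e₁ , e′ with ∧-true {r′ % suc (suc p) ≡ᵇ 0} e′
        ... | e₂ , e₃ = ℕ.1+n≢0 (ℕ.suc-injective (Regular.coprime M′ cubic (suc (suc p))
          (%≡ᵇ0⇒≈0 r′ (suc p) e₂) (%≡ᵇ0⇒≈0 s′ (suc p) e₃) (%≡ᵇ0⇒≈0 k (suc p) e₁)))

        no-zero : ∀ {vs} → All (λ v → ¬ Soundness.Zero k (+ r′) (+ s′) v) vs → anyZero j r′ s′ vs ≡ true → ⊥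
        no-zero {v ∷ vs} (v≉0 ∷ ns) e with ∨-true {congruent j (value k (+ r′) (+ s′) v) 0ℤ} e
        ... | inj₁ p = v≉0 (congruent-true j (value k (+ r′) (+ s′) v) 0ℤ p)
        ... | inj₂ q = no-zero ns q

        not-degenerate : degenerate t j r′ s′ ≡ true → ⊥
        not-degenerate e with ∨-true {anyBelow 9 (commonDivisor j r′ s′)} e
        ... | inj₁ p = let i , q = anyBelow-true 9 {commonDivisor j r′ s′} p in no-divisor i q
        ... | inj₂ q = no-zero (nonzero-sound M′) q

        regular : ∀ Ts → (∀ T → T ∈ Ts → ∀ x y → closedCount j r′ s′ (T ⟦ x , x ⟧) ≡ closedCount j r′ s′ (T ⟦ y , y ⟧)) →
                  irregular Ts j r′ s′ ≡ false
        regular [] h = refl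
        regular (T ∷ Ts) h
          with closedCount j r′ s′ (T ⟦ 0F , 0F ⟧) ℤ.≟ closedCount j r′ s′ (T ⟦ 1F , 1F ⟧)
             | closedCount j r′ s′ (T ⟦ 0F , 0F ⟧) ℤ.≟ closedCount j r′ s′ (T ⟦ 2F , 2F ⟧)
        ... | no ¬p | _     = contradiction (h T (here refl) 0F 1F) ¬p
        ... | yes _ | no ¬q = contradiction (h T (here refl) 0F 2F) ¬q
        ... | yes _ | yes _ = regular Ts (λ T T∈ → h T (there T∈))

        finish : degenerate t j r′ s′ ≡ true ⊎ expected t j r′ s′ ∨ irregular Ts j r′ s′ ≡ true → expected t j r′ s′ ≡ true
        finish (inj₁ p) = ⊥-elim (not-degenerate p)
        finish (inj₂ q) with ∨-true {expected t j r′ s′} q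
        ... | inj₁ x = x
        ... | inj₂ x = contradiction (trans (sym (regular Ts (equal M′))) x) λ ()

    equal-closedCounts : ∀ {t r s} f → Model t G k r s → ∀ T → T ∈ tables t f →
                         ∀ x y → Evaluate.eval k r s 0ℤ (T ⟦ x , x ⟧) ≡ Evaluate.eval k r s 0ℤ (T ⟦ y , y ⟧)
    equal-closedCounts f M T T∈ = let L , e = ∈⇒nth T∈ in Regular.equalCounts M cubic vt f L T e

    module _ {t r s} (M : Model t G k r s) where
      bounded⇒≤limit : ∀ e → 1 ℕ.≤ e → e ℕ.≤ limit t → + e * r ≈ 0ℤ [ k ] → + e * s ≈ 0ℤ [ k ] → k ℕ.≤ limit t
      bounded⇒≤limit (suc e) _ e≤limit er es = ℕ.≤-trans (annihilator-bound (suc e) r s k (Regular.coprime M cubic) er es) e≤limit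

  -- For odd k exactly one of the two solutions r of 2 r = 3 s + k is even, and with that choice s
  -- is odd. The second alternative is the truncated tetrahedron.
  Result₁ : ∀ {n} → Graph n → ℕ → Set
  Result₁ G k = (∃ λ r → ∃ λ s → Model t1 G k r s × r ≈ 0ℤ [ 2 ] × + 2 * r ≈ + 3 * s + + k [ 2 ℕ.* k ] × + k ≈ 1ℤ [ 2 ])
              ⊎ (k ≡ 2 × ∃ λ s → Model t1 G k 0ℤ s)

  Result₂ : ∀ {n} → Graph n → ℕ → Set
  Result₂ G k = ∃ λ r → ∃ λ s → Model t2 G k r s × r ≈ + 2 * s [ 2 ℕ.* k ] × s ≈ 1ℤ [ 2 ] × + k ≈ 1ℤ [ 2 ]

  Result₄ : ∀ {n} → Graph n → ℕ → Set
  Result₄ G k = k ≡ 5 × ∃ λ r → ∃ λ s → Model t4 G k r s × ∃ λ c → c * r ≈ 1ℤ [ 10 ] × c * s ≈ + 3 [ 10 ]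

  even-j : ∀ j → (j % 2 ≡ᵇ 0) ≡ true → + suc j ≈ 1ℤ [ 2 ]
  even-j j e = +-congˡ-≈ 1ℤ (%≡ᵇ0⇒≈0 j 1 e)

  neg-odd : ∀ {s} → s ≈ 1ℤ [ 2 ] → - s ≈ 1ℤ [ 2 ]
  neg-odd p = ≈-trans (neg-cong-≈ p) (by (- 1ℤ) refl)

  %≡⇒≈ℕ : ∀ a b p → (a % suc p ≡ᵇ b) ≡ true → + a ≈ + b [ suc p ]
  %≡⇒≈ℕ a b p e = ≈-trans (≈-sym (residue {suc p} (+ a))) (≈-reflexive (cong +_ (≡ᵇ-true e)))

  -- Parities in the two families, and the sporadic parameters

  module Conclusions {n} {G : Graph n} (cubic : Cubic G) (vt : VertexTransitive G) (j : ℕ) where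
    open Classify cubic vt j

    expected⇒Result₁ : ∀ r s → Model t1 G k (+ r) (+ s) → expected t1 j r s ≡ true → Result₁ G k
    expected⇒Result₁ r s M e = first (∨-true {(j % 2 ≡ᵇ 0) ∧ (good₁ j r s ∨ good₁ j s r)} e)
      where
        use : ∀ r s → Model t1 G k (+ r) (+ s) → + k ≈ 1ℤ [ 2 ] → good₁ j r s ≡ true → Result₁ G k
        use r s M odd e = let e₁ , e₂ = ∧-true {r % 2 ≡ᵇ 0} e in
          inj₁ (+ r , + s , M , %≡ᵇ0⇒≈0 r 1 e₁ , congruent-true j (+ 2 * + r) (+ 3 * + s + + suc j) e₂ , odd)
        first : _ → Result₁ G k
        first (inj₁ p) = let p₁ , p₂ = ∧-true {j % 2 ≡ᵇ 0} p in
          [ use r s M (even-j j p₁) , use s r (swap-t₁ M) (even-j j p₁) ]′ (∨-true {good₁ j r s} p₂)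
        first (inj₂ q) = let q₁ , q₂ = ∧-true {j ≡ᵇ 1} q in
          inj₂ (cong suc (≡ᵇ-true q₁) ,
            [ (λ x → + s , residues M (≈-reflexive (cong +_ (sym (≡ᵇ-true x)))) ≈-refl)
            , (λ x → + r , residues (swap-t₁ M) (≈-reflexive (cong +_ (sym (≡ᵇ-true x)))) ≈-refl) ]′ (∨-true {r ≡ᵇ 0} q₂))

    small₁ : ∀ {r s} → Model t1 G k r s → k ℕ.≤ limit t1 → Result₁ G k
    small₁ M b = let r , s , M′ , e = exceptional M (tables t1 13) (equal-closedCounts 13) brute₁ b in expected⇒Result₁ r s M′ e

    module _ {r s} (M : Model t1 G k r s) (rel : + 2 * r ≈ + 3 * s + + k [ m ]) where
      open Model M

      -- For odd r we have k r = k, so 3k steps lead from u₀ to its neighbour uₖ. From v₀ they lead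
      -- to some vertex v, and no two vertices v are adjacent.
      not-odd₁ : ∀ {L τ} → Soundness.Signature k r s t1 (tables t1 12) [] L τ → ¬ (r ≈ 1ℤ [ 2 ])
      not-odd₁ {L} {τ} σ odd = conclude (vt (V 0F 0ℤ) (V 1F 0ℤ))
        where
          conclude : ¬ (Σ (Aut G) λ θ → _≅_.to θ (V 0F 0ℤ) ≡ V 1F 0ℤ)
          conclude (θ , eq) = absurd (walk-aut M cubic vt {[]} {12} {L} {τ} σ (reversible₁ k r s) θ (0F , 0ℤ) (1F , 0ℤ) eq)
            where
              kr≈k : 0ℤ + value k r s ⟨ 0ℤ , 0ℤ , 1ℤ ⟩ ≈ 0ℤ + + k * r [ m ]
              kr≈k = ≈-trans (≈-reflexive (lem r s (+ k))) (≈-trans (≈-sym (odd*k≈k k odd)) (≈-reflexive (lem′ r (+ k))))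
                where lem : ∀ r s k → 0ℤ + (0ℤ * r + 0ℤ * s + 1ℤ * k) ≡ k
                      lem = solve-∀
                      lem′ : ∀ r k → r * k ≡ 0ℤ + k * r
                      lem′ = solve-∀
              no-edge : ∀ {y} i → y ≡ V 1F i → ¬ G (V 1F 0ℤ) y
              no-edge i refl g = none (edge-nb 1F 0ℤ (V 1F i) g)
                where
                  none : ¬ (∃ λ d → V 1F i ≡ nb 1F 0ℤ d)
                  none (0F , e) = contradiction (proj₁ (V-inj e)) λ ()
                  none (1F , e) = contradiction (proj₁ (V-inj e)) λ ()
                  none (2F , e) = contradiction (proj₁ (V-inj e)) λ ()
              absurd : ¬ (∃ λ e → ∀ i → _≅_.to θ (at M cubic vt {[]} (pow (Walk.move t1 k r s true) i (0F , 0ℤ))) ≡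
                                        at M cubic vt {[]} (pow (Walk.move t1 k r s e) i (1F , 0ℤ)))
              absurd (e , h) = no-edge (0ℤ + + k * along e r)
                (trans (cong (_≅_.to θ ∘ at M cubic vt {[]}) (sym (walk₁ k r s true 0F k 0ℤ)))
                  (trans (h (k ℕ.* 3)) (cong (at M cubic vt {[]}) (walk₁ k r s e 1F k 0ℤ))))
                (subst (λ z → G z (_≅_.to θ (V 0F (0ℤ + + k * r)))) eq
                  (_≅_.pres θ _ _ (subst (G (V 0F 0ℤ)) (V-cong 0F kr≈k) (nb-edge 0F 0ℤ 0F))))

      -- If k were even as well as r, the relation would make s even, against connectedness.
      k-odd₁ : r ≈ 0ℤ [ 2 ] → + k ≈ 1ℤ [ 2 ]
      k-odd₁ even = decide (even⊎odd (+ k))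
        where
          s≈0 : + k ≈ 0ℤ [ 2 ] → s ≈ 0ℤ [ 2 ]
          s≈0 k0 = ≈-trans (by (- s) (lem₁ s)) (≈-trans (≈-sym (drop-zero {x = + 3 * s + + k} {y = + 3 * s} refl k0))
                     (≈-trans (≈-sym (≈-half {k} rel)) (*-congˡ-≈ {y = 0ℤ} (+ 2) even)))
            where
              lem₁ : ∀ s → s ≡ + 3 * s + - s * + 2
              lem₁ = solve-∀
          decide : _ → + k ≈ 1ℤ [ 2 ]
          decide (inj₂ odd) = odd
          decide (inj₁ k0) = contradiction (Regular.coprime M cubic 2 even (s≈0 k0) k0) λ ()

      family₁ : Result₁ G k
      family₁ = conclude (analyse M basis1B basis0 [] tree1B check1B)
        where
          basis0 : Soundness.AllZero k r s basis1B
          basis0 = ≈-trans (≈-reflexive (lem r s (+ k))) (≈-trans (+-congʳ-≈ _ rel) (≈-trans (≈-reflexive (lem′ s (+ k))) (even*k≈0 k (by 1ℤ refl))))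
                 ∷ 2k≈0 M ∷ []
            where lem : ∀ r s k → + 2 * r + - (+ 3) * s + + 1 * k ≡ + 2 * r + (- (+ 3) * s + k)
                  lem = solve-∀
                  lem′ : ∀ s k → + 3 * s + k + (- (+ 3) * s + k) ≡ + 2 * k
                  lem′ = solve-∀
          conclude : Soundness.Outcome k r s t1 (tables t1 12) [] → Result₁ G k
          conclude (Soundness.bounded e e≥1 e≤limit er es) = small₁ M (bounded⇒≤limit M e e≥1 e≤limit er es)
          conclude (Soundness.relation v () _)
          conclude (Soundness.signed _ L τ σ) = [ (λ even → inj₁ (r , s , M , even , rel , k-odd₁ even))
                                              , (λ odd → contradiction odd (not-odd₁ {L} {τ} σ)) ]′ (even⊎odd r)

    type₁ : ∀ {r s} → Model t1 G k r s → Result₁ G k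
    type₁ {r} {s} M = conclude (analyse M basis1A (2k≈0 M ∷ []) (families t1) tree1A check1A)
      where
        rearrange : ∀ r s → + 2 * r + - (+ 3) * s + + 1 * + k ≈ 0ℤ [ m ] → + 2 * r ≈ + 3 * s + + k [ m ]
        rearrange r s p = ≈-trans (≈-reflexive (lem r s (+ k)))
            (≈-trans (+-congʳ-≈ (+ 3 * s + + k) (+-cong-≈ p (neg-cong-≈ (even*k≈0 k {+ 2} (by 1ℤ refl))))) (≈-reflexive (ℤ.+-identityˡ _)))
          where
            lem : ∀ r s k → + 2 * r ≡ + 2 * r + - (+ 3) * s + + 1 * k + - (+ 2 * k) + (+ 3 * s + k)
            lem = solve-∀
        conclude : Soundness.Outcome k r s t1 (tables t1 12) (families t1) → Result₁ G k
        conclude (Soundness.bounded e e≥1 e≤limit er es) = small₁ M (bounded⇒≤limit M e e≥1 e≤limit er es)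
        conclude (Soundness.relation v (here refl) p) = family₁ M (rearrange r s p)
        conclude (Soundness.relation v (there (here refl)) p) =
          family₁ (swap-t₁ M) (rearrange s r (≈-trans (≈-reflexive (cong (_+ + 1 * + k) (ℤ.+-comm (+ 2 * s) (- (+ 3) * r)))) p))
        conclude (Soundness.signed () _ _ _)

    small₂ : ∀ {r s} → Model t2 G k r s → k ℕ.≤ limit t2 → Result₂ G k
    small₂ M b = let r , s , M′ , e = exceptional M (tables t2 13) (equal-closedCounts 13) brute₂ b in convert r s M′ e
      where
        convert : ∀ r s → Model t2 G k (+ r) (+ s) → expected t2 j r s ≡ true → Result₂ G k
        convert r s M e =
          let e₁ , e′ = ∧-true {j % 2 ≡ᵇ 0} e
              e₂ , e₃ = ∧-true {s % 2 ≡ᵇ 1} e′ in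
          [ (λ x → + r , + s , M , congruent-true j (+ r) (+ 2 * + s) x , %≡⇒≈ℕ s 1 1 e₂ , even-j j e₁)
          , (λ x → + r , - + s , flip-t₂ M , congruent-true j (+ r) (+ 2 * - + s) x , neg-odd (%≡⇒≈ℕ s 1 1 e₂) , even-j j e₁)
          ]′ (∨-true {congruent j (+ r) (+ 2 * + s)} e₃)

    module _ {r s} (M : Model t2 G k r s) (rel : r ≈ + 2 * s [ m ]) where
      open Model M

      module _ {L τ} (σ : Soundness.Signature k r s t2 (tables t2 12) [] L τ) where
        private
          label : Fin 3 × ℤ → Fin n
          label = at M cubic vt {[]}

          walk : ∀ (θ : Aut G) x y → _≅_.to θ (label x) ≡ label y → ∃ λ e → ∀ i →
                 _≅_.to θ (label (pow (Walk.move t2 k r s true) i x)) ≡ label (pow (Walk.move t2 k r s e) i y)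
          walk = walk-aut M cubic vt {[]} {12} {L} {τ} σ (reversible₂ k r s)

        -- From w₀ the k = 2q steps end at w with index q r = k s = k, a neighbour of w₀. From v₀
        -- they also end at index k, but v₀ and vₖ are adjacent only if k = ±s, and then 2 s = 0.
        not-even-odd : ∀ q → k ≡ q ℕ.* 2 → ¬ (s ≈ 1ℤ [ 2 ])
        not-even-odd q k≡ odd = let θ , eq = vt (V 2F 0ℤ) (V 1F 0ℤ) in absurd θ eq (walk θ (2F , 0ℤ) (1F , 0ℤ) eq)
          where
            ks≈k : s * + k ≈ + k [ m ]
            ks≈k = odd*k≈k k odd
            qr≈k : 0ℤ + value k r s ⟨ 0ℤ , 0ℤ , 1ℤ ⟩ ≈ 0ℤ + + q * r [ m ]
            qr≈k = ≈-trans (≈-reflexive (lem r s (+ k))) (≈-trans (≈-sym ks≈k) (≈-trans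
                     (≈-reflexive (trans (cong (s *_) (trans (cong +_ k≡) (ℤ.pos-* q 2))) (lem′ s (+ q))))
                     (+-congˡ-≈ 0ℤ (*-congˡ-≈ (+ q) (≈-sym rel)))))
              where lem : ∀ r s k → 0ℤ + (0ℤ * r + 0ℤ * s + 1ℤ * k) ≡ k
                    lem = solve-∀
                    lem′ : ∀ s q → s * (q * + 2) ≡ 0ℤ + q * (+ 2 * s)
                    lem′ = solve-∀
            end≈k : ∀ e → 0ℤ + + k * along e s ≈ + k [ m ]
            end≈k true  = ≈-trans (≈-reflexive (lem s (+ k))) ks≈k
              where lem : ∀ s k → 0ℤ + k * s ≡ s * k
                    lem = solve-∀
            end≈k false = ≈-trans (≈-reflexive (lem s (+ k))) (odd*k≈k k (neg-odd odd))
              where lem : ∀ s k → 0ℤ + k * - s ≡ - s * k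
                    lem = solve-∀
            2s≉0 : ¬ (+ 2 * s ≈ 0ℤ [ m ])
            2s≉0 p = distinct-darts M 1F {1F} {2F} (λ ()) refl ⟨ 0ℤ , + 2 , 0ℤ ⟩ refl (≈-trans (≈-reflexive (lem r s (+ k))) p)
              where lem : ∀ r s k → 0ℤ * r + + 2 * s + 0ℤ * k ≡ + 2 * s
                    lem = solve-∀
            k≉±s : ∀ x → x ≈ + k [ m ] → + 2 * x ≈ 0ℤ [ m ]
            k≉±s x p = ≈-trans (*-congˡ-≈ (+ 2) p) (even*k≈0 k (by 1ℤ refl))
            no-edge : ∀ {y} i → i ≈ + k [ m ] → y ≡ V 1F i → ¬ G (V 1F 0ℤ) y
            no-edge i i≈k refl g = none (edge-nb 1F 0ℤ (V 1F i) g)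
              where
                lem₁ : ∀ r s k → s ≡ 0ℤ + (0ℤ * r + 1ℤ * s + 0ℤ * k)
                lem₁ = solve-∀
                lem₂ : ∀ r s k → - s ≡ 0ℤ + (0ℤ * r + - 1ℤ * s + 0ℤ * k)
                lem₂ = solve-∀
                lem₃ : ∀ s → + 2 * s ≡ - (+ 2 * - s)
                lem₃ = solve-∀
                none : ¬ (∃ λ d → V 1F i ≡ nb 1F 0ℤ d)
                none (0F , e) = contradiction (proj₁ (V-inj e)) λ ()
                none (1F , e) = 2s≉0 (k≉±s s (≈-trans (≈-reflexive (lem₁ r s (+ k))) (≈-trans (≈-sym (proj₂ (V-inj e))) i≈k)))
                none (2F , e) = 2s≉0 (≈-trans (≈-reflexive (lem₃ s)) (neg-cong-≈ (k≉±s (- s) (≈-trans (≈-reflexive (lem₂ r s (+ k)))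
                                  (≈-trans (≈-sym (proj₂ (V-inj e))) i≈k)))))
            absurd : ∀ (θ : Aut G) → _≅_.to θ (V 2F 0ℤ) ≡ V 1F 0ℤ → ¬ (∃ λ e → ∀ i →
                     _≅_.to θ (label (pow (Walk.move t2 k r s true) i (2F , 0ℤ))) ≡ label (pow (Walk.move t2 k r s e) i (1F , 0ℤ)))
            absurd θ eq (e , h) = no-edge (0ℤ + + k * along e s) (end≈k e)
              (trans (cong (_≅_.to θ ∘ label) (sym (walk₂ k r s true 2F (λ ()) q 0ℤ)))
                (trans (h (q ℕ.* 2)) (cong label (trans (cong (λ i → pow (Walk.move t2 k r s e) i (1F , 0ℤ)) (sym k≡)) (walk₂-v k r s e k 0ℤ)))))
              (subst (λ z → G z (_≅_.to θ (V 2F (0ℤ + + q * r)))) eq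
                (_≅_.pres θ _ _ (subst (G (V 2F 0ℤ)) (V-cong 2F qr≈k) (nb-edge 2F 0ℤ 0F))))

        -- For even s we have k s = 0, so k steps from v₀ return to v₀. From u₀ an odd number of
        -- steps ends at a vertex w.
        not-odd-even : ∀ q → k ≡ suc (q ℕ.* 2) → ¬ (s ≈ 0ℤ [ 2 ])
        not-odd-even q k≡ even = let θ , eq = vt (V 1F 0ℤ) (V 0F 0ℤ) in absurd θ eq (walk θ (1F , 0ℤ) (0F , 0ℤ) eq)
          where
            ks≈0 : 0ℤ + + k * s ≈ 0ℤ [ m ]
            ks≈0 = ≈-trans (≈-reflexive (lem s (+ k))) (even*k≈0 k even)
              where lem : ∀ s k → 0ℤ + k * s ≡ s * k
                    lem = solve-∀
            lands-on-w : ∀ e x → ∃ λ i → Walk.move t2 k r s e (0F , x) ≡ (2F , i)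
            lands-on-w true  x = _ , refl
            lands-on-w false x = _ , refl
            absurd : ∀ (θ : Aut G) → _≅_.to θ (V 1F 0ℤ) ≡ V 0F 0ℤ → ¬ (∃ λ e → ∀ i →
                     _≅_.to θ (label (pow (Walk.move t2 k r s true) i (1F , 0ℤ))) ≡ label (pow (Walk.move t2 k r s e) i (0F , 0ℤ)))
            absurd θ eq (e , h) = 0≢2 (proj₁ (V-inj (trans (sym eq) (trans
                (cong (_≅_.to θ) (trans (V-cong 1F (≈-sym ks≈0)) (cong label (sym (walk₂-v k r s true k 0ℤ)))))
                (trans (h k) (trans (cong (λ i → label (pow (Walk.move t2 k r s e) i (0F , 0ℤ))) k≡)
                  (cong label (trans (cong (Walk.move t2 k r s e) (walk₂ k r s e 0F (λ ()) q 0ℤ)) (proj₂ (lands-on-w e (0ℤ + + q * along e r)))))))))))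
              where 0≢2 : ¬ (_≡_ {A = Fin 3} 0F 2F)
                    0≢2 ()

      family₂ : Result₂ G k
      family₂ = conclude (analyse M basis2B basis0 [] tree2B check2B)
        where
          basis0 : Soundness.AllZero k r s basis2B
          basis0 = ≈-trans (≈-reflexive (lem r s (+ k))) (≈-trans (+-congʳ-≈ (- (+ 2) * s) rel) (≈-reflexive (lem′ s)))
                 ∷ 2k≈0 M ∷ []
            where lem : ∀ r s k → + 1 * r + - (+ 2) * s + + 0 * k ≡ r + - (+ 2) * s
                  lem = solve-∀
                  lem′ : ∀ s → + 2 * s + - (+ 2) * s ≡ 0ℤ
                  lem′ = solve-∀
          s-even⇒k-odd : s ≈ 0ℤ [ 2 ] → + k ≈ 0ℤ [ 2 ] → ⊥
          s-even⇒k-odd s0 k0 = contradiction (Regular.coprime M cubic 2 (≈-trans (≈-half {k} rel) (*-congˡ-≈ {y = 0ℤ} (+ 2) s0)) s0 k0) λ ()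
          parity : ∀ L τ → Soundness.Signature k r s t2 (tables t2 12) [] L τ →
                   (s ≈ 0ℤ [ 2 ] ⊎ s ≈ 1ℤ [ 2 ]) → (∃ λ q → k ≡ q ℕ.* 2) ⊎ (∃ λ q → k ≡ suc (q ℕ.* 2)) → Result₂ G k
          parity L τ σ (inj₂ odd)  (inj₁ (q , e)) = contradiction odd (not-even-odd {L} {τ} σ q e)
          parity L τ σ (inj₁ even) (inj₂ (q , e)) = contradiction even (not-odd-even {L} {τ} σ q e)
          parity L τ σ (inj₂ odd)  (inj₂ (q , e)) = r , s , M , rel , odd ,
            by (+ q) (trans (cong +_ e) (cong (λ x → 1ℤ + x) (ℤ.pos-* q 2)))
          parity L τ σ (inj₁ even) (inj₁ (q , e)) = ⊥-elim (s-even⇒k-odd even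
            (by (+ q) (trans (cong +_ e) (trans (ℤ.pos-* q 2) (sym (ℤ.+-identityˡ (+ q * + 2)))))))
          halve : ∀ x → (∃ λ q → x ≡ q ℕ.* 2) ⊎ (∃ λ q → x ≡ suc (q ℕ.* 2))
          halve zero = inj₁ (0 , refl)
          halve (suc x) with halve x
          ... | inj₁ (q , e) = inj₂ (q , cong suc e)
          ... | inj₂ (q , e) = inj₁ (suc q , cong suc e)
          conclude : Soundness.Outcome k r s t2 (tables t2 12) [] → Result₂ G k
          conclude (Soundness.bounded e e≥1 e≤limit er es) = small₂ M (bounded⇒≤limit M e e≥1 e≤limit er es)
          conclude (Soundness.relation v () _)
          conclude (Soundness.signed _ L τ σ) = parity L τ σ (even⊎odd s) (halve k)

    type₂ : ∀ {r s} → Model t2 G k r s → Result₂ G k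
    type₂ {r} {s} M = conclude (analyse M basis2A (2k≈0 M ∷ []) (families t2) tree2A check2A)
      where
        conclude : Soundness.Outcome k r s t2 (tables t2 12) (families t2) → Result₂ G k
        conclude (Soundness.bounded e e≥1 e≤limit er es) = small₂ M (bounded⇒≤limit M e e≥1 e≤limit er es)
        conclude (Soundness.relation v (here refl) p) = family₂ (flip-t₂ M)
            (≈-trans (≈-reflexive (lem r s (+ k))) (≈-trans (+-congʳ-≈ (+ 2 * - s) p) (≈-reflexive (ℤ.+-identityˡ (+ 2 * - s)))))
          where lem : ∀ r s k → r ≡ + 1 * r + + 2 * s + + 0 * k + + 2 * - s
                lem = solve-∀
        conclude (Soundness.relation v (there (here refl)) p) = family₂ M
            (≈-trans (≈-reflexive (lem r s (+ k))) (≈-trans (+-congʳ-≈ (+ 2 * s) p) (≈-reflexive (ℤ.+-identityˡ (+ 2 * s)))))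
          where lem : ∀ r s k → r ≡ + 1 * r + - (+ 2) * s + + 0 * k + + 2 * s
                lem = solve-∀
        conclude (Soundness.signed () _ _ _)

    type₄ : ∀ {r s} → Model t4 G k r s → Result₄ G k
    type₄ {r} {s} M = conclude (analyse M basis4A (2k≈0 M ∷ []) (families t4) tree4A check4A)
      where
        convert : ∀ r s → Model t4 G k (+ r) (+ s) → expected t4 j r s ≡ true → Result₄ G k
        convert r s M e =
          let e₁ , e₂ = ∧-true {j ≡ᵇ 4} e
              c , e₃ = anyBelow-true 10 {good₄ r s} e₂
              e₄ , e₅ = ∧-true {(c ℕ.* r) % 10 ≡ᵇ 1} e₃ in
          cong suc (≡ᵇ-true e₁) ,
          [ (λ x → + r , + s , M , + c , product c r 1 e₄ , product c s 3 x)
          , (λ x → + r , - + s , flip-t₄ M , + c , product c r 1 e₄ ,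
               ≈-trans (≈-reflexive (sym (ℤ.neg-distribʳ-* (+ c) (+ s)))) (≈-trans (neg-cong-≈ (product c s 7 x)) (by (- 1ℤ) refl)))
          ]′ (∨-true {(c ℕ.* s) % 10 ≡ᵇ 3} e₅)
          where
            product : ∀ c x b → ((c ℕ.* x) % 10 ≡ᵇ b) ≡ true → + c * + x ≈ + b [ 10 ]
            product c x b e = ≈-trans (≈-reflexive (sym (ℤ.pos-* c x))) (%≡⇒≈ℕ (c ℕ.* x) b 9 e)
        conclude : Soundness.Outcome k r s t4 (tables t4 12) (families t4) → Result₄ G k
        conclude (Soundness.bounded e e≥1 e≤limit er es) =
          let r′ , s′ , M′ , e = exceptional M (tables t4 13) (equal-closedCounts 13) brute₄ (bounded⇒≤limit M e e≥1 e≤limit er es) in convert r′ s′ M′ e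
        conclude (Soundness.relation v (here refl) p) = contradiction p (k≉0 M)
        conclude (Soundness.signed () _ _ _)

  -- Graphs given by edge lists

  value-k : ∀ r s k → k ≡ 0ℤ * r + 0ℤ * s + 1ℤ * k
  value-k = solve-∀
  value-0 : ∀ r s k → 0ℤ ≡ 0ℤ * r + 0ℤ * s + 0ℤ * k
  value-0 = solve-∀
  value-r : ∀ r s k → r ≡ 1ℤ * r + 0ℤ * s + 0ℤ * k
  value-r = solve-∀
  value-s : ∀ r s k → s ≡ 0ℤ * r + 1ℤ * s + 0ℤ * k
  value-s = solve-∀

  Dart : Set
  Dart = Fin 3 × Fin 3

  -- One dart of each edge.
  primary : Type → List Dart
  primary t1 = (0F , 0F) ∷ (0F , 1F) ∷ (0F , 2F) ∷ (1F , 1F) ∷ (1F , 0F) ∷ []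
  primary t2 = (2F , 0F) ∷ (0F , 0F) ∷ (0F , 2F) ∷ (0F , 1F) ∷ (1F , 1F) ∷ []
  primary t3 = (0F , 0F) ∷ (1F , 0F) ∷ (2F , 0F) ∷ (0F , 1F) ∷ (0F , 2F) ∷ (1F , 1F) ∷ []
  primary t4 = (1F , 1F) ∷ (2F , 1F) ∷ (0F , 0F) ∷ (1F , 0F) ∷ (2F , 0F) ∷ []

  -- The same edge traversed backwards, as the number of a dart at its other end; a semi-edge is its
  -- own reverse.
  inverse : Type → Fin 3 → Fin 3 → Fin 3
  inverse t2 0F 1F = 2F
  inverse t2 0F 2F = 1F
  inverse t2 2F 1F = 2F
  inverse t2 2F 2F = 1F
  inverse t2 1F 1F = 2F
  inverse t2 1F 2F = 1F
  inverse t4 0F _  = 0F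
  inverse t4 1F 0F = 1F
  inverse t4 2F 0F = 2F
  inverse _  _  0F = 0F
  inverse _  _  1F = 2F
  inverse _  _  2F = 1F

  private
    _≟ᵈ_ : (x y : Dart) → Dec (x ≡ y)
    _≟ᵈ_ = ≡-dec F._≟_ F._≟_

    open import Data.List.Membership.DecPropositional _≟ᵈ_ using (_∈?_)

    Covered : Type → Set
    Covered t = ∀ a d → (a , d) ∈ primary t ⊎ (head t a d , inverse t a d) ∈ primary t

    covered? : ∀ t → Dec (Covered t)
    covered? t = F.all? λ a → F.all? λ d → ((a , d) ∈? primary t) ⊎-dec ((head t a d , inverse t a d) ∈? primary t)

    covered : ∀ t → Covered t
    covered t1 = toWitness {a? = covered? t1} tt
    covered t2 = toWitness {a? = covered? t2} tt
    covered t3 = toWitness {a? = covered? t3} tt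
    covered t4 = toWitness {a? = covered? t4} tt

    head-inverse? : ∀ t → Dec (∀ a d → head t (head t a d) (inverse t a d) ≡ a)
    head-inverse? t = F.all? λ a → F.all? λ d → head t (head t a d) (inverse t a d) F.≟ a

    head-inverse : ∀ t a d → head t (head t a d) (inverse t a d) ≡ a
    head-inverse t1 = toWitness {a? = head-inverse? t1} tt
    head-inverse t2 = toWitness {a? = head-inverse? t2} tt
    head-inverse t3 = toWitness {a? = head-inverse? t3} tt
    head-inverse t4 = toWitness {a? = head-inverse? t4} tt

    -- The coefficient of k keeps its sign because -k = k in ℤ₂ₖ.
    opposite : Vec → Vec
    opposite ⟨ a , b , c ⟩ = ⟨ - a , - b , c ⟩

    _≟_ : (u v : Vec) → _
    ⟨ a , b , c ⟩ ≟ ⟨ a′ , b′ , c′ ⟩ = ≡-dec ℤ._≟_ (≡-dec ℤ._≟_ ℤ._≟_) (a , b , c) (a′ , b′ , c′)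

    pack : ∀ {a b c a′ b′ c′ : ℤ} → (a , b , c) ≡ (a′ , b′ , c′) → ⟨ a , b , c ⟩ ≡ ⟨ a′ , b′ , c′ ⟩
    pack refl = refl

    volt-inverse : ∀ t a d → volt t (head t a d) (inverse t a d) ≡ opposite (volt t a d)
    volt-inverse t1 a d = pack (toWitness {a? = F.all? λ a → F.all? λ d → volt t1 (head t1 a d) (inverse t1 a d) ≟ opposite (volt t1 a d)} tt a d)
    volt-inverse t2 a d = pack (toWitness {a? = F.all? λ a → F.all? λ d → volt t2 (head t2 a d) (inverse t2 a d) ≟ opposite (volt t2 a d)} tt a d)
    volt-inverse t3 a d = pack (toWitness {a? = F.all? λ a → F.all? λ d → volt t3 (head t3 a d) (inverse t3 a d) ≟ opposite (volt t3 a d)} tt a d)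
    volt-inverse t4 a d = pack (toWitness {a? = F.all? λ a → F.all? λ d → volt t4 (head t4 a d) (inverse t4 a d) ≟ opposite (volt t4 a d)} tt a d)

    cancel : ∀ k r s i v → i + value k r s v + value k r s (opposite v) ≈ i [ 2 ℕ.* k ]
    cancel k r s i ⟨ a , b , c ⟩ = by c (trans (lem i a b c r s (+ k)) (cong (λ x → i + c * x) (sym (ℤ.pos-* 2 k))))
      where lem : ∀ i a b c r s k → i + (a * r + b * s + c * k) + (- a * r + - b * s + c * k) ≡ i + c * (+ 2 * k)
            lem = solve-∀

  module _ (t : Type) {n} {G : Graph n} {k : ℕ} {r s : ℤ} {V : Fin 3 → ℤ → Fin n} (lab : Labelling V (2 ℕ.* k)) where
    open Labelling lab
    private
      nb : Fin 3 → ℤ → Fin 3 → Fin n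
      nb a i d = V (head t a d) (i + value k r s (volt t a d))

      nb-inverse : ∀ a i d → nb (head t a d) (i + value k r s (volt t a d)) (inverse t a d) ≡ V a i
      nb-inverse a i d = trans (cong₂ (λ b v → V b (i + value k r s (volt t a d) + value k r s v)) (head-inverse t a d) (volt-inverse t a d))
                               (V-cong a (cancel k r s i (volt t a d)))

    allDarts : (∀ {x y} → G x y → G y x) → (∀ {a d} → (a , d) ∈ primary t → ∀ i → G (V a i) (nb a i d)) →
               ∀ a i d → G (V a i) (nb a i d)
    allDarts G-sym fwd a i d = [ (λ p → fwd p i)
      , (λ p → G-sym (subst (G _) (nb-inverse a i d) (fwd p (i + value k r s (volt t a d))))) ]′ (covered t a d)

    -- One dart of each edge suffices, since reversal supplies the others.
    fromEdges : (∀ {x y} → G x y → G y x) →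
                (∀ {a d} → (a , d) ∈ primary t → ∀ i → G (V a i) (nb a i d)) →
                (∀ {x y} → G x y → ∃ λ a → ∃ λ d → ∃ λ i → (x ≡ V a i × y ≡ nb a i d) ⊎ (y ≡ V a i × x ≡ nb a i d)) →
                Model t G k r s
    fromEdges G-sym fwd back = record
      { V = V ; labelling = lab
      ; nb-edge = allDarts G-sym fwd
      ; edge-nb = λ a i y g → find a i y (back g) }
      where
        find : ∀ a i y → (∃ λ b → ∃ λ d → ∃ λ j → (V a i ≡ V b j × y ≡ nb b j d) ⊎ (y ≡ V b j × V a i ≡ nb b j d)) → ∃ λ d → y ≡ nb a i d
        find a i y (b , d , j , inj₁ (e , f)) with V-inj e
        ... | refl , p = d , trans f (V-cong _ (+-congʳ-≈ _ (≈-sym p)))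
        find a i y (b , d , j , inj₂ (e , f)) with V-inj f
        ... | refl , p = inverse t b d , trans e (trans (sym (nb-inverse b j d)) (V-cong _ (+-congʳ-≈ _ (≈-sym p))))

  -- The edge of Tric contributed by a dart of voltage x, when orbit a is stored in block π a.
  edgeData : (Fin 3 → Fin 3) → Type → Dart × ℕ → ℕ × ℕ × ℕ
  edgeData π t ((a , d) , x) = toℕ (π a) , toℕ (π (head t a d)) , x

  module _ {N} (j : ℕ) (size : 3 ℕ.* (2 ℕ.* suc j) ≡ N) (π π⁻ : Fin 3 → Fin 3)
           (π⁻π : ∀ a → π⁻ (π a) ≡ a) (ππ⁻ : ∀ a → π (π⁻ a) ≡ a) where
    private
      m = 2 ℕ.* suc j

    block : Fin 3 → ℤ → Fin N
    block a i = cast size (combine (π a) (fromℕ< (ℤ.n%ℕd<d i m)))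

    toℕ-block : ∀ a i → toℕ (block a i) ≡ toℕ (π a) ℕ.* m ℕ.+ i %ℕ m
    toℕ-block a i = trans (F.toℕ-cast size _) (trans (F.toℕ-combine (π a) _)
      (cong₂ ℕ._+_ (ℕ.*-comm m (toℕ (π a))) (F.toℕ-fromℕ< (ℤ.n%ℕd<d i m))))

    private
      residue-of-ℕ : ∀ {x} → x ℕ.< m → (+ x) %ℕ m ≡ x
      residue-of-ℕ x<m = m<n⇒m%n≡m x<m

    block-labelling : Labelling block m
    block-labelling = record
      { V-cong = λ a {i} {i′} p → F.toℕ-injective (trans (toℕ-block a i) (trans (cong (toℕ (π a) ℕ.* m ℕ.+_) (≈⇒%≡ p)) (sym (toℕ-block a i′))))
      ; V-inj  = λ e → inj e
      ; V-surj = surj }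
      where
        uncast : ∀ {x y} → cast size x ≡ cast size y → x ≡ y
        uncast {x} {y} e = F.toℕ-injective (trans (sym (F.toℕ-cast size x)) (trans (cong toℕ e) (F.toℕ-cast size y)))
        inj : ∀ {a b i i′} → block a i ≡ block b i′ → a ≡ b × i ≈ i′ [ m ]
        inj {a} {b} {i} {i′} e with F.combine-injective (π a) (fromℕ< (ℤ.n%ℕd<d i m)) (π b) (fromℕ< (ℤ.n%ℕd<d i′ m)) (uncast e)
        ... | p , q = trans (sym (π⁻π a)) (trans (cong π⁻ p) (π⁻π b)) , %≡⇒≈ (F.fromℕ<-injective _ _ (ℤ.n%ℕd<d i m) (ℤ.n%ℕd<d i′ m) q)
        surj : ∀ x → ∃ λ a → ∃ λ i → block a i ≡ x
        surj x with F.combine-surjective {3} {m} (cast (sym size) x)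
        ... | a , y , e = π⁻ a , + toℕ y , F.toℕ-injective (trans (toℕ-block (π⁻ a) (+ toℕ y)) (trans
                (cong₂ (λ b z → toℕ b ℕ.* m ℕ.+ z) (ππ⁻ a) (residue-of-ℕ (F.toℕ<n y)))
                (trans (cong (ℕ._+ toℕ y) (ℕ.*-comm (toℕ a) m)) (trans (sym (F.toℕ-combine a y)) (trans (cong toℕ e) (F.toℕ-cast (sym size) x))))))

    module _ (t : Type) (r s : ℤ) (L : List (Dart × ℕ)) (L-darts : map proj₁ L ≡ primary t)
             (L-values : All (λ ((a , d) , x) → + x ≈ value (suc j) r s (volt t a d) [ m ]) L)
             (E : ℕ → ℕ → Set)
             (E⇒Tric : ∀ {x y} → E x y → TricE m (map (edgeData π t) L) x y) (Tric⇒E : ∀ {x y} → TricE m (map (edgeData π t) L) x y → E x y) where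

      -- `T1`, `T2` and the census graphs all consist of three blocks of size 2k with a list of
      -- connections, so one construction serves them all. `L` gives one dart of each edge, in the
      -- order of `primary`, together with its shift.
      genModel : Model t (gen N E) (suc j) r s
      genModel = fromEdges t block-labelling (λ { (inj₁ e) → inj₂ e ; (inj₂ e) → inj₁ e }) fwd
        (λ { (inj₁ e) → let a , d , i , p = back (E⇒Tric e) in a , d , i , inj₁ p
           ; (inj₂ e) → let a , d , i , p = back (E⇒Tric e) in a , d , i , inj₂ p })
        where
          nb : Fin 3 → ℤ → Fin 3 → Fin N
          nb a i d = block (head t a d) (i + value (suc j) r s (volt t a d))

          toℕ-nb : ∀ {a d x} → ((a , d) , x) ∈ L → ∀ i → toℕ (nb a i d) ≡ toℕ (π (head t a d)) ℕ.* m ℕ.+ (i %ℕ m ℕ.+ x) % m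
          toℕ-nb {a} {d} {x} ∈L i = trans (toℕ-block (head t a d) (i + value (suc j) r s (volt t a d))) (cong (toℕ (π (head t a d)) ℕ.* m ℕ.+_)
            (≈⇒%≡ {y = + (i %ℕ m ℕ.+ x)} (+-cong-≈ (≈-sym (residue i)) (≈-sym (All.lookup L-values ∈L)))))

          fwd : ∀ {a d} → (a , d) ∈ primary t → ∀ i → gen N E (block a i) (nb a i d)
          fwd {a} {d} p i with ∈-map⁻ proj₁ (subst ((a , d) ∈_) (sym L-darts) p)
          ... | (_ , x) , ∈L , refl = inj₁ (Tric⇒E (_ , _ , x , i %ℕ m , ∈-map⁺ (edgeData π t) ∈L , ℤ.n%ℕd<d i m , toℕ-block a i , toℕ-nb ∈L i))

          back : ∀ {X Y : Fin N} → TricE m (map (edgeData π t) L) (toℕ X) (toℕ Y) → ∃ λ a → ∃ λ d → ∃ λ i → X ≡ block a i × Y ≡ nb a i d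
          back (_ , _ , x , i , ∈cs , i<m , eX , eY) with ∈-map⁻ (edgeData π t) ∈cs
          ... | ((a , d) , _) , ∈L , refl = a , d , + i
              , F.toℕ-injective (trans eX (sym (trans (toℕ-block a (+ i)) (cong (toℕ (π a) ℕ.* m ℕ.+_) (residue-of-ℕ i<m)))))
              , F.toℕ-injective (trans eY (sym (trans (toℕ-nb ∈L (+ i)) (cong (λ z → toℕ (π (head t a d)) ℕ.* m ℕ.+ (z ℕ.+ x) % m) (residue-of-ℕ i<m)))))

  private
    1*m : ∀ k i → 2 ℕ.* k ℕ.+ i ≡ 1 ℕ.* (2 ℕ.* k) ℕ.+ i
    1*m k i = cong (ℕ._+ i) (sym (ℕ.*-identityˡ (2 ℕ.* k)))

    2*m : ∀ k i → 4 ℕ.* k ℕ.+ i ≡ 2 ℕ.* (2 ℕ.* k) ℕ.+ i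
    2*m k i = cong (ℕ._+ i) (ℕ.*-assoc 2 2 k)

    +0-mod : ∀ {j i} → i ℕ.< 2 ℕ.* suc j → i ≡ (i ℕ.+ 0) mod (2 ℕ.* suc j)
    +0-mod {i = i} i<m = sym (trans (cong (_% _) (ℕ.+-identityʳ i)) (m<n⇒m%n≡m i<m))

    3*2k : ∀ k → 3 ℕ.* (2 ℕ.* k) ≡ 6 ℕ.* k
    3*2k k = sym (ℕ.*-assoc 3 2 k)

  T1-model : ∀ j r s → Model t1 (T1 (suc j) r s) (suc j) (+ r) (+ s)
  T1-model j r s = genModel j (3*2k k) id id (λ _ → refl) (λ _ → refl) t1 (+ r) (+ s)
    (((0F , 0F) , k) ∷ ((0F , 1F) , 0) ∷ ((0F , 2F) , 0) ∷ ((1F , 1F) , r) ∷ ((1F , 0F) , s) ∷ []) refl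
    (≈-reflexive (value-k (+ r) (+ s) (+ k)) ∷ ≈-reflexive (value-0 (+ r) (+ s) (+ k)) ∷ ≈-reflexive (value-0 (+ r) (+ s) (+ k))
      ∷ ≈-reflexive (value-r (+ r) (+ s) (+ k)) ∷ ≈-reflexive (value-s (+ r) (+ s) (+ k)) ∷ [])
    (T1E k r s) to from
    where
      k = suc j
      m = 2 ℕ.* k
      cs = (0 , 0 , k) ∷ (0 , 1 , 0) ∷ (0 , 2 , 0) ∷ (1 , 2 , r) ∷ (1 , 2 , s) ∷ []
      to : ∀ {x y} → T1E k r s x y → TricE m cs x y
      to (i , i<m , inj₁ (p , q)) = 0 , 0 , k , i , here refl , i<m , p , q
      to (i , i<m , inj₂ (inj₁ (p , q))) = 0 , 1 , 0 , i , there (here refl) , i<m , p , trans q (trans (1*m k i) (cong (1 ℕ.* m ℕ.+_) (+0-mod i<m)))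
      to (i , i<m , inj₂ (inj₂ (inj₁ (p , q)))) = 0 , 2 , 0 , i , there (there (here refl)) , i<m , p , trans q (trans (2*m k i) (cong (2 ℕ.* m ℕ.+_) (+0-mod i<m)))
      to (i , i<m , inj₂ (inj₂ (inj₂ (inj₁ (p , q))))) = 1 , 2 , r , i , there (there (there (here refl))) , i<m , trans p (1*m k i) , trans q (2*m k _)
      to (i , i<m , inj₂ (inj₂ (inj₂ (inj₂ (p , q))))) = 1 , 2 , s , i , there (there (there (there (here refl)))) , i<m , trans p (1*m k i) , trans q (2*m k _)
      from : ∀ {x y} → TricE m cs x y → T1E k r s x y
      from (_ , _ , _ , i , here refl , i<m , p , q) = i , i<m , inj₁ (p , q)
      from (_ , _ , _ , i , there (here refl) , i<m , p , q) = i , i<m , inj₂ (inj₁ (p , trans q (sym (trans (1*m k i) (cong (1 ℕ.* m ℕ.+_) (+0-mod i<m))))))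
      from (_ , _ , _ , i , there (there (here refl)) , i<m , p , q) = i , i<m , inj₂ (inj₂ (inj₁ (p , trans q (sym (trans (2*m k i) (cong (2 ℕ.* m ℕ.+_) (+0-mod i<m)))))))
      from (_ , _ , _ , i , there (there (there (here refl))) , i<m , p , q) = i , i<m , inj₂ (inj₂ (inj₂ (inj₁ (trans p (sym (1*m k i)) , trans q (sym (2*m k _))))))
      from (_ , _ , _ , i , there (there (there (there (here refl)))) , i<m , p , q) = i , i<m , inj₂ (inj₂ (inj₂ (inj₂ (trans p (sym (1*m k i)) , trans q (sym (2*m k _))))))

  T2-model : ∀ j r s → Model t2 (T2 (suc j) r s) (suc j) (+ r) (+ s)
  T2-model j r s = genModel j (3*2k k) id id (λ _ → refl) (λ _ → refl) t2 (+ r) (+ s)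
    (((2F , 0F) , k) ∷ ((0F , 0F) , 0) ∷ ((0F , 2F) , 0) ∷ ((0F , 1F) , r) ∷ ((1F , 1F) , s) ∷ []) refl
    (≈-reflexive (value-k (+ r) (+ s) (+ k)) ∷ ≈-reflexive (value-0 (+ r) (+ s) (+ k)) ∷ ≈-reflexive (value-0 (+ r) (+ s) (+ k))
      ∷ ≈-reflexive (value-r (+ r) (+ s) (+ k)) ∷ ≈-reflexive (value-s (+ r) (+ s) (+ k)) ∷ [])
    (T2E k r s) to from
    where
      k = suc j
      m = 2 ℕ.* k
      cs = (2 , 2 , k) ∷ (0 , 1 , 0) ∷ (0 , 2 , 0) ∷ (0 , 2 , r) ∷ (1 , 1 , s) ∷ []
      to : ∀ {x y} → T2E k r s x y → TricE m cs x y
      to (i , i<m , inj₁ (p , q)) = 2 , 2 , k , i , here refl , i<m , trans p (2*m k i) , trans q (2*m k _)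
      to (i , i<m , inj₂ (inj₁ (p , q))) = 0 , 1 , 0 , i , there (here refl) , i<m , p , trans q (trans (1*m k i) (cong (1 ℕ.* m ℕ.+_) (+0-mod i<m)))
      to (i , i<m , inj₂ (inj₂ (inj₁ (p , q)))) = 0 , 2 , 0 , i , there (there (here refl)) , i<m , p , trans q (trans (2*m k i) (cong (2 ℕ.* m ℕ.+_) (+0-mod i<m)))
      to (i , i<m , inj₂ (inj₂ (inj₂ (inj₁ (p , q))))) = 0 , 2 , r , i , there (there (there (here refl))) , i<m , p , trans q (2*m k _)
      to (i , i<m , inj₂ (inj₂ (inj₂ (inj₂ (p , q))))) = 1 , 1 , s , i , there (there (there (there (here refl)))) , i<m , trans p (1*m k i) , trans q (1*m k _)
      from : ∀ {x y} → TricE m cs x y → T2E k r s x y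
      from (_ , _ , _ , i , here refl , i<m , p , q) = i , i<m , inj₁ (trans p (sym (2*m k i)) , trans q (sym (2*m k _)))
      from (_ , _ , _ , i , there (here refl) , i<m , p , q) = i , i<m , inj₂ (inj₁ (p , trans q (sym (trans (1*m k i) (cong (1 ℕ.* m ℕ.+_) (+0-mod i<m))))))
      from (_ , _ , _ , i , there (there (here refl)) , i<m , p , q) = i , i<m , inj₂ (inj₂ (inj₁ (p , trans q (sym (trans (2*m k i) (cong (2 ℕ.* m ℕ.+_) (+0-mod i<m)))))))
      from (_ , _ , _ , i , there (there (there (here refl))) , i<m , p , q) = i , i<m , inj₂ (inj₂ (inj₂ (inj₁ (p , trans q (sym (2*m k _))))))
      from (_ , _ , _ , i , there (there (there (there (here refl)))) , i<m , p , q) = i , i<m , inj₂ (inj₂ (inj₂ (inj₂ (trans p (sym (1*m k i)) , trans q (sym (1*m k _))))))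

  -- The truncated tetrahedron: r = 0 closes the triangles uᵢ vᵢ wᵢ.
  census-12-model : Model t1 (Tric 4 ((0 , 0 , 2) ∷ (0 , 1 , 0) ∷ (0 , 2 , 0) ∷ (1 , 2 , 0) ∷ (1 , 2 , 1) ∷ [])) 2 0ℤ 1ℤ
  census-12-model = genModel 1 refl id id (λ _ → refl) (λ _ → refl) t1 0ℤ 1ℤ
    (((0F , 0F) , 2) ∷ ((0F , 1F) , 0) ∷ ((0F , 2F) , 0) ∷ ((1F , 1F) , 0) ∷ ((1F , 0F) , 1) ∷ []) refl
    (≈-refl ∷ ≈-refl ∷ ≈-refl ∷ ≈-refl ∷ ≈-refl ∷ []) _ id id

  -- Tutte's 8-cage.
  census-30-model : Model t4 (Tric 10 ((0 , 0 , 1) ∷ (1 , 1 , 3) ∷ (2 , 2 , 5) ∷ (0 , 2 , 0) ∷ (1 , 2 , 0) ∷ [])) 5 1ℤ (+ 3)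
  census-30-model = genModel 4 refl π π⁻ (λ { 0F → refl ; 1F → refl ; 2F → refl }) (λ { 0F → refl ; 1F → refl ; 2F → refl }) t4 1ℤ (+ 3)
    (((1F , 1F) , 1) ∷ ((2F , 1F) , 3) ∷ ((0F , 0F) , 5) ∷ ((1F , 0F) , 0) ∷ ((2F , 0F) , 0) ∷ []) refl
    (≈-refl ∷ ≈-refl ∷ ≈-refl ∷ ≈-refl ∷ ≈-refl ∷ []) _ id id
    where
      π π⁻ : Fin 3 → Fin 3
      π 0F = 2F
      π 1F = 0F
      π 2F = 1F
      π⁻ 0F = 1F
      π⁻ 1F = 2F
      π⁻ 2F = 0F

  -- Congruences modulo k and modulo 2k

  ≈-down : ∀ {k g x y} → x ≈ y [ 2 ℕ.* k ] → + k ≈ 0ℤ [ g ] → x ≈ y [ g ]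
  ≈-down {k} {g} {y = y} (by q refl) k0 = ≈-trans (+-congˡ-≈ y (≈-trans (≈-reflexive (cong (q *_) (ℤ.pos-* 2 k)))
    (*-congˡ-≈ {y = 0ℤ} q (*-congˡ-≈ {y = 0ℤ} (+ 2) k0)))) (≈-reflexive (lem y q))
    where lem : ∀ y q → y + q * 0ℤ ≡ y
          lem = solve-∀

  -- If c s = 1 + q k with q odd, replace c by c + k: this adds k s, and for odd s the total
  -- multiple of k becomes even.
  lift-unit : ∀ k c s → s ≈ 1ℤ [ 2 ] → c * s ≈ 1ℤ [ k ] → ∃ λ c′ → c′ * s ≈ 1ℤ [ 2 ℕ.* k ]
  lift-unit k c s (by f s≡) (by q e) = go (even⊎odd q)
    where
      go : q ≈ 0ℤ [ 2 ] ⊎ q ≈ 1ℤ [ 2 ] → ∃ λ c′ → c′ * s ≈ 1ℤ [ 2 ℕ.* k ]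
      go (inj₁ (by h q≡)) = c , by h (trans e (cong (λ t → 1ℤ + t) (trans (cong (_* + k) q≡) (trans (lem h (+ k)) (cong (h *_) (sym (ℤ.pos-* 2 k)))))))
        where lem : ∀ h k → (0ℤ + h * + 2) * k ≡ h * (+ 2 * k)
              lem = solve-∀
      go (inj₂ (by h q≡)) = c + + k , by (1ℤ + h + f) (trans (ℤ.*-distribʳ-+ s c (+ k)) (trans (cong₂ (λ a b → a + + k * b) e s≡)
          (trans (cong (λ q → 1ℤ + q * + k + + k * (1ℤ + f * + 2)) q≡) (trans (lem h f (+ k)) (cong (λ t → 1ℤ + (1ℤ + h + f) * t) (sym (ℤ.pos-* 2 k)))))))
        where lem : ∀ h f k → 1ℤ + (1ℤ + h * + 2) * k + k * (1ℤ + f * + 2) ≡ 1ℤ + (1ℤ + h + f) * (+ 2 * k)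
              lem = solve-∀

  -- Here x - y = q k; since k is odd, q has the parity of x - y.
  crt : ∀ {k x y} → + k ≈ 1ℤ [ 2 ] → x ≈ y [ k ] → x ≈ y [ 2 ] → x ≈ y [ 2 ℕ.* k ]
  crt {k} {x} {y} odd (by q refl) p = go q≈0
    where
      q≈0 : q ≈ 0ℤ [ 2 ]
      q≈0 = ≈-trans (≈-reflexive (sym (ℤ.*-identityʳ q))) (≈-trans (≈-sym (*-congˡ-≈ {y = 1ℤ} q odd))
              (+-cancelˡ-≈ y {q * + k} {0ℤ} (≈-trans p (≈-reflexive (sym (ℤ.+-identityʳ y))))))
      go : q ≈ 0ℤ [ 2 ] → y + q * + k ≈ y [ 2 ℕ.* k ]
      go (by h q≡) = by h (cong (λ t → y + t) (trans (cong (_* + k) q≡) (trans (lem h (+ k)) (cong (h *_) (sym (ℤ.pos-* 2 k))))))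
        where lem : ∀ h k → (0ℤ + h * + 2) * k ≡ h * (+ 2 * k)
              lem = solve-∀

  halve-≈ : ∀ {k x y} → + 2 * x ≈ + 2 * y [ 2 ℕ.* k ] → x ≈ y [ k ]
  halve-≈ {k} {x} {y} (by q e) = by q (ℤ.*-cancelˡ-≡ (+ 2) x (y + q * + k) (trans e (trans (cong (λ t → + 2 * y + q * t) (ℤ.pos-* 2 k)) (lem y q (+ k)))))
    where lem : ∀ y q k → + 2 * y + q * (+ 2 * k) ≡ + 2 * (y + q * k)
          lem = solve-∀

  ≈1⇒Odd : ∀ k → + k ≈ 1ℤ [ 2 ] → Odd k
  ≈1⇒Odd k p = ≈⇒%≡ {2} p

  -- (k + 3) / 2 is even if k ≡ 1 modulo 4. If k ≡ 3 it is odd, and adding the odd number k corrects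
  -- the parity without changing the double modulo 2k. So r* is the even solution of the relation of
  -- type 1 at s = 1.
  rstar-spec : ∀ k → + k ≈ 1ℤ [ 2 ] → + 2 * + rstar k ≈ + 3 + + k [ 2 ℕ.* k ] × + rstar k ≈ 0ℤ [ 2 ]
  rstar-spec k odd with k % 4 in e | m≡m%n+[m/n]*n k 4 | m%n<n k 4
  ... | 0 | k≡ | _ = ⊥-elim (1≉0 (≈-trans (≈-sym odd) (by (+ (k / 4) * + 2) (trans (cong +_ k≡) (trans (ℤ.pos-* (k / 4) 4) (lem (+ (k / 4))))))))
    where lem : ∀ q → q * + 4 ≡ 0ℤ + q * + 2 * + 2
          lem = solve-∀
  ... | 2 | k≡ | _ = ⊥-elim (1≉0 (≈-trans (≈-sym odd) (by (1ℤ + + (k / 4) * + 2) (trans (cong +_ k≡) (trans (cong (λ t → + 2 + t) (ℤ.pos-* (k / 4) 4)) (lem (+ (k / 4))))))))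
    where lem : ∀ q → + 2 + q * + 4 ≡ 0ℤ + (1ℤ + q * + 2) * + 2
          lem = solve-∀
  ... | suc (suc (suc (suc _))) | _ | ℕ.s≤s (ℕ.s≤s (ℕ.s≤s (ℕ.s≤s ())))
  ... | 1 | k≡ | _ = ≈-reflexive (trans (cong (λ x → + 2 * + x) half) (trans (cong (+ 2 *_) (cong (λ t → + 2 + t) (ℤ.pos-* q 2))) (trans (lem (+ q))
          (sym (cong (λ x → + 3 + x) (trans (cong +_ k≡) (cong (λ t → 1ℤ + t) (ℤ.pos-* q 4))))))))
      , by (1ℤ + + q) (trans (cong +_ half) (trans (cong (λ t → + 2 + t) (ℤ.pos-* q 2)) (lem₂ (+ q))))
    where
      q = k / 4
      lemℕ : ∀ q → 1 ℕ.+ q ℕ.* 4 ℕ.+ 3 ≡ (2 ℕ.+ q ℕ.* 2) ℕ.* 2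
      lemℕ = ℕ.solve-∀
      half : (k ℕ.+ 3) / 2 ≡ 2 ℕ.+ q ℕ.* 2
      half = trans (cong (λ k → (k ℕ.+ 3) / 2) k≡) (trans (cong (_/ 2) (lemℕ q)) (m*n/n≡m (2 ℕ.+ q ℕ.* 2) 2))
      lem : ∀ q → + 2 * (+ 2 + q * + 2) ≡ + 3 + (1ℤ + q * + 4)
      lem = solve-∀
      lem₂ : ∀ q → + 2 + q * + 2 ≡ 0ℤ + (1ℤ + q) * + 2
      lem₂ = solve-∀
  ... | 3 | k≡ | _ = by 1ℤ (trans (cong (λ x → + 2 * x) whole) (trans (lem (+ q)) (sym
          (cong₂ (λ x y → + 3 + x + 1ℤ * y) kℤ (trans (ℤ.pos-* 2 k) (cong (+ 2 *_) kℤ))))))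
      , by (+ 3 * (1ℤ + + q)) (trans whole (lem₂ (+ q)))
    where
      q = k / 4
      kℤ : + k ≡ + 3 + + q * + 4
      kℤ = trans (cong +_ k≡) (cong (λ t → + 3 + t) (ℤ.pos-* q 4))
      lemℕ : ∀ q → 3 ℕ.+ q ℕ.* 4 ℕ.+ 3 ≡ (3 ℕ.+ q ℕ.* 2) ℕ.* 2
      lemℕ = ℕ.solve-∀
      half : (k ℕ.+ 3) / 2 ≡ 3 ℕ.+ q ℕ.* 2
      half = trans (cong (λ k → (k ℕ.+ 3) / 2) k≡) (trans (cong (_/ 2) (lemℕ q)) (m*n/n≡m (3 ℕ.+ q ℕ.* 2) 2))
      whole : + ((k ℕ.+ 3) / 2 ℕ.+ k) ≡ + 3 + + q * + 2 + (+ 3 + + q * + 4)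
      whole = cong₂ _+_ (trans (cong +_ half) (cong (λ t → + 3 + t) (ℤ.pos-* q 2))) kℤ
      lem : ∀ q → + 2 * (+ 3 + q * + 2 + (+ 3 + q * + 4)) ≡ + 3 + (+ 3 + q * + 4) + 1ℤ * (+ 2 * (+ 3 + q * + 4))
      lem = solve-∀
      lem₂ : ∀ q → + 3 + q * + 2 + (+ 3 + q * + 4) ≡ 0ℤ + + 3 * (1ℤ + q) * + 2
      lem₂ = solve-∀

  -- Strands: prisms and Möbius ladders

  offset : Fin 3 → ℤ
  offset 0F = 0ℤ
  offset 1F = 1ℤ
  offset 2F = - 1ℤ

  -- Along a strand the vertices wᵢ, uᵢ, vᵢ occupy the consecutive places 3i - 1, 3i, 3i + 1.
  position : Fin 3 → ℤ → ℤ
  position a i = + 3 * i + offset a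

  residue-mod-3 : ∀ z → ∃ λ a → ∃ λ i → z ≡ position a i
  residue-mod-3 z with z %ℕ 3 | ℤ.a≡a%ℕn+[a/ℕn]*n z 3 | ℤ.n%ℕd<d z 3
  ... | 0 | e | _ = 0F , z /ℕ 3 , trans e (lem (z /ℕ 3))
    where lem : ∀ q → 0ℤ + q * + 3 ≡ + 3 * q + 0ℤ
          lem = solve-∀
  ... | 1 | e | _ = 1F , z /ℕ 3 , trans e (lem (z /ℕ 3))
    where lem : ∀ q → 1ℤ + q * + 3 ≡ + 3 * q + 1ℤ
          lem = solve-∀
  ... | 2 | e | _ = 2F , 1ℤ + z /ℕ 3 , trans e (lem (z /ℕ 3))
    where lem : ∀ q → + 2 + q * + 3 ≡ + 3 * (1ℤ + q) + - 1ℤ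
          lem = solve-∀
  ... | suc (suc (suc _)) | _ | ℕ.s≤s (ℕ.s≤s (ℕ.s≤s ()))

  offset-inj : ∀ a b → offset a ≈ offset b [ 3 ] → a ≡ b
  offset-inj 0F 0F _ = refl
  offset-inj 1F 1F _ = refl
  offset-inj 2F 2F _ = refl
  offset-inj 0F 1F p = contradiction (≈⇒%≡ {3} p) λ ()
  offset-inj 0F 2F p = contradiction (≈⇒%≡ {3} p) λ ()
  offset-inj 1F 0F p = contradiction (≈⇒%≡ {3} p) λ ()
  offset-inj 1F 2F p = contradiction (≈⇒%≡ {3} p) λ ()
  offset-inj 2F 0F p = contradiction (≈⇒%≡ {3} p) λ ()
  offset-inj 2F 1F p = contradiction (≈⇒%≡ {3} p) λ ()

  position-mod-3 : ∀ a b i j → position a i ≈ position b j [ 3 ] → a ≡ b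
  position-mod-3 a b i j p = offset-inj a b (≈-trans (≈-sym (drop a i)) (≈-trans p (drop b j)))
    where
      lem : ∀ i o → + 3 * i + o ≡ o + i * + 3
      lem = solve-∀
      drop : ∀ a i → position a i ≈ offset a [ 3 ]
      drop a i = by i (lem i (offset a))

  position-inj : ∀ a i j k → position a i ≈ position a j [ 3 ℕ.* k ] → i ≈ j [ k ]
  position-inj a i j k (by q e) = by q (ℤ.*-cancelˡ-≡ (+ 3) i (j + q * + k) (trans (lem₁ i (offset a)) (trans (cong (_- offset a) e)
      (trans (cong (λ t → + 3 * j + offset a + q * t - offset a) (ℤ.pos-* 3 k)) (lem₂ j (offset a) q (+ k))))))
    where lem₁ : ∀ i o → + 3 * i ≡ + 3 * i + o - o
          lem₁ = solve-∀
          lem₂ : ∀ j o q k → + 3 * j + o + q * (+ 3 * k) - o ≡ + 3 * (j + q * k)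
          lem₂ = solve-∀

  same-position : ∀ a b i j k → position a i ≈ position b j [ 3 ℕ.* k ] → a ≡ b × i ≈ j [ k ]
  same-position a b i j k p = a≡b , position-inj a i j k (subst (λ b → position a i ≈ position b j [ 3 ℕ.* k ]) (sym a≡b) p)
    where
      a≡b : a ≡ b
      a≡b = position-mod-3 a b i j (≈-coarsen k (subst (λ m → position a i ≈ position b j [ m ]) (ℕ.*-comm 3 k) p))

  position-cong : ∀ a {i j} k → i ≈ j [ k ] → position a i ≈ position a j [ 3 ℕ.* k ]
  position-cong a {j = j} k (by q refl) = by q (trans (lem j (offset a) q (+ k)) (cong (λ t → + 3 * j + offset a + q * t) (sym (ℤ.pos-* 3 k))))
    where lem : ∀ j o q k → + 3 * (j + q * k) + o ≡ + 3 * j + o + q * (+ 3 * k)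
          lem = solve-∀

  -- The vertices of a type 3 graph lie on one or two closed strands uᵢ vᵢ wᵢ₊ᵣ uᵢ₊ᵣ …; a vertex has
  -- coordinates (p , z), where z is the position along its strand and p is only used to tell strands apart.
  module Strands {n} {G : Graph n} (k : ℕ) (r : ℤ) (at : ℤ → ℤ → Fin n)
    (_∼_ : ℤ × ℤ → ℤ × ℤ → Set) (at-cong : ∀ {p z p′ z′} → (p , z) ∼ (p′ , z′) → at p z ≡ at p′ z′)
    (shift : ∀ a b {p z p′ z′} → (p , z) ∼ (p′ , z′) → (p + a , z + b) ∼ (p′ + a , z′ + b))
    (locate : ∀ p z → ∃ λ a → ∃ λ i → (p , z) ∼ (i , position a i))
    -- The strand leaves vᵢ towards wᵢ₊ᵣ; this is the only place where r enters.
    (turn : ∀ i → at i (position 1F i + 1ℤ) ≡ at (i + r) (position 2F (i + r)))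
    (lab : Labelling (λ a i → at i (position a i)) (2 ℕ.* k))
    (G-sym : ∀ {x y} → G x y → G y x)
    (rim : ∀ p z → G (at p z) (at p (z + 1ℤ)))
    (spoke : ∀ p z → G (at p z) (at (p + + k) (z + + 3 * + k)))
    (back : ∀ {x y} → G x y → ∃ λ p → ∃ λ z → (x ≡ at p z × (y ≡ at p (z + 1ℤ) ⊎ y ≡ at (p + + k) (z + + 3 * + k)))
                                             ⊎ (y ≡ at p z × (x ≡ at p (z + 1ℤ) ⊎ x ≡ at (p + + k) (z + + 3 * + k))))
    where
    private
      V : Fin 3 → ℤ → Fin n
      V a i = at i (position a i)

      val : Vec → ℤ
      val = value k r 0ℤ

      nb : Fin 3 → ℤ → Fin 3 → Fin n
      nb a i d = V (head t3 a d) (i + val (volt t3 a d))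

      k-val : ∀ i → i + val ⟨ 0ℤ , 0ℤ , 1ℤ ⟩ ≡ i + + k
      k-val i = lem i r (+ k)
        where lem : ∀ i r k → i + (0ℤ * r + 0ℤ * 0ℤ + 1ℤ * k) ≡ i + k
              lem = solve-∀
      0-val : ∀ i → i + val ⟨ 0ℤ , 0ℤ , 0ℤ ⟩ ≡ i
      0-val i = lem i r (+ k)
        where lem : ∀ i r k → i + (0ℤ * r + 0ℤ * 0ℤ + 0ℤ * k) ≡ i
              lem = solve-∀
      r-val : ∀ i → i + val ⟨ 1ℤ , 0ℤ , 0ℤ ⟩ ≡ i + r
      r-val i = lem i r (+ k)
        where lem : ∀ i r k → i + (1ℤ * r + 0ℤ * 0ℤ + 0ℤ * k) ≡ i + r
              lem = solve-∀

      nb-spoke : ∀ a i → nb a i 0F ≡ at (i + + k) (position a i + + 3 * + k)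
      nb-spoke 0F i = trans (cong (V 0F) (k-val i)) (cong (at (i + + k)) (lem i (+ k)))
        where lem : ∀ i k → + 3 * (i + k) + 0ℤ ≡ + 3 * i + 0ℤ + + 3 * k
              lem = solve-∀
      nb-spoke 1F i = trans (cong (V 1F) (k-val i)) (cong (at (i + + k)) (lem i (+ k)))
        where lem : ∀ i k → + 3 * (i + k) + 1ℤ ≡ + 3 * i + 1ℤ + + 3 * k
              lem = solve-∀
      nb-spoke 2F i = trans (cong (V 2F) (k-val i)) (cong (at (i + + k)) (lem i (+ k)))
        where lem : ∀ i k → + 3 * (i + k) + - 1ℤ ≡ + 3 * i + - 1ℤ + + 3 * k
              lem = solve-∀

      u-v : ∀ i → nb 0F i 1F ≡ at i (position 0F i + 1ℤ)
      u-v i = trans (cong (V 1F) (0-val i)) (cong (at i) (lem i))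
        where lem : ∀ i → + 3 * i + 1ℤ ≡ + 3 * i + 0ℤ + 1ℤ
              lem = solve-∀

      u-w : ∀ i → nb 0F i 2F ≡ at i (position 2F i)
      u-w i = cong (V 2F) (0-val i)

      w-u : ∀ i → at i (position 2F i + 1ℤ) ≡ V 0F i
      w-u i = cong (at i) (lem i)
        where lem : ∀ i → + 3 * i + - 1ℤ + 1ℤ ≡ + 3 * i + 0ℤ
              lem = solve-∀

      v-w : ∀ i → nb 1F i 1F ≡ at i (position 1F i + 1ℤ)
      v-w i = trans (cong (V 2F) (r-val i)) (sym (turn i))

      Match : Fin n → Fin n → Set
      Match x y = ∃ λ a → ∃ λ d → ∃ λ i → (x ≡ V a i × y ≡ nb a i d) ⊎ (y ≡ V a i × x ≡ nb a i d)

      swap : ∀ {x y} → Match x y → Match y x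
      swap (a , d , i , inj₁ p) = a , d , i , inj₂ p
      swap (a , d , i , inj₂ p) = a , d , i , inj₁ p

      along-rim : ∀ a i → Match (V a i) (at i (position a i + 1ℤ))
      along-rim 0F i = 0F , 1F , i , inj₁ (refl , sym (u-v i))
      along-rim 1F i = 1F , 1F , i , inj₁ (refl , sym (v-w i))
      along-rim 2F i = 0F , 2F , i , inj₂ (w-u i , sym (u-w i))

      match : ∀ {x y} p z → x ≡ at p z → y ≡ at p (z + 1ℤ) ⊎ y ≡ at (p + + k) (z + + 3 * + k) → Match x y
      match p z refl (inj₁ refl) = let a , i , c = locate p z in
        subst₂ Match (sym (at-cong c)) (sym (trans (cong (λ q → at q (z + 1ℤ)) (sym (ℤ.+-identityʳ p)))
          (trans (at-cong (shift 0ℤ 1ℤ c)) (cong (λ q → at q (position a i + 1ℤ)) (ℤ.+-identityʳ i))))) (along-rim a i)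
      match p z refl (inj₂ refl) = let a , i , c = locate p z in
        a , 0F , i , inj₁ (at-cong c , trans (at-cong (shift (+ k) (+ 3 * + k) c)) (sym (nb-spoke a i)))

      data Forward : Fin 3 → Fin 3 → Set where
        spokes : ∀ a → Forward a 0F
        uv : Forward 0F 1F
        uw : Forward 0F 2F
        vw : Forward 1F 1F

      fwd : ∀ {a d} → Forward a d → ∀ i → G (V a i) (nb a i d)
      fwd (spokes a) i = subst (G (V a i)) (sym (nb-spoke a i)) (spoke i (position a i))
      fwd uv i = subst (G (V 0F i)) (sym (u-v i)) (rim i (position 0F i))
      fwd uw i = G-sym (subst₂ G (sym (u-w i)) (w-u i) (rim i (position 2F i)))
      fwd vw i = subst (G (V 1F i)) (sym (v-w i)) (rim i (position 1F i))

    model : Model t3 G k r 0ℤ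
    model = fromEdges t3 lab G-sym primary-edge find
      where
        find : ∀ {x y} → G x y → Match x y
        find g with back g
        ... | p , z , inj₁ (e , f) = match p z e f
        ... | p , z , inj₂ (e , f) = swap (match p z e f)
        primary-edge : ∀ {a d} → (a , d) ∈ primary t3 → ∀ i → G (V a i) (nb a i d)
        primary-edge (here refl) = fwd (spokes 0F)
        primary-edge (there (here refl)) = fwd (spokes 1F)
        primary-edge (there (there (here refl))) = fwd (spokes 2F)
        primary-edge (there (there (there (here refl)))) = fwd uv
        primary-edge (there (there (there (there (here refl))))) = fwd uw
        primary-edge (there (there (there (there (there (here refl)))))) = fwd vw

  six : ∀ k → 2 ℕ.* (3 ℕ.* k) ≡ 3 ℕ.* (2 ℕ.* k)
  six k = trans (sym (ℕ.*-assoc 2 3 k)) (ℕ.*-assoc 3 2 k)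

  module _ (j : ℕ) where
    private
      k = suc j
      n = 3 ℕ.* k
      m = 2 ℕ.* n

      C : ℤ → Fin m
      C z = fromℕ< (ℤ.n%ℕd<d z m)

      toℕ-C : ∀ z → toℕ (C z) ≡ z %ℕ m
      toℕ-C z = F.toℕ-fromℕ< (ℤ.n%ℕd<d z m)

      C-cong : ∀ {y z} → y ≈ z [ m ] → C y ≡ C z
      C-cong {y} {z} p = F.toℕ-injective (trans (toℕ-C y) (trans (≈⇒%≡ p) (sym (toℕ-C z))))

      C-inj : ∀ {y z} → C y ≡ C z → y ≈ z [ m ]
      C-inj {y} {z} e = %≡⇒≈ (trans (sym (toℕ-C y)) (trans (cong toℕ e) (toℕ-C z)))

      C-toℕ : ∀ (x : Fin m) {i} → toℕ x ≡ i → i ℕ.< m → x ≡ C (+ i)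
      C-toℕ x {i} e i<m = F.toℕ-injective (trans e (sym (trans (toℕ-C (+ i)) (m<n⇒m%n≡m i<m))))

      C-mod : ∀ (x : Fin m) i → toℕ x ≡ i % m → x ≡ C (+ i)
      C-mod x i e = F.toℕ-injective (trans e (sym (toℕ-C (+ i))))

      to-triple : ∀ {y z} → y ≈ z [ m ] → y ≈ z [ 3 ℕ.* (2 ℕ.* k) ]
      to-triple {y} {z} = subst (λ m → y ≈ z [ m ]) (six k)

      from-triple : ∀ {y z} → y ≈ z [ 3 ℕ.* (2 ℕ.* k) ] → y ≈ z [ m ]
      from-triple {y} {z} = subst (λ m → y ≈ z [ m ]) (sym (six k))

      3k : + n ≡ + 3 * + k
      3k = ℤ.pos-* 3 k

      successor : ∀ z c → toℕ (C (z + + c)) ≡ (z %ℕ m ℕ.+ c) mod m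
      successor z c = trans (toℕ-C (z + + c)) (≈⇒%≡ {y = + (z %ℕ m ℕ.+ c)} (+-congʳ-≈ (+ c) (≈-sym (residue z))))

      C-surj : ∀ x → ∃ λ z → x ≡ C z
      C-surj x = + toℕ x , C-toℕ x refl (F.toℕ<n x)

      mobius-labelling : Labelling (λ a i → C (position a i)) (2 ℕ.* k)
      mobius-labelling = record
        { V-cong = λ a p → C-cong (from-triple (position-cong a (2 ℕ.* k) p))
        ; V-inj = λ {a} {b} {i} {i′} e → inj a b i i′ (C-inj e)
        ; V-surj = λ x → let z , e = C-surj x ; a , i , f = residue-mod-3 z in a , i , sym (trans e (cong C f)) }
        where
          inj : ∀ a b i i′ → position a i ≈ position b i′ [ m ] → a ≡ b × i ≈ i′ [ 2 ℕ.* k ]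
          inj a b i i′ p = same-position a b i i′ (2 ℕ.* k) (to-triple p)

      mobius-back : ∀ {x y : Fin m} → MobiusE n (toℕ x) (toℕ y) → ∃ λ z → x ≡ C z × (y ≡ C (z + 1ℤ) ⊎ y ≡ C (z + + 3 * + k))
      mobius-back {x} {y} (i , i<m , inj₁ (p , q)) = + i , C-toℕ x p i<m , inj₁ (C-mod y (i ℕ.+ 1) q)
      mobius-back {x} {y} (i , i<m , inj₂ (p , q)) = + i , C-toℕ x p i<m , inj₂ (trans (C-mod y (i ℕ.+ n) q) (cong (λ t → C (+ i + t)) 3k))

    -- For r = 1 there is one strand, closed after 6k steps, and the semi-edges join opposite
    -- places. The coordinate p is ignored.
    mobius-model : Model t3 (Mobius n) k 1ℤ 0ℤ
    mobius-model = Strands.model k 1ℤ (λ _ → C) (λ (_ , y) (_ , z) → y ≈ z [ m ]) C-cong (λ _ b → +-congʳ-≈ b)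
      (λ _ z → let a , i , e = residue-mod-3 z in a , i , ≈-reflexive e) (λ i → cong C (lem i)) mobius-labelling
      (λ { (inj₁ e) → inj₂ e ; (inj₂ e) → inj₁ e })
      (λ _ z → inj₁ (z %ℕ m , ℤ.n%ℕd<d z m , inj₁ (toℕ-C z , successor z 1)))
      (λ _ z → inj₁ (z %ℕ m , ℤ.n%ℕd<d z m , inj₂ (toℕ-C z , trans (cong (λ t → toℕ (C (z + t))) (sym 3k)) (successor z n))))
      (λ { (inj₁ e) → let z , p = mobius-back e in 0ℤ , z , inj₁ p ; (inj₂ e) → let z , p = mobius-back e in 0ℤ , z , inj₂ p })
      where lem : ∀ i → + 3 * i + 1ℤ + 1ℤ ≡ + 3 * (i + 1ℤ) + - 1ℤ
            lem = solve-∀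

  module _ (j : ℕ) (odd : + suc j ≈ 1ℤ [ 2 ]) where
    private
      k = suc j
      n = 3 ℕ.* k

      D : ℤ → ℤ → Fin (2 ℕ.* n)
      D p z = combine (fromℕ< (ℤ.n%ℕd<d p 2)) (fromℕ< (ℤ.n%ℕd<d z n))

      toℕ-D : ∀ p z → toℕ (D p z) ≡ n ℕ.* (p %ℕ 2) ℕ.+ z %ℕ n
      toℕ-D p z = trans (F.toℕ-combine (fromℕ< (ℤ.n%ℕd<d p 2)) (fromℕ< (ℤ.n%ℕd<d z n)))
        (cong₂ (λ a b → n ℕ.* a ℕ.+ b) (F.toℕ-fromℕ< (ℤ.n%ℕd<d p 2)) (F.toℕ-fromℕ< (ℤ.n%ℕd<d z n)))

      _∼_ : ℤ × ℤ → ℤ × ℤ → Set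
      (p , z) ∼ (p′ , z′) = p ≈ p′ [ 2 ] × z ≈ z′ [ n ]

      D-cong : ∀ {p z p′ z′} → (p , z) ∼ (p′ , z′) → D p z ≡ D p′ z′
      D-cong {p} {z} {p′} {z′} (e , f) = F.toℕ-injective (trans (toℕ-D p z)
        (trans (cong₂ (λ a b → n ℕ.* a ℕ.+ b) (≈⇒%≡ e) (≈⇒%≡ f)) (sym (toℕ-D p′ z′))))

      D-inj : ∀ {p z p′ z′} → D p z ≡ D p′ z′ → (p , z) ∼ (p′ , z′)
      D-inj {p} {z} {p′} {z′} e with F.combine-injective (fromℕ< (ℤ.n%ℕd<d p 2)) (fromℕ< (ℤ.n%ℕd<d z n)) (fromℕ< (ℤ.n%ℕd<d p′ 2)) (fromℕ< (ℤ.n%ℕd<d z′ n)) e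
      ... | a , b = %≡⇒≈ (F.fromℕ<-injective _ _ (ℤ.n%ℕd<d p 2) (ℤ.n%ℕd<d p′ 2) a)
                  , %≡⇒≈ (F.fromℕ<-injective _ _ (ℤ.n%ℕd<d z n) (ℤ.n%ℕd<d z′ n) b)

      D-surj : ∀ x → ∃ λ p → ∃ λ z → x ≡ D p z
      D-surj x with F.combine-surjective {2} {n} x
      ... | a , b , e = + toℕ a , + toℕ b , F.toℕ-injective (trans (cong toℕ (sym e)) (trans (F.toℕ-combine a b)
            (trans (cong₂ (λ a b → n ℕ.* a ℕ.+ b) (sym (m<n⇒m%n≡m (F.toℕ<n a))) (sym (m<n⇒m%n≡m (F.toℕ<n b)))) (sym (toℕ-D (+ toℕ a) (+ toℕ b))))))

      layer₀ : ∀ z → toℕ (D 0ℤ z) ≡ z %ℕ n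
      layer₀ z = trans (toℕ-D 0ℤ z) (cong (ℕ._+ z %ℕ n) (ℕ.*-zeroʳ n))

      layer₁ : ∀ z → toℕ (D 1ℤ z) ≡ n ℕ.+ z %ℕ n
      layer₁ z = trans (toℕ-D 1ℤ z) (cong (ℕ._+ z %ℕ n) (ℕ.*-identityʳ n))

      successor : ∀ z → (z + 1ℤ) %ℕ n ≡ (z %ℕ n ℕ.+ 1) mod n
      successor z = ≈⇒%≡ {y = + (z %ℕ n ℕ.+ 1)} (+-congʳ-≈ 1ℤ (≈-sym (residue z)))

      3k : + n ≡ + 3 * + k
      3k = ℤ.pos-* 3 k

      3k≈0 : ∀ z → z + + 3 * + k ≈ z [ n ]
      3k≈0 z = ≈-trans (+-congˡ-≈ z (by 1ℤ (trans (sym 3k) (lem (+ n))))) (≈-reflexive (ℤ.+-identityʳ z))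
        where lem : ∀ n → n ≡ 0ℤ + 1ℤ * n
              lem = solve-∀

      -- The index must have the parity of p and a prescribed residue modulo k; as k is odd, i or i
      -- + k will do.
      locate : ∀ p z → ∃ λ a → ∃ λ i → (p , z) ∼ (i , position a i)
      locate p z with residue-mod-3 z
      ... | a , i , refl = a , choose (even⊎odd (i - p))
        where
          lem : ∀ i p → p ≡ i + - (i - p)
          lem = solve-∀
          lem′ : ∀ i o k → + 3 * (i + k) + o ≡ + 3 * i + o + + 3 * k
          lem′ = solve-∀
          choose : i - p ≈ 0ℤ [ 2 ] ⊎ i - p ≈ 1ℤ [ 2 ] → ∃ λ i′ → (p , position a i) ∼ (i′ , position a i′)
          choose (inj₁ e) = i , ≈-trans (≈-reflexive (lem i p)) (≈-trans (+-congˡ-≈ i (neg-cong-≈ e)) (≈-reflexive (ℤ.+-identityʳ i))) , ≈-refl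
          choose (inj₂ e) = i + + k
            , ≈-trans (≈-reflexive (lem i p)) (+-congˡ-≈ i (≈-trans (neg-cong-≈ e) (≈-trans (by (- 1ℤ) refl) (≈-sym odd))))
            , ≈-sym (≈-trans (≈-reflexive (lem′ i (offset a) (+ k))) (3k≈0 (position a i)))

      prism-labelling : Labelling (λ a i → D i (position a i)) (2 ℕ.* k)
      prism-labelling = record
        { V-cong = λ a p → D-cong (≈-half {k} p , position-cong a k (≈-coarsen 2 p))
        ; V-inj = λ {a} {b} {i} {i′} e → inj a b i i′ (D-inj e)
        ; V-surj = λ x → let p , z , e = D-surj x ; a , i , c = locate p z in a , i , sym (trans e (D-cong c)) }
        where
          inj : ∀ a b i i′ → (i , position a i) ∼ (i′ , position b i′) → a ≡ b × i ≈ i′ [ 2 ℕ.* k ]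
          inj a b i i′ (e , f) = let a≡b , g = same-position a b i i′ k f in a≡b , crt odd g e

      edge₀ : ∀ z → PrismE n (toℕ (D 0ℤ z)) (toℕ (D 0ℤ (z + 1ℤ)))
      edge₀ z = z %ℕ n , ℤ.n%ℕd<d z n , inj₁ (layer₀ z , trans (layer₀ (z + 1ℤ)) (successor z))

      edge₁ : ∀ z → PrismE n (toℕ (D 1ℤ z)) (toℕ (D 1ℤ (z + 1ℤ)))
      edge₁ z = z %ℕ n , ℤ.n%ℕd<d z n , inj₂ (inj₁ (layer₁ z , trans (layer₁ (z + 1ℤ)) (cong (n ℕ.+_) (successor z))))

      edge₀₁ : ∀ z → PrismE n (toℕ (D 0ℤ z)) (toℕ (D 1ℤ z))
      edge₀₁ z = z %ℕ n , ℤ.n%ℕd<d z n , inj₂ (inj₂ (layer₀ z , layer₁ z))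

      layer : ∀ {p q} z → q ≈ p [ 2 ] → D p z ≡ D q z
      layer {p} {q} z e = D-cong {p} {z} {q} {z} (≈-sym e , ≈-refl)

      rim : ∀ p z → Prism n (D p z) (D p (z + 1ℤ))
      rim p z with even⊎odd p
      ... | inj₁ e = subst₂ (Prism n) (layer z e) (layer (z + 1ℤ) e) (inj₁ (edge₀ z))
      ... | inj₂ e = subst₂ (Prism n) (layer z e) (layer (z + 1ℤ) e) (inj₁ (edge₁ z))

      spoke : ∀ p z → Prism n (D p z) (D (p + + k) (z + + 3 * + k))
      spoke p z = subst (Prism n (D p z)) (D-cong {p + + k} {z} {p + + k} {z + + 3 * + k} (≈-refl , ≈-sym (3k≈0 z))) (cross (even⊎odd p))
        where
          cross : p ≈ 0ℤ [ 2 ] ⊎ p ≈ 1ℤ [ 2 ] → Prism n (D p z) (D (p + + k) z)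
          cross (inj₁ e) = subst₂ (Prism n) (layer z e) (layer z (+-cong-≈ e odd)) (inj₁ (edge₀₁ z))
          cross (inj₂ e) = subst₂ (Prism n) (layer z e) (layer {0ℤ} z (≈-trans (+-cong-≈ e odd) (by 1ℤ refl))) (inj₂ (edge₀₁ z))

      at₀ : ∀ (x : Fin (2 ℕ.* n)) i → toℕ x ≡ i % n → x ≡ D 0ℤ (+ i)
      at₀ x i e = F.toℕ-injective (trans e (sym (layer₀ (+ i))))

      at₁ : ∀ (x : Fin (2 ℕ.* n)) i → toℕ x ≡ n ℕ.+ i % n → x ≡ D 1ℤ (+ i)
      at₁ x i e = F.toℕ-injective (trans e (sym (layer₁ (+ i))))

      prism-back : ∀ {x y : Fin (2 ℕ.* n)} → PrismE n (toℕ x) (toℕ y) →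
                   ∃ λ p → ∃ λ z → x ≡ D p z × (y ≡ D p (z + 1ℤ) ⊎ y ≡ D (p + + k) (z + + 3 * + k))
      prism-back {x} {y} (i , i<n , inj₁ (p , q)) = 0ℤ , + i , at₀ x i (trans p (sym (m<n⇒m%n≡m i<n))) , inj₁ (at₀ y (i ℕ.+ 1) q)
      prism-back {x} {y} (i , i<n , inj₂ (inj₁ (p , q))) =
        1ℤ , + i , at₁ x i (trans p (cong (n ℕ.+_) (sym (m<n⇒m%n≡m i<n)))) , inj₁ (at₁ y (i ℕ.+ 1) q)
      prism-back {x} {y} (i , i<n , inj₂ (inj₂ (p , q))) = 0ℤ , + i , at₀ x i (trans p (sym (m<n⇒m%n≡m i<n))) ,
        inj₂ (trans (at₁ y i (trans q (cong (n ℕ.+_) (sym (m<n⇒m%n≡m i<n))))) (D-cong (≈-sym (≈-trans (≈-reflexive (ℤ.+-identityˡ (+ k))) odd) , ≈-sym (3k≈0 (+ i)))))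

    -- As k is odd, 1 + k is even and congruent to 1 modulo k. A strand then keeps the parity of its
    -- indices and closes after 3k steps, while the semi-edges change the parity and join the two
    -- strands.
    prism-model : Model t3 (Prism n) k (1ℤ + + k) 0ℤ
    prism-model = Strands.model k (1ℤ + + k) D _∼_ D-cong (λ a b (e , f) → +-congʳ-≈ a e , +-congʳ-≈ b f) locate turn prism-labelling
      (λ { (inj₁ e) → inj₂ e ; (inj₂ e) → inj₁ e }) rim spoke
      (λ { (inj₁ e) → let p , z , h = prism-back e in p , z , inj₁ h ; (inj₂ e) → let p , z , h = prism-back e in p , z , inj₂ h })
      where
        turn : ∀ i → D i (position 1F i + 1ℤ) ≡ D (i + (1ℤ + + k)) (position 2F (i + (1ℤ + + k)))
        turn i = D-cong
          ( ≈-sym (≈-trans (+-congˡ-≈ i (+-congˡ-≈ 1ℤ odd)) (≈-trans (+-congˡ-≈ {x′ = 0ℤ} i (by 1ℤ refl)) (≈-reflexive (ℤ.+-identityʳ i))))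
          , ≈-sym (≈-trans (≈-reflexive (lem i (+ k))) (3k≈0 (position 1F i + 1ℤ))))
          where lem : ∀ i k → + 3 * (i + (1ℤ + k)) + - 1ℤ ≡ + 3 * i + 1ℤ + 1ℤ + + 3 * k
                lem = solve-∀

  -- Identification with the named graphs

  module Identify {n} {G : Graph n} (cubic : Cubic G) (j : ℕ) where
    private
      k = suc j
      m = 2 ℕ.* k

      *0 : ∀ c → c * 0ℤ ≈ 0ℤ [ m ]
      *0 c = ≈-reflexive (ℤ.*-zeroʳ c)

    identify₁ : Result₁ G k → (Odd k × G ≅ X k) ⊎ (k ≡ 2 × InCensusList G)
    identify₁ (inj₂ (refl , s , M)) = inj₂ (refl , there (there (there (here (model-≅ M census-12-model c s cs (*0 c) cs)))))
      where
        s-odd : s ≈ 0ℤ [ 2 ] ⊎ s ≈ 1ℤ [ 2 ] → s ≈ 1ℤ [ 2 ]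
        s-odd (inj₂ p) = p
        s-odd (inj₁ p) = contradiction (Regular.coprime M cubic 2 ≈-refl p (by 1ℤ refl)) λ ()
        unit-s : ∃ λ c → c * s ≈ 1ℤ [ 4 ]
        unit-s = lift-unit 2 1ℤ s (s-odd (even⊎odd s)) (≈-trans (≈-reflexive (ℤ.*-identityˡ s)) (s-odd (even⊎odd s)))
        c = proj₁ unit-s
        cs = proj₂ unit-s
    identify₁ (inj₁ (r , s , M , r-even , rel , k-odd)) =
      inj₁ (≈1⇒Odd k k-odd , model-≅ M (T1-model j (rstar k) 1) c s cs (cr c cs) cs)
      where
        s-odd : s ≈ 0ℤ [ 2 ] ⊎ s ≈ 1ℤ [ 2 ] → s ≈ 1ℤ [ 2 ]
        s-odd (inj₂ p) = p
        s-odd (inj₁ p) = ⊥-elim (1≉0 (≈-trans (≈-sym (+-cong-≈ {x′ = 0ℤ} (*-congˡ-≈ {y = 0ℤ} (+ 3) p) k-odd))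
          (≈-trans (≈-sym (≈-half {k} rel)) (*-congˡ-≈ {y = 0ℤ} (+ 2) r-even))))
        -- With k = 1 + 2 q we have r = r k - q (2 r), and g divides 2 r because of the relation 2 r
        -- = 3 s + k.
        r≈0 : ∀ g → s ≈ 0ℤ [ g ] → + k ≈ 0ℤ [ g ] → + k ≈ 1ℤ [ 2 ] → r ≈ 0ℤ [ g ]
        r≈0 g s0 k0 (by q e) = ≈-trans (≈-reflexive (lem r q)) (≈-trans (+-cong-≈ {x′ = r * 0ℤ} {y′ = - q * 0ℤ}
            (*-congˡ-≈ r (≈-trans (≈-reflexive (sym e)) k0))
            (*-congˡ-≈ (- q) (≈-trans (≈-down {k} rel k0) (+-cong-≈ {x′ = 0ℤ} {y′ = 0ℤ} (*-congˡ-≈ {y = 0ℤ} (+ 3) s0) k0))))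
            (≈-reflexive (lem′ r q)))
          where lem : ∀ r q → r ≡ r * (1ℤ + q * + 2) + - q * (+ 2 * r)
                lem = solve-∀
                lem′ : ∀ r q → r * 0ℤ + - q * 0ℤ ≡ 0ℤ
                lem′ = solve-∀
        unit-k : ∃ λ c → c * s ≈ 1ℤ [ k ]
        unit-k = unit s k (λ g s0 k0 → Regular.coprime M cubic g (r≈0 g s0 k0 k-odd) s0 k0)
        unit-m : ∃ λ c → c * s ≈ 1ℤ [ m ]
        unit-m = lift-unit k (proj₁ unit-k) s (s-odd (even⊎odd s)) (proj₂ unit-k)
        c = proj₁ unit-m
        cs = proj₂ unit-m
        -- Modulo k, halve 2 c r = 3 + k = 2 r*; modulo 2 both sides vanish.
        cr : ∀ c → c * s ≈ 1ℤ [ m ] → c * r ≈ + rstar k [ m ]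
        cr c cs = crt k-odd (halve-≈ {k} (≈-trans (≈-reflexive (lem c r)) (≈-trans (*-congˡ-≈ c rel) (≈-trans (≈-reflexive (lem′ c s (+ k)))
                    (≈-trans (+-cong-≈ {x′ = + 3 * 1ℤ} {y′ = + k} (*-congˡ-≈ (+ 3) cs) (unit-fixes-k {k} {c} {s} cs)) (≈-sym (proj₁ (rstar-spec k k-odd))))))))
                    (≈-trans (*-congˡ-≈ {y = 0ℤ} c r-even) (≈-trans (≈-reflexive (ℤ.*-zeroʳ c)) (≈-sym (proj₂ (rstar-spec k k-odd)))))
          where lem : ∀ c r → + 2 * (c * r) ≡ c * (+ 2 * r)
                lem = solve-∀
                lem′ : ∀ c s k → c * (+ 3 * s + k) ≡ + 3 * (c * s) + c * k
                lem′ = solve-∀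

    identify₂ : Result₂ G k → Odd k × G ≅ Y k
    identify₂ (r , s , M , rel , s-odd , k-odd) = ≈1⇒Odd k k-odd , model-≅ M (T2-model j 2 1) c s cs cr cs
      where
        unit-k : ∃ λ c → c * s ≈ 1ℤ [ k ]
        unit-k = unit s k (λ g s0 k0 → Regular.coprime M cubic g (≈-trans (≈-down {k} rel k0) (*-congˡ-≈ {y = 0ℤ} (+ 2) s0)) s0 k0)
        unit-m : ∃ λ c → c * s ≈ 1ℤ [ m ]
        unit-m = lift-unit k (proj₁ unit-k) s s-odd (proj₂ unit-k)
        c = proj₁ unit-m
        cs = proj₂ unit-m
        cr : c * r ≈ + 2 [ m ]
        cr = ≈-trans (*-congˡ-≈ c rel) (≈-trans (≈-reflexive (lem c s)) (*-congˡ-≈ {y = 1ℤ} (+ 2) cs))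
          where lem : ∀ c s → c * (+ 2 * s) ≡ + 2 * (c * s)
                lem = solve-∀

    identify₄ : Result₄ G k → k ≡ 5 × InCensusList G
    identify₄ (refl , r , s , M , c , cr , cs) = refl ,
      -- Since c r = 1, the number r itself serves as the inverse of c.
      there (there (there (there (there (there (there (there (there (here (model-≅ M census-30-model c r cr cr cs))))))))))

    -- An odd r has an inverse modulo 2k, which turns it into 1. For even r there is an inverse
    -- modulo k only; chosen odd, it is a unit modulo 2k and turns r into the even number 1 + k.
    identify₃ : ∀ {r} → Model t3 G k r 0ℤ → (IsPrism G × Odd k) ⊎ IsMobiusLadder G
    identify₃ {r} M = decide (even⊎odd r)
      where
        unit-k : ∃ λ c → c * r ≈ 1ℤ [ k ]
        unit-k = unit r k (λ g r0 k0 → Regular.coprime M cubic g r0 ≈-refl k0)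

        3≤3k : 3 ℕ.≤ 3 ℕ.* k
        3≤3k = ℕ.m≤m*n 3 k

        prism : r ≈ 0ℤ [ 2 ] → + k ≈ 1ℤ [ 2 ] → ∀ c → c ≈ 1ℤ [ 2 ] → c * r ≈ 1ℤ [ k ] → IsPrism G
        prism r-even k-odd c c-odd cr = 3 ℕ.* k , 3≤3k ,
            model-≅ M (prism-model j k-odd) c (proj₁ unit-c) (≈-trans (≈-reflexive (ℤ.*-comm c (proj₁ unit-c))) (proj₂ unit-c)) cr′ (*0 c)
          where
            unit-c : ∃ λ c′ → c′ * c ≈ 1ℤ [ m ]
            unit-c = lift-unit k r c c-odd (≈-trans (≈-reflexive (ℤ.*-comm r c)) cr)
            cr′ : c * r ≈ 1ℤ + + k [ m ]
            cr′ = crt k-odd (≈-trans cr (by (- 1ℤ) (lem (+ k))))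
                            (≈-trans (*-congˡ-≈ {y = 0ℤ} c r-even) (≈-trans (≈-reflexive (ℤ.*-zeroʳ c))
                              (≈-trans (≈-sym (by {y = 0ℤ} 1ℤ refl)) (+-congˡ-≈ 1ℤ (≈-sym k-odd)))))
              where lem : ∀ k → 1ℤ ≡ 1ℤ + k + - 1ℤ * k
                    lem = solve-∀

        odd-unit : + k ≈ 1ℤ [ 2 ] → ∀ c → c * r ≈ 1ℤ [ k ] → c ≈ 0ℤ [ 2 ] ⊎ c ≈ 1ℤ [ 2 ] → ∃ λ c′ → c′ ≈ 1ℤ [ 2 ] × c′ * r ≈ 1ℤ [ k ]
        odd-unit k-odd c cr (inj₂ odd)  = c , odd , cr
        odd-unit k-odd c cr (inj₁ even) = c + + k , +-cong-≈ even k-odd , ≈-trans (by r (lem c (+ k) r)) cr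
          where lem : ∀ c k r → (c + k) * r ≡ c * r + r * k
                lem = solve-∀

        decide : r ≈ 0ℤ [ 2 ] ⊎ r ≈ 1ℤ [ 2 ] → (IsPrism G × Odd k) ⊎ IsMobiusLadder G
        decide (inj₂ r-odd) = let c , cr = lift-unit k (proj₁ unit-k) r r-odd (proj₂ unit-k) in
          inj₂ (3 ℕ.* k , ℕ.≤-trans (ℕ.n≤1+n 2) 3≤3k , model-≅ M (mobius-model j) c r cr cr (*0 c))
        decide (inj₁ r-even) = [ (λ k-even → contradiction (Regular.coprime M cubic 2 r-even ≈-refl k-even) λ ())
                               , (λ k-odd → let c , c-odd , cr = odd-unit k-odd (proj₁ unit-k) (proj₂ unit-k) (even⊎odd (proj₁ unit-k)) in
                                   inj₁ (prism r-even k-odd c c-odd cr , ≈1⇒Odd k k-odd)) ]′ (even⊎odd (+ k))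

  -- From orbits to covers

  labelling-size : ∀ {n m} .{{_ : NonZero m}} {V : Fin 3 → ℤ → Fin n} → Labelling V m → n ≡ 3 ℕ.* m
  labelling-size {n} {m} {V} lab = ℕ.≤-antisym (F.injective⇒≤ {f = enc} enc-inj) (F.injective⇒≤ {f = dec} dec-inj)
    where
      open Labelling lab
      enc : Fin n → Fin (3 ℕ.* m)
      enc x = let a , i , _ = V-surj x in combine a (fromℕ< (ℤ.n%ℕd<d i m))
      enc-inj : ∀ {x y} → enc x ≡ enc y → x ≡ y
      enc-inj {x} {y} e with V-surj x | V-surj y
      ... | a , i , refl | b , j , refl with F.combine-injective a (fromℕ< (ℤ.n%ℕd<d i m)) b (fromℕ< (ℤ.n%ℕd<d j m)) e
      ... | refl , q = V-cong a (%≡⇒≈ (F.fromℕ<-injective _ _ (ℤ.n%ℕd<d i m) (ℤ.n%ℕd<d j m) q))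
      dec : Fin (3 ℕ.* m) → Fin n
      dec x = let a , i = remQuot {3} m x in V a (+ toℕ i)
      dec-inj : ∀ {x y} → dec x ≡ dec y → x ≡ y
      dec-inj {x} {y} e with V-inj e
      ... | p , q = trans (sym (F.combine-remQuot {3} m x)) (trans
        (cong₂ combine p (F.toℕ-injective (residues-≡ (F.toℕ<n _) (F.toℕ<n _) q))) (F.combine-remQuot {3} m y))

  -- A regular ℤₘ-cover of a pregraph on three vertices, before the pregraph and its voltages are
  -- known.
  record Cover {n} (G : Graph n) (m : ℕ) : Set where
    field
      V         : Fin 3 → ℤ → Fin n
      labelling : Labelling V m
      translate : ∀ {a b i j} c → G (V a i) (V b j) → G (V a (i + c)) (V b (j + c))
    open Labelling labelling public

  -- Renames the orbits by `π` and moves the base vertex of each orbit by `g`; on voltages this is a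
  -- change of gauge.
  regauge : ∀ {n} {G : Graph n} {m} → Cover G m → (π π⁻ : Fin 3 → Fin 3) → (∀ a → π⁻ (π a) ≡ a) → (∀ a → π (π⁻ a) ≡ a) →
            (Fin 3 → ℤ) → Cover G m
  regauge {G = G} C π π⁻ π⁻π ππ⁻ g = record
    { V = λ a i → V (π a) (i + g a)
    ; labelling = record
      { V-cong = λ a p → V-cong (π a) (+-congʳ-≈ (g a) p)
      ; V-inj = λ {a} {b} {i} {j} e → inj a b i j (V-inj e)
      ; V-surj = λ x → let a , i , e = V-surj x in
          π⁻ a , i - g (π⁻ a) , trans (cong₂ V (ππ⁻ a) (lem i (g (π⁻ a)))) e }
    ; translate = λ {a} {b} {i} {j} c e → subst₂ (λ x y → G (V (π a) x) (V (π b) y)) (lem′ i (g a) c) (lem′ j (g b) c) (translate c e) }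
    where
      open Cover C
      lem : ∀ i g → i - g + g ≡ i
      lem = solve-∀
      lem′ : ∀ i g c → i + g + c ≡ i + c + g
      lem′ = solve-∀
      inj : ∀ a b i j → π a ≡ π b × i + g a ≈ j + g b [ _ ] → a ≡ b × i ≈ j [ _ ]
      inj a b i j (p , q) with trans (sym (π⁻π a)) (trans (cong π⁻ p) (π⁻π b))
      ... | refl = refl , +-cancelˡ-≈ (g a) (≈-trans (≈-reflexive (ℤ.+-comm (g a) i)) (≈-trans q (≈-reflexive (ℤ.+-comm j (g a)))))

  pow-+ : ∀ {A : Set} (f : A → A) i j x → pow f (i ℕ.+ j) x ≡ pow f i (pow f j x)
  pow-+ f zero j x = refl
  pow-+ f (suc i) j x = cong f (pow-+ f i j x)

  pow-periodic : ∀ {A : Set} (f : A → A) {d x} → pow f d x ≡ x → ∀ q → pow f (q ℕ.* d) x ≡ x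
  pow-periodic f e zero = refl
  pow-periodic f {d} {x} e (suc q) = trans (pow-+ f d (q ℕ.* d) x) (trans (cong (pow f d) (pow-periodic f e q)) e)

  pow-% : ∀ {A : Set} (f : A → A) {d x} .{{_ : NonZero d}} → pow f d x ≡ x → ∀ i → pow f i x ≡ pow f (i % d) x
  pow-% f {d} {x} e i = trans (cong (λ i → pow f i x) (m≡m%n+[m/n]*n i d))
    (trans (pow-+ f (i % d) (i / d ℕ.* d) x) (cong (pow f (i % d)) (pow-periodic f e (i / d))))

  pow-cancel : ∀ {A : Set} (f : A → A) → (∀ {x y} → f x ≡ f y → x ≡ y) → ∀ i {x y} → pow f i x ≡ pow f i y → x ≡ y
  pow-cancel f inj zero e = e
  pow-cancel f inj (suc i) e = pow-cancel f inj i (inj e)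

  module _ {n} (f : Fin n → Fin n) (f-inj : ∀ {x y} → f x ≡ f y → x ≡ y) {x m} (size : OrbitSize f x m) where
    private
      e = proj₁ size
      e-inj = proj₁ (proj₂ size)
      e-orbit = proj₁ (proj₂ (proj₂ size))
      e-onto = proj₂ (proj₂ (proj₂ size))

    -- The powers repeat modulo d, so the orbit has at most d elements.
    period-bound : ∀ d .{{_ : NonZero d}} → pow f d x ≡ x → m ℕ.≤ d
    period-bound d p = F.injective⇒≤ {f = λ i → fromℕ< (m%n<n (proj₁ (e-orbit i)) d)} λ {i} {j} eq →
      e-inj i j (trans (sym (proj₂ (e-orbit i))) (trans (pow-% f p (proj₁ (e-orbit i)))
        (trans (cong (λ i → pow f i x) (F.fromℕ<-injective _ _ (m%n<n (proj₁ (e-orbit i)) d) (m%n<n (proj₁ (e-orbit j)) d) eq))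
          (trans (sym (pow-% f p (proj₁ (e-orbit j)))) (proj₂ (e-orbit j))))))

    return : ∀ i d → pow f i x ≡ pow f (i ℕ.+ d) x → pow f d x ≡ x
    return i d eq = sym (pow-cancel f f-inj i (trans eq (pow-+ f i d x)))

    pow-distinct : ∀ i j → i ℕ.< j → j ℕ.< m → pow f i x ≢ pow f j x
    pow-distinct i j i<j j<m eq = contradiction (period-bound (j ℕ.∸ i) {{ℕ.>-nonZero (ℕ.m<n⇒0<n∸m i<j)}}
        (return i (j ℕ.∸ i) (trans eq (cong (λ j → pow f j x) (sym (ℕ.m+[n∸m]≡n (ℕ.<⇒≤ i<j)))))))
      (ℕ.<⇒≱ (ℕ.≤-<-trans (ℕ.m∸n≤m j i) j<m))

    pow-injective : ∀ i j → i ℕ.< m → j ℕ.< m → pow f i x ≡ pow f j x → i ≡ j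
    pow-injective i j i<m j<m eq with ℕ.<-cmp i j
    ... | tri< i<j _ _ = contradiction eq (pow-distinct i j i<j j<m)
    ... | tri≈ _ i≡j _ = i≡j
    ... | tri> _ _ j<i = contradiction (sym eq) (pow-distinct j i j<i i<m)

    -- Two of the powers with exponents 0 to m agree, which gives a period d ≤ m, and `period-bound`
    -- gives m ≤ d.
    period : pow f m x ≡ x
    period with F.pigeonhole (ℕ.n<1+n m) (λ i → proj₁ (e-onto (pow f (toℕ i) x) (toℕ i , refl)))
    ... | i , j , i<j , eq = subst (λ d → pow f d x ≡ x) (ℕ.≤-antisym d≤m m≤d) back
      where
        d = toℕ j ℕ.∸ toℕ i
        same : pow f (toℕ i) x ≡ pow f (toℕ j) x
        same = trans (sym (proj₂ (e-onto (pow f (toℕ i) x) (toℕ i , refl)))) (trans (cong e eq) (proj₂ (e-onto (pow f (toℕ j) x) (toℕ j , refl))))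
        back : pow f d x ≡ x
        back = return (toℕ i) d (trans same (cong (λ j → pow f j x) (sym (ℕ.m+[n∸m]≡n (ℕ.<⇒≤ i<j)))))
        m≤d : m ℕ.≤ d
        m≤d = period-bound d {{ℕ.>-nonZero (ℕ.m<n⇒0<n∸m i<j)}} back
        d≤m : d ℕ.≤ m
        d≤m = ℕ.≤-trans (ℕ.m∸n≤m (toℕ j) (toℕ i)) (ℕ.≤-pred (F.toℕ<n j))

  cover : ∀ {n} {G : Graph n} (σ : Aut G) (orbits : ThreeEqualOrbits (_≅_.to σ)) → Cover G (proj₁ (proj₂ orbits))
  cover {n} {G} σ (base , m , 1<m , onto , apart , sizes) = record
    { V = V
    ; labelling = record { V-cong = λ a p → cong (λ i → pow f i (base a)) (≈⇒%≡ p) ; V-inj = λ {a} {b} {i} {j} → V-inj a b i j ; V-surj = V-surj }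
    ; translate = λ {a} {b} {i} {j} c g → subst₂ (λ x y → G x y) (V-cong a (+-congˡ-≈ i (residue c))) (V-cong b (+-congˡ-≈ j (residue c))) (translateℕ a b i j (c %ℕ m) g) }
    where
      instance
        m≢0 : NonZero m
        m≢0 = ℕ.>-nonZero (ℕ.<-trans ℕ.z<s 1<m)
      f = _≅_.to σ
      f-inj : ∀ {x y} → f x ≡ f y → x ≡ y
      f-inj {x} {y} e = trans (sym (_≅_.from-to σ x)) (trans (cong (_≅_.from σ) e) (_≅_.from-to σ y))

      V : Fin 3 → ℤ → Fin n
      V a i = pow f (i %ℕ m) (base a)

      V-cong : ∀ a {i j} → i ≈ j [ m ] → V a i ≡ V a j
      V-cong a p = cong (λ i → pow f i (base a)) (≈⇒%≡ p)

      powℕ : ∀ a i → pow f i (base a) ≡ V a (+ i)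
      powℕ a i = pow-% f (period f f-inj (sizes a)) i

      V-surj : ∀ x → ∃ λ a → ∃ λ i → V a i ≡ x
      V-surj x = let a , i , e = onto x in a , + i , trans (sym (powℕ a i)) e

      -- Apply the power m - i to both sides; the left side returns to its base vertex.
      same-orbit : ∀ a b i j → pow f i (base a) ≡ pow f j (base b) → i ℕ.≤ m → SameOrbit f (base b) (base a)
      same-orbit a b i j e i≤m = (m ℕ.∸ i) ℕ.+ j , trans (pow-+ f (m ℕ.∸ i) j (base b)) (trans (cong (pow f (m ℕ.∸ i)) (sym e))
        (trans (sym (pow-+ f (m ℕ.∸ i) i (base a))) (trans (cong (λ i → pow f i (base a)) (ℕ.m∸n+n≡m i≤m)) (period f f-inj (sizes a)))))

      V-inj : ∀ a b i j → V a i ≡ V b j → a ≡ b × i ≈ j [ m ]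
      V-inj a b i j e with apart b a (same-orbit a b (i %ℕ m) (j %ℕ m) e (ℕ.<⇒≤ (ℤ.n%ℕd<d i m)))
      ... | refl = refl , %≡⇒≈ (pow-injective f f-inj (sizes a) (i %ℕ m) (j %ℕ m) (ℤ.n%ℕd<d i m) (ℤ.n%ℕd<d j m) e)

      f-V : ∀ a i → f (V a i) ≡ V a (i + 1ℤ)
      f-V a i = trans (powℕ a (suc (i %ℕ m))) (V-cong a (≈-trans (+-congˡ-≈ 1ℤ (residue i)) (≈-reflexive (ℤ.+-comm 1ℤ i))))

      translateℕ : ∀ a b i j c → G (V a i) (V b j) → G (V a (i + + c)) (V b (j + + c))
      translateℕ a b i j zero g = subst₂ (λ x y → G (V a x) (V b y)) (sym (ℤ.+-identityʳ i)) (sym (ℤ.+-identityʳ j)) g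
      translateℕ a b i j (suc c) g = subst₂ G (trans (f-V a (i + + c)) (cong (V a) (lem i (+ c)))) (trans (f-V b (j + + c)) (cong (V b) (lem j (+ c))))
        (_≅_.pres σ _ _ (translateℕ a b i j c g))
        where lem : ∀ i c → i + c + 1ℤ ≡ i + (1ℤ + c)
              lem = solve-∀

  -- The four pregraphs

  -- The residue y of x satisfies m ∣ 2 y and 0 < 2 y < 2 m, so 2 y = m. Through this a semi-edge
  -- makes m even.
  involution⇒half : ∀ {m x} .{{_ : NonZero m}} → ¬ (x ≈ 0ℤ [ m ]) → - x ≈ x [ m ] → ∃ λ k → m ≡ 2 ℕ.* k × x ≈ + k [ m ]
  involution⇒half {m} {x} x≉0 p = y , ≤∧∣⇒≡ , ≈-sym (residue x)
    where
      y = x %ℕ m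
      lem : ∀ y → + 2 * y ≡ y - - y
      lem = solve-∀
      2y≈0 : + (2 ℕ.* y) ≈ 0ℤ [ m ]
      2y≈0 = ≈-trans (≈-reflexive (trans (ℤ.pos-* 2 y) (lem (+ y))))
               (≈-trans (+-cong-≈ (residue x) (neg-cong-≈ (neg-cong-≈ (residue x)))) (≈-trans (+-congˡ-≈ x (neg-cong-≈ p)) (≈-reflexive (ℤ.+-inverseʳ x))))
      y≢0 : y ≢ 0
      y≢0 e = x≉0 (≈-trans (≈-sym (residue x)) (≈-reflexive (cong +_ e)))
      m∣2y : m ℕ.∣ 2 ℕ.* y
      m∣2y = ≈0⇒∣ 2y≈0
      ≤∧∣⇒≡ : m ≡ 2 ℕ.* y
      ≤∧∣⇒≡ = multiple (ℕ.quotient m∣2y) (ℕ._∣_.equality m∣2y)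
        where
          multiple : ∀ q → 2 ℕ.* y ≡ q ℕ.* m → m ≡ 2 ℕ.* y
          multiple zero e = contradiction (ℕ.m+n≡0⇒m≡0 y e) y≢0
          multiple (suc zero) e = sym (trans e (ℕ.*-identityˡ m))
          multiple (suc (suc q)) e = contradiction (ℕ.<-≤-trans (ℕ.*-monoʳ-< 2 (ℤ.n%ℕd<d x m)) (ℕ.≤-trans (ℕ.*-monoˡ-≤ m (ℕ.s≤s (ℕ.s≤s (ℕ.z≤n {q})))) (ℕ.≤-reflexive (sym e)))) (ℕ.<-irrefl refl)

  halves-agree : ∀ {m x y} → (∃ λ k → m ≡ 2 ℕ.* k × x ≈ + k [ m ]) → (∃ λ k → m ≡ 2 ℕ.* k × y ≈ + k [ m ]) → x ≈ y [ m ]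
  halves-agree (k , refl , p) (k′ , e , q) with ℕ.*-cancelˡ-≡ k k′ 2 e
  ... | refl = ≈-trans p (≈-sym q)

  Modelled : ∀ {n} → Graph n → ℕ → Set
  Modelled G k = (∃ λ r → ∃ λ s → Model t1 G k r s) ⊎ (∃ λ r → ∃ λ s → Model t2 G k r s)
               ⊎ (∃ λ r → Model t3 G k r 0ℤ) ⊎ (∃ λ r → ∃ λ s → Model t4 G k r s)

  HasModel : ∀ {n} → Graph n → ℕ → Set
  HasModel G m = ∃ λ k → m ≡ 2 ℕ.* k × Modelled G k

  module CubicGraph {n} {G : Graph n} (cubic : Cubic G) where
    G-sym : ∀ {x y} → G x y → G y x
    G-sym {x} {y} = proj₁ (proj₁ cubic) x y

    irreflexive : ∀ {x y} → G x y → x ≢ y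
    irreflexive g refl = proj₂ (proj₁ cubic) _ g

    -- Three distinct neighbours of a vertex of degree 3 are all its neighbours.
    edge-onto : ∀ {x} (e : Fin 3 → Fin n) → (∀ d → G x (e d)) → Inj e → ∀ y → G x y → ∃ λ d → y ≡ e d
    edge-onto {x} e ge inj y g with proj₂ (proj₂ cubic) x
    ... | a , b , c , ab , ac , bc , h = find
      where
        nbr : Fin 3 → Fin n
        nbr 0F = a
        nbr 1F = b
        nbr 2F = c
        index : ∀ {y} → G x y → ∃ λ d → y ≡ nbr d
        index {y} g with proj₁ (h y) g
        ... | inj₁ p        = 0F , p
        ... | inj₂ (inj₁ p) = 1F , p
        ... | inj₂ (inj₂ p) = 2F , p
        π : Fin 3 → Fin 3
        π d = proj₁ (index (ge d))
        π-inj : ∀ d d′ → d ≢ d′ → π d ≢ π d′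
        π-inj d d′ d≢d′ eq = d≢d′ (inj (trans (proj₂ (index (ge d))) (trans (cong nbr eq) (sym (proj₂ (index (ge d′)))))))
        hit : ∀ d → proj₁ (index g) ≡ π d → ∃ λ d → y ≡ e d
        hit d eq = d , trans (proj₂ (index g)) (trans (cong nbr eq) (sym (proj₂ (index (ge d)))))
        find : ∃ λ d → y ≡ e d
        find with distinct-cover (π 0F) (π 1F) (π 2F) (π-inj 0F 1F λ ()) (π-inj 0F 2F λ ()) (π-inj 1F 2F λ ()) (proj₁ (index g))
        ... | inj₁ p        = hit 0F p
        ... | inj₂ (inj₁ p) = hit 1F p
        ... | inj₂ (inj₂ p) = hit 2F p

    rest : ∀ {x p} → G x p → ∃ λ q → ∃ λ s → G x q × G x s × p ≢ q × p ≢ s × q ≢ s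
    rest {x} {p} g with proj₂ (proj₂ cubic) x
    ... | a , b , c , ab , ac , bc , h with proj₁ (h p) g
    ... | inj₁ refl        = b , c , proj₂ (h b) (inj₂ (inj₁ refl)) , proj₂ (h c) (inj₂ (inj₂ refl)) , ab , ac , bc
    ... | inj₂ (inj₁ refl) = a , c , proj₂ (h a) (inj₁ refl) , proj₂ (h c) (inj₂ (inj₂ refl)) , (λ e → ab (sym e)) , bc , ac
    ... | inj₂ (inj₂ refl) = a , b , proj₂ (h a) (inj₁ refl) , proj₂ (h b) (inj₂ (inj₁ refl)) , (λ e → ac (sym e)) , (λ e → bc (sym e)) , ab

    third : ∀ {x p q} → G x p → G x q → p ≢ q → ∃ λ s → G x s × p ≢ s × q ≢ s
    third {x} {p} {q} gp gq pq with rest gp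
    ... | a , b , ga , gb , pa , pb , ab with q F.≟ a
    ... | yes refl = b , gb , pb , ab
    ... | no q≢a  = a , ga , pa , q≢a

  inj₃ : ∀ {A : Set} {e : Fin 3 → A} → e 0F ≢ e 1F → e 0F ≢ e 2F → e 1F ≢ e 2F → Inj e
  inj₃ {e = e} p q r = onto-distinct⇒Inj e p q r (0F , refl) (1F , refl) (2F , refl)

  module Cases {n} {G : Graph n} (cubic : Cubic G) {m} {{m≢0 : NonZero m}} where
    open CubicGraph cubic

    module At (C : Cover G m) where
      open Cover C public

      -- E a b x: an edge from the base vertex of orbit a to the x-th vertex of orbit b.
      E : Fin 3 → Fin 3 → ℤ → Set
      E a b x = G (V a 0ℤ) (V b x)

      E-sym : ∀ {a b} x → E a b x → E b a (- x)
      E-sym {a} {b} x e = G-sym (subst₂ (λ i j → G (V a i) (V b j)) (ℤ.+-identityˡ (- x)) (ℤ.+-inverseʳ x) (translate (- x) e))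

      E-cong : ∀ {a b x y} → x ≈ y [ m ] → E a b x → E a b y
      E-cong {a} {b} p = subst (G (V a 0ℤ)) (V-cong b p)

      loop≉0 : ∀ {a x} → E a a x → ¬ (x ≈ 0ℤ [ m ])
      loop≉0 {a} e p = irreflexive e (V-cong a (≈-sym p))

      orbits-differ : ∀ {a b i j} → a ≢ b → V a i ≢ V b j
      orbits-differ ne e = ne (proj₁ (V-inj e))

      indices-differ : ∀ {a i j} → ¬ (i ≈ j [ m ]) → V a i ≢ V a j
      indices-differ ne e = ne (proj₂ (V-inj e))

      Rest : Fin 3 → Fin 3 → ℤ → Set
      Rest a b x = ∃ λ c → ∃ λ y → ∃ λ d → ∃ λ z → E a c y × E a d z × V b x ≢ V c y × V b x ≢ V d z × V c y ≢ V d z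

      restE : ∀ {a b x} → E a b x → Rest a b x
      restE e with rest e
      ... | p , q , gp , gq , h with V-surj p | V-surj q
      ... | c , y , refl | d , z , refl = c , y , d , z , gp , gq , h

      thirdE : ∀ {a b x c y} → E a b x → E a c y → V b x ≢ V c y → ∃ λ d → ∃ λ z → E a d z × V b x ≢ V d z × V c y ≢ V d z
      thirdE e f ne with third e f ne
      ... | p , gp , h with V-surj p
      ... | d , z , refl = d , z , gp , h

      Is : Fin 3 → ℤ → Fin 3 → ℤ → Set
      Is b x c y = b ≡ c × x ≈ y [ m ]

      abstract
        complete : ∀ {a b₀ x₀ b₁ x₁ b₂ x₂} → E a b₀ x₀ → E a b₁ x₁ → E a b₂ x₂ →
                   V b₀ x₀ ≢ V b₁ x₁ → V b₀ x₀ ≢ V b₂ x₂ → V b₁ x₁ ≢ V b₂ x₂ →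
                   ∀ {b x} → E a b x → Is b x b₀ x₀ ⊎ Is b x b₁ x₁ ⊎ Is b x b₂ x₂
        complete {a} {b₀} {x₀} {b₁} {x₁} {b₂} {x₂} e₀ e₁ e₂ p q r {b} {x} e = conclude (edge-onto list edges (inj₃ {e = list} p q r) (V b x) e)
          where
            list : Fin 3 → Fin n
            list 0F = V b₀ x₀
            list 1F = V b₁ x₁
            list 2F = V b₂ x₂
            edges : ∀ d → G (V a 0ℤ) (list d)
            edges 0F = e₀
            edges 1F = e₁
            edges 2F = e₂
            conclude : (∃ λ d → V b x ≡ list d) → Is b x b₀ x₀ ⊎ Is b x b₁ x₁ ⊎ Is b x b₂ x₂
            conclude (0F , f) = inj₁ (V-inj f)
            conclude (1F , f) = inj₂ (inj₁ (V-inj f))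
            conclude (2F , f) = inj₂ (inj₂ (V-inj f))

      -- Otherwise both darts would carry the unique involution of ℤₘ.
      opposite-loops : ∀ {a y z} → E a a y → E a a z → ¬ (y ≈ z [ m ]) →
                       (∀ {x} → E a a x → x ≈ y [ m ] ⊎ x ≈ z [ m ]) → ¬ (y ≈ - y [ m ])
      opposite-loops {a} {y} {z} ey ez y≉z only y≈-y = decide (only (E-sym z ez))
        where
          flip : ∀ {x y} → - x ≈ y [ m ] → x ≈ - y [ m ]
          flip {x} p = ≈-trans (≈-reflexive (sym (ℤ.neg-involutive x))) (neg-cong-≈ p)
          decide : - z ≈ y [ m ] ⊎ - z ≈ z [ m ] → ⊥
          decide (inj₁ p) = y≉z (≈-trans y≈-y (≈-sym (flip p)))
          decide (inj₂ p) = y≉z (halves-agree (involution⇒half (loop≉0 ey) (≈-sym y≈-y)) (involution⇒half (loop≉0 ez) p))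

    module Build {k} {{_ : NonZero (2 ℕ.* k)}} (m≡ : m ≡ 2 ℕ.* k) (C : Cover G m) where
      open At C

      fromPrimary : ∀ t {r s} → (∀ {a d} → (a , d) ∈ primary t → E a (head t a d) (value k r s (volt t a d))) →
                    (∀ a i → Inj (λ d → V (head t a d) (i + value k r s (volt t a d)))) → Model t G k r s
      fromPrimary t {r} {s} edges inj = record
        { V = V ; labelling = lab
        ; nb-edge = darts
        ; edge-nb = λ a i y g → edge-onto _ (darts a i) (inj a i) y g }
        where
          lab : Labelling V (2 ℕ.* k)
          lab = subst (Labelling V) m≡ labelling
          darts : ∀ a i d → G (V a i) (V (head t a d) (i + value k r s (volt t a d)))
          darts = allDarts t {G = G} {k = k} {r} {s} lab G-sym λ {a} {d} p i → subst₂ (λ x y → G (V a x) (V (head t a d) y)) (ℤ.+-identityˡ i)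
            (ℤ.+-comm (value k r s (volt t a d)) i) (translate i (edges p))

      differ : ∀ {a i x y} → ¬ (x ≈ y [ m ]) → V a (i + x) ≢ V a (i + y)
      differ {i = i} ne e = ne (+-cancelˡ-≈ i (proj₂ (V-inj e)))

      at-≡ : ∀ {a b x y} → x ≡ y → E a b x → E a b y
      at-≡ {a} {b} = subst (E a b)

      model₁ : ∀ r s → E 0F 0F (+ k) → E 0F 1F 0ℤ → E 0F 2F 0ℤ → E 1F 2F r → E 1F 2F s → ¬ (r ≈ s [ m ]) → Model t1 G k r s
      model₁ r s uu uv uw vr vs r≉s = fromPrimary t1 edges inj
        where
          edges : ∀ {a d} → (a , d) ∈ primary t1 → E a (head t1 a d) (value k r s (volt t1 a d))
          edges (here refl) = at-≡ (value-k r s (+ k)) uu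
          edges (there (here refl)) = at-≡ (value-0 r s (+ k)) uv
          edges (there (there (here refl))) = at-≡ (value-0 r s (+ k)) uw
          edges (there (there (there (here refl)))) = at-≡ (value-r r s (+ k)) vr
          edges (there (there (there (there (here refl))))) = at-≡ (value-s r s (+ k)) vs
          lem : ∀ r s k → - (- 1ℤ * r + 0ℤ * s + 0ℤ * k) ≡ r
          lem = solve-∀
          lem′ : ∀ r s k → - (0ℤ * r + - 1ℤ * s + 0ℤ * k) ≡ s
          lem′ = solve-∀
          s≉r : ¬ (0ℤ * r + 1ℤ * s + 0ℤ * + k ≈ 1ℤ * r + 0ℤ * s + 0ℤ * + k [ m ])
          s≉r p = r≉s (≈-trans (≈-reflexive (value-r r s (+ k))) (≈-trans (≈-sym p) (≈-reflexive (sym (value-s r s (+ k))))))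
          -s≉-r : ¬ (0ℤ * r + - 1ℤ * s + 0ℤ * + k ≈ - 1ℤ * r + 0ℤ * s + 0ℤ * + k [ m ])
          -s≉-r p = r≉s (≈-trans (≈-reflexive (sym (lem r s (+ k)))) (≈-trans (neg-cong-≈ (≈-sym p)) (≈-reflexive (lem′ r s (+ k)))))
          inj : ∀ a i → Inj (λ d → V (head t1 a d) (i + value k r s (volt t1 a d)))
          inj 0F i = inj₃ (orbits-differ λ ()) (orbits-differ λ ()) (orbits-differ λ ())
          inj 1F i = inj₃ (differ {i = i} s≉r) (orbits-differ λ ()) (orbits-differ λ ())
          inj 2F i = inj₃ (orbits-differ λ ()) (differ {i = i} -s≉-r) (orbits-differ λ ())

      model₂ : ∀ r s → E 2F 2F (+ k) → E 0F 1F 0ℤ → E 0F 2F 0ℤ → E 0F 2F r → E 1F 1F s →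
               ¬ (r ≈ 0ℤ [ m ]) → ¬ (s ≈ - s [ m ]) → Model t2 G k r s
      model₂ r s ww uv uw ur vv r≉0 s≉-s = fromPrimary t2 edges inj
        where
          edges : ∀ {a d} → (a , d) ∈ primary t2 → E a (head t2 a d) (value k r s (volt t2 a d))
          edges (here refl) = at-≡ (value-k r s (+ k)) ww
          edges (there (here refl)) = at-≡ (value-0 r s (+ k)) uv
          edges (there (there (here refl))) = at-≡ (value-0 r s (+ k)) uw
          edges (there (there (there (here refl)))) = at-≡ (value-r r s (+ k)) ur
          edges (there (there (there (there (here refl))))) = at-≡ (value-s r s (+ k)) vv
          lem : ∀ r s k → - (- 1ℤ * r + 0ℤ * s + 0ℤ * k) ≡ r
          lem = solve-∀
          lem′ : ∀ r s k → 0ℤ * r + - 1ℤ * s + 0ℤ * k ≡ - s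
          lem′ = solve-∀
          lem″ : ∀ r s k → - (0ℤ * r + 0ℤ * s + 0ℤ * k) ≡ 0ℤ
          lem″ = solve-∀
          0≉-r : ¬ (0ℤ * r + 0ℤ * s + 0ℤ * + k ≈ - 1ℤ * r + 0ℤ * s + 0ℤ * + k [ m ])
          0≉-r p = r≉0 (≈-trans (≈-reflexive (sym (lem r s (+ k)))) (≈-trans (neg-cong-≈ (≈-sym p)) (≈-reflexive (lem″ r s (+ k)))))
          inj : ∀ a i → Inj (λ d → V (head t2 a d) (i + value k r s (volt t2 a d)))
          inj 0F i = inj₃ (orbits-differ λ ()) (orbits-differ λ ()) (differ {i = i} λ p → r≉0
            (≈-trans (≈-reflexive (value-r r s (+ k))) (≈-trans p (≈-reflexive (sym (value-0 r s (+ k)))))))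
          inj 1F i = inj₃ (orbits-differ λ ()) (orbits-differ λ ()) (differ {i = i} λ p → s≉-s
            (≈-trans (≈-reflexive (value-s r s (+ k))) (≈-trans p (≈-reflexive (lem′ r s (+ k))))))
          inj 2F i = inj₃ (orbits-differ λ ()) (orbits-differ λ ()) (differ {i = i} 0≉-r)

      model₃ : ∀ r → E 0F 0F (+ k) → E 1F 1F (+ k) → E 2F 2F (+ k) → E 0F 1F 0ℤ → E 0F 2F 0ℤ → E 1F 2F r → Model t3 G k r 0ℤ
      model₃ r uu vv ww uv uw vr = fromPrimary t3 edges inj
        where
          edges : ∀ {a d} → (a , d) ∈ primary t3 → E a (head t3 a d) (value k r 0ℤ (volt t3 a d))
          edges (here refl) = at-≡ (value-k r 0ℤ (+ k)) uu
          edges (there (here refl)) = at-≡ (value-k r 0ℤ (+ k)) vv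
          edges (there (there (here refl))) = at-≡ (value-k r 0ℤ (+ k)) ww
          edges (there (there (there (here refl)))) = at-≡ (value-0 r 0ℤ (+ k)) uv
          edges (there (there (there (there (here refl))))) = at-≡ (value-0 r 0ℤ (+ k)) uw
          edges (there (there (there (there (there (here refl)))))) = at-≡ (value-r r 0ℤ (+ k)) vr
          inj : ∀ a i → Inj (λ d → V (head t3 a d) (i + value k r 0ℤ (volt t3 a d)))
          inj 0F i = inj₃ (orbits-differ λ ()) (orbits-differ λ ()) (orbits-differ λ ())
          inj 1F i = inj₃ (orbits-differ λ ()) (orbits-differ λ ()) (orbits-differ λ ())
          inj 2F i = inj₃ (orbits-differ λ ()) (orbits-differ λ ()) (orbits-differ λ ())

      model₄ : ∀ r s → E 1F 1F r → E 2F 2F s → E 0F 0F (+ k) → E 1F 0F 0ℤ → E 2F 0F 0ℤ →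
               ¬ (r ≈ - r [ m ]) → ¬ (s ≈ - s [ m ]) → Model t4 G k r s
      model₄ r s vv ww uu vu wu r≉-r s≉-s = fromPrimary t4 edges inj
        where
          edges : ∀ {a d} → (a , d) ∈ primary t4 → E a (head t4 a d) (value k r s (volt t4 a d))
          edges (here refl) = at-≡ (value-r r s (+ k)) vv
          edges (there (here refl)) = at-≡ (value-s r s (+ k)) ww
          edges (there (there (here refl))) = at-≡ (value-k r s (+ k)) uu
          edges (there (there (there (here refl)))) = at-≡ (value-0 r s (+ k)) vu
          edges (there (there (there (there (here refl))))) = at-≡ (value-0 r s (+ k)) wu
          lem : ∀ r s k → - 1ℤ * r + 0ℤ * s + 0ℤ * k ≡ - r
          lem = solve-∀
          lem′ : ∀ r s k → 0ℤ * r + - 1ℤ * s + 0ℤ * k ≡ - s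
          lem′ = solve-∀
          inj : ∀ a i → Inj (λ d → V (head t4 a d) (i + value k r s (volt t4 a d)))
          inj 0F i = inj₃ (orbits-differ λ ()) (orbits-differ λ ()) (orbits-differ λ ())
          inj 1F i = inj₃ (orbits-differ λ ()) (orbits-differ λ ()) (differ {i = i} λ p → r≉-r
            (≈-trans (≈-reflexive (value-r r s (+ k))) (≈-trans p (≈-reflexive (lem r s (+ k))))))
          inj 2F i = inj₃ (orbits-differ λ ()) (orbits-differ λ ()) (differ {i = i} λ p → s≉-s
            (≈-trans (≈-reflexive (value-s r s (+ k))) (≈-trans p (≈-reflexive (lem′ r s (+ k))))))

    module _ (C : Cover G m) where
      open At C

      private
        neg-flip : ∀ {x y} → - x ≈ y [ m ] → x ≈ - y [ m ]
        neg-flip {x} p = ≈-trans (≈-reflexive (sym (ℤ.neg-involutive x))) (neg-cong-≈ p)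

        neg≈0 : ∀ {x} → - x ≈ 0ℤ [ m ] → x ≈ 0ℤ [ m ]
        neg≈0 = neg-flip

      module _ (uv : E 0F 1F 0ℤ) (uw : E 0F 2F 0ℤ) where
        private
          vu : E 1F 0F 0ℤ
          vu = E-sym 0ℤ uv
          wu : E 2F 0F 0ℤ
          wu = E-sym 0ℤ uw

        -- The third edge at u is a semi-edge.
        module Semi {k} {{_ : NonZero (2 ℕ.* k)}} (m≡ : m ≡ 2 ℕ.* k) (uu : E 0F 0F (+ k)) where
          open Build {k} m≡ C

          half : ∀ {a x} → E a a x → - x ≈ x [ m ] → E a a (+ k)
          half {a} {x} e p = E-cong (halves-agree (involution⇒half (loop≉0 e) p) (k , m≡ , ≈-refl)) e

          atU : ∀ {b x} → E 0F b x → Is b x 0F (+ k) ⊎ Is b x 1F 0ℤ ⊎ Is b x 2F 0ℤ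
          atU = complete uu uv uw (orbits-differ λ ()) (orbits-differ λ ()) (orbits-differ λ ())

          v-to-u : ∀ {x} → E 1F 0F x → x ≈ 0ℤ [ m ]
          v-to-u {x} e with atU (E-sym x e)
          ... | inj₁ (() , _)
          ... | inj₂ (inj₁ (_ , p)) = neg≈0 p
          ... | inj₂ (inj₂ (() , _))

          w-to-u : ∀ {x} → E 2F 0F x → x ≈ 0ℤ [ m ]
          w-to-u {x} e with atU (E-sym x e)
          ... | inj₁ (() , _)
          ... | inj₂ (inj₁ (() , _))
          ... | inj₂ (inj₂ (_ , p)) = neg≈0 p

          v-parallel : ∀ {y z} → E 1F 2F y → E 1F 2F z → V 2F y ≢ V 2F z → Modelled G k
          v-parallel {y} {z} ey ez ne = inj₁ (y , z , model₁ y z uu uv uw ey ez (λ p → ne (V-cong 2F p)))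

          -- No further edge can join w to u or v, so the third edge at w is a loop. A vertex with a
          -- single loop has it equal to its own reverse, so all three vertices carry semi-edges:
          -- type 3.
          v-mixed : ∀ {y z} → E 1F 1F y → E 1F 2F z → Modelled G k
          v-mixed {y} {z} ey ez = conclude (thirdE wu (E-sym z ez) (orbits-differ λ ()))
            where
              atV : ∀ {b x} → E 1F b x → Is b x 0F 0ℤ ⊎ Is b x 1F y ⊎ Is b x 2F z
              atV = complete vu ey ez (orbits-differ λ ()) (orbits-differ λ ()) (orbits-differ λ ())
              vv : E 1F 1F (+ k)
              vv with atV (E-sym y ey)
              ... | inj₂ (inj₁ (_ , p)) = half ey p
              conclude : (∃ λ c → ∃ λ x → E 2F c x × V 0F 0ℤ ≢ V c x × V 1F (- z) ≢ V c x) → Modelled G k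
              conclude (0F , x , e , ne , _) = contradiction (V-cong 0F (≈-sym (w-to-u e))) ne
              conclude (1F , x , e , _ , ne) with atV (E-sym x e)
              ... | inj₂ (inj₂ (_ , p)) = contradiction (V-cong 1F (≈-sym (neg-flip p))) ne
              conclude (2F , x , e , _ , _) = inj₂ (inj₂ (inj₁ (z , model₃ z uu vv ww uv uw ez)))
                where
                  atW : ∀ {b y} → E 2F b y → Is b y 0F 0ℤ ⊎ Is b y 1F (- z) ⊎ Is b y 2F x
                  atW = complete wu (E-sym z ez) e (orbits-differ λ ()) (orbits-differ λ ()) (orbits-differ λ ())
                  ww : E 2F 2F (+ k)
                  ww with atW (E-sym x e)
                  ... | inj₂ (inj₂ (_ , p)) = half e p

          -- Neither u nor v has an edge left for w, so w also has two loops, reverse to each other: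
          -- type 4.
          v-loops : ∀ {y z} → E 1F 1F y → E 1F 1F z → V 1F y ≢ V 1F z → Modelled G k
          v-loops {y} {z} ey ez ne = conclude (restE wu)
            where
              y≉z : ¬ (y ≈ z [ m ])
              y≉z p = ne (V-cong 1F p)
              atV : ∀ {b x} → E 1F b x → Is b x 0F 0ℤ ⊎ Is b x 1F y ⊎ Is b x 1F z
              atV = complete vu ey ez (orbits-differ λ ()) (orbits-differ λ ()) ne
              onlyV : ∀ {x} → E 1F 1F x → x ≈ y [ m ] ⊎ x ≈ z [ m ]
              onlyV e with atV e
              ... | inj₂ (inj₁ (_ , p)) = inj₁ p
              ... | inj₂ (inj₂ (_ , p)) = inj₂ p
              w-not-v : ∀ {x} → ¬ E 2F 1F x
              w-not-v {x} e with atV (E-sym x e)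
              ... | inj₁ (() , _)
              ... | inj₂ (inj₁ (() , _))
              ... | inj₂ (inj₂ (() , _))
              conclude : Rest 2F 0F 0ℤ → Modelled G k
              conclude (0F , x , _ , _ , e , _ , n , _) = contradiction (V-cong 0F (≈-sym (w-to-u e))) n
              conclude (1F , x , _ , _ , e , _) = ⊥-elim (w-not-v e)
              conclude (2F , _ , 0F , x , _ , e , _ , n , _) = contradiction (V-cong 0F (≈-sym (w-to-u e))) n
              conclude (2F , _ , 1F , x , _ , e , _) = ⊥-elim (w-not-v e)
              conclude (2F , x , 2F , x′ , e , e′ , _ , _ , n) = inj₂ (inj₂ (inj₂ (y , x ,
                  model₄ y x ey e uu vu wu (opposite-loops ey ez y≉z onlyV) (opposite-loops e e′ (λ p → n (V-cong 2F p)) onlyW))))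
                where
                  onlyW : ∀ {y} → E 2F 2F y → y ≈ x [ m ] ⊎ y ≈ x′ [ m ]
                  onlyW f with complete wu e e′ (orbits-differ λ ()) (orbits-differ λ ()) n f
                  ... | inj₂ (inj₁ (_ , p)) = inj₁ p
                  ... | inj₂ (inj₂ (_ , p)) = inj₂ p

          -- The number of edges between v and w decides: two, one or none give types 1, 3 and 4.
          semi : Modelled G k
          semi = conclude (restE vu)
            where
              conclude : Rest 1F 0F 0ℤ → Modelled G k
              conclude (0F , x , _ , _ , e , _ , n , _) = contradiction (V-cong 0F (≈-sym (v-to-u e))) n
              conclude (1F , _ , 0F , x , _ , e , _ , n , _) = contradiction (V-cong 0F (≈-sym (v-to-u e))) n
              conclude (2F , _ , 0F , x , _ , e , _ , n , _) = contradiction (V-cong 0F (≈-sym (v-to-u e))) n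
              conclude (1F , _ , 1F , _ , e , e′ , _ , _ , n) = v-loops e e′ n
              conclude (1F , _ , 2F , _ , e , e′ , _) = v-mixed e e′
              conclude (2F , _ , 1F , _ , e , e′ , _) = v-mixed e′ e
              conclude (2F , _ , 2F , _ , e , e′ , _ , _ , n) = v-parallel e e′ n

        -- The third edge at u is a second edge to v.
        module Double {x} (uv′ : E 0F 1F x) (x≉0 : ¬ (x ≈ 0ℤ [ m ])) where
          private
            vu′ : E 1F 0F (- x)
            vu′ = E-sym x uv′

            -x≉0 : V 0F 0ℤ ≢ V 0F (- x)
            -x≉0 = indices-differ λ p → x≉0 (neg≈0 (≈-sym p))

            rotate rotate⁻ : Fin 3 → Fin 3
            rotate 0F = 2F
            rotate 1F = 0F
            rotate 2F = 1F
            rotate⁻ 0F = 1F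
            rotate⁻ 1F = 2F
            rotate⁻ 2F = 0F

            rotate⁻∘rotate : ∀ a → rotate⁻ (rotate a) ≡ a
            rotate⁻∘rotate 0F = refl
            rotate⁻∘rotate 1F = refl
            rotate⁻∘rotate 2F = refl

            rotate∘rotate⁻ : ∀ a → rotate (rotate⁻ a) ≡ a
            rotate∘rotate⁻ 0F = refl
            rotate∘rotate⁻ 1F = refl
            rotate∘rotate⁻ 2F = refl

          atU : ∀ {b y} → E 0F b y → Is b y 1F 0ℤ ⊎ Is b y 1F x ⊎ Is b y 2F 0ℤ
          atU = complete uv uv′ uw (indices-differ λ p → x≉0 (≈-sym p)) (orbits-differ λ ()) (orbits-differ λ ())

          v-to-u : ∀ {y} → E 1F 0F y → V 0F 0ℤ ≢ V 0F y → V 0F (- x) ≢ V 0F y → ⊥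
          v-to-u {y} e n n′ with atU (E-sym y e)
          ... | inj₁ (_ , p) = n (V-cong 0F (≈-sym (neg≈0 p)))
          ... | inj₂ (inj₁ (_ , p)) = n′ (V-cong 0F (≈-sym (neg-flip p)))
          ... | inj₂ (inj₂ (() , _))

          w-to-u : ∀ {y} → E 2F 0F y → y ≈ 0ℤ [ m ]
          w-to-u {y} e with atU (E-sym y e)
          ... | inj₁ (() , _)
          ... | inj₂ (inj₁ (() , _))
          ... | inj₂ (inj₂ (_ , p)) = neg≈0 p

          -- The single loop at v is a semi-edge, and w is left with two loops. This is type 2 with
          -- v and w exchanged.
          v-loop : ∀ {y} → E 1F 1F y → HasModel G m
          v-loop {y} ey = finish (involution⇒half (loop≉0 ey) -y≈y)
            where
              atV : ∀ {b z} → E 1F b z → Is b z 0F 0ℤ ⊎ Is b z 0F (- x) ⊎ Is b z 1F y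
              atV = complete vu vu′ ey -x≉0 (orbits-differ λ ()) (orbits-differ λ ())
              -y≈y : - y ≈ y [ m ]
              -y≈y with atV (E-sym y ey)
              ... | inj₂ (inj₂ (_ , p)) = p
              w-not-v : ∀ {z} → ¬ E 2F 1F z
              w-not-v {z} e with atV (E-sym z e)
              ... | inj₁ (() , _)
              ... | inj₂ (inj₁ (() , _))
              ... | inj₂ (inj₂ (() , _))
              finish : (∃ λ k → m ≡ 2 ℕ.* k × y ≈ + k [ m ]) → HasModel G m
              finish (k , m≡ , y≈k) = k , m≡ , conclude (restE wu)
                where
                  instance
                    _ : NonZero (2 ℕ.* k)
                    _ = subst NonZero m≡ m≢0
                  C′ : Cover G m
                  C′ = regauge C transpose₁₂ transpose₁₂ transpose₁₂² transpose₁₂² (λ _ → 0ℤ)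
                  re : ∀ {a b z} → E (transpose₁₂ a) (transpose₁₂ b) z → At.E C′ a b z
                  re {a} {b} {z} = subst (λ z → G (V (transpose₁₂ a) 0ℤ) (V (transpose₁₂ b) z)) (sym (ℤ.+-identityʳ z))
                  conclude : Rest 2F 0F 0ℤ → Modelled G k
                  conclude (0F , x , _ , _ , e , _ , n , _) = contradiction (V-cong 0F (≈-sym (w-to-u e))) n
                  conclude (1F , x , _ , _ , e , _) = ⊥-elim (w-not-v e)
                  conclude (2F , _ , 0F , x , _ , e , _ , n , _) = contradiction (V-cong 0F (≈-sym (w-to-u e))) n
                  conclude (2F , _ , 1F , x , _ , e , _) = ⊥-elim (w-not-v e)
                  conclude (2F , z , 2F , z′ , e , e′ , _ , _ , n) = inj₂ (inj₁ (x , z ,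
                      Build.model₂ {k} m≡ C′ x z (re {2F} {2F} (E-cong y≈k ey)) (re {0F} {1F} uw) (re {0F} {2F} uv) (re {0F} {2F} uv′) (re {1F} {1F} e)
                        x≉0 (opposite-loops e e′ (λ p → n (V-cong 2F p)) onlyW)))
                    where
                      onlyW : ∀ {y} → E 2F 2F y → y ≈ z [ m ] ⊎ y ≈ z′ [ m ]
                      onlyW f with complete wu e e′ (orbits-differ λ ()) (orbits-differ λ ()) n f
                      ... | inj₂ (inj₁ (_ , p)) = inj₁ p
                      ... | inj₂ (inj₂ (_ , p)) = inj₂ p

          -- The last edge at w is a semi-edge, so w takes the place of u in type 1. The gauge -y
          -- gives voltage 0 to the edges leaving w, and the double edge between u and v receives
          -- the voltages y and x + y.
          v-w : ∀ {y} → E 1F 2F y → HasModel G m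
          v-w {y} ey = conclude (thirdE wu (E-sym y ey) (orbits-differ λ ()))
            where
              atV : ∀ {b z} → E 1F b z → Is b z 0F 0ℤ ⊎ Is b z 0F (- x) ⊎ Is b z 2F y
              atV = complete vu vu′ ey -x≉0 (orbits-differ λ ()) (orbits-differ λ ())
              conclude : (∃ λ c → ∃ λ z → E 2F c z × V 0F 0ℤ ≢ V c z × V 1F (- y) ≢ V c z) → HasModel G m
              conclude (0F , z , e , n , _) = contradiction (V-cong 0F (≈-sym (w-to-u e))) n
              conclude (1F , z , e , _ , n) with atV (E-sym z e)
              ... | inj₂ (inj₂ (_ , p)) = contradiction (V-cong 1F (≈-sym (neg-flip p))) n
              conclude (2F , z , e , _ , _) = finish (involution⇒half (loop≉0 e) -z≈z)
                where
                  -z≈z : - z ≈ z [ m ]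
                  -z≈z with complete wu (E-sym y ey) e (orbits-differ λ ()) (orbits-differ λ ()) (orbits-differ λ ()) (E-sym z e)
                  ... | inj₂ (inj₂ (_ , p)) = p
                  finish : (∃ λ k → m ≡ 2 ℕ.* k × z ≈ + k [ m ]) → HasModel G m
                  finish (k , m≡ , z≈k) = k , m≡ , inj₁ (y , x + y ,
                      Build.model₁ {k} m≡ C′ y (x + y) (re {0F} {0F} (+ k) (ℤ.+-identityʳ (+ k)) (E-cong z≈k e)) (re {0F} {1F} 0ℤ refl wu)
                        (re {0F} {2F} 0ℤ (ℤ.+-identityˡ (- y)) (E-sym y ey)) (re {1F} {2F} y (ℤ.+-inverseʳ y) uv) (re {1F} {2F} (x + y) (lem x y) uv′)
                        λ p → x≉0 (≈-sym (+-cancelˡ-≈ y (≈-trans (≈-reflexive (ℤ.+-identityʳ y)) (≈-trans p (≈-reflexive (ℤ.+-comm x y)))))))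
                    where
                      lem : ∀ x y → x + y - y ≡ x
                      lem = solve-∀
                      instance
                        _ : NonZero (2 ℕ.* k)
                        _ = subst NonZero m≡ m≢0
                      gauge : Fin 3 → ℤ
                      gauge 2F = - y
                      gauge _  = 0ℤ
                      C′ : Cover G m
                      C′ = regauge C rotate rotate⁻ rotate⁻∘rotate rotate∘rotate⁻ gauge
                      re : ∀ {a b} i {i′} → i + gauge b ≡ i′ → G (V (rotate a) (0ℤ + gauge a)) (V (rotate b) i′) → At.E C′ a b i
                      re {a} {b} i p = subst (λ i → G (V (rotate a) (0ℤ + gauge a)) (V (rotate b) i)) (sym p)

          double : HasModel G m
          double = conclude (thirdE vu vu′ -x≉0)
            where
              conclude : (∃ λ c → ∃ λ z → E 1F c z × V 0F 0ℤ ≢ V c z × V 0F (- x) ≢ V c z) → HasModel G m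
              conclude (0F , z , e , n , n′) = ⊥-elim (v-to-u e n n′)
              conclude (1F , z , e , _) = v-loop e
              conclude (2F , z , e , _) = v-w e

  -- Choice of a centre and of a gauge

  module Normalise {n} {G : Graph n} (cubic : Cubic G) {m} {{m≢0 : NonZero m}} where
    open CubicGraph cubic
    open Cases cubic {m} using (module At; module Semi; module Double)

    -- The third edge at u is either a loop, which must be its own reverse and hence a semi-edge, or
    -- a second edge to v or w.
    centred : (C : Cover G m) → At.E C 0F 1F 0ℤ → At.E C 0F 2F 0ℤ → HasModel G m
    centred C uv uw = conclude (thirdE uv uw (orbits-differ λ ()))
      where
        open At C
        conclude : (∃ λ c → ∃ λ x → E 0F c x × V 1F 0ℤ ≢ V c x × V 2F 0ℤ ≢ V c x) → HasModel G m
        conclude (0F , x , e , _) = finish (involution⇒half (loop≉0 e) (self (complete e uv uw (orbits-differ λ ()) (orbits-differ λ ()) (orbits-differ λ ()) (E-sym x e))))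
          where
            self : Is 0F (- x) 0F x ⊎ Is 0F (- x) 1F 0ℤ ⊎ Is 0F (- x) 2F 0ℤ → - x ≈ x [ m ]
            self (inj₁ (_ , p)) = p
            self (inj₂ (inj₁ (() , _)))
            self (inj₂ (inj₂ (() , _)))
            finish : (∃ λ k → m ≡ 2 ℕ.* k × x ≈ + k [ m ]) → HasModel G m
            finish (k , m≡ , p) = k , m≡ , Semi.semi C uv uw {k} {{subst NonZero m≡ m≢0}} m≡ (E-cong p e)
        conclude (1F , x , e , ne , _) = Double.double C uv uw e (λ p → ne (V-cong 1F (≈-sym p)))
        conclude (2F , x , e , _ , ne) = Double.double (regauge C transpose₁₂ transpose₁₂ transpose₁₂² transpose₁₂² (λ _ → 0ℤ))
            (re uw) (re uv) (re e) (λ p → ne (V-cong 2F (≈-sym p)))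
          where
            re : ∀ {b z} → E 0F b z → G (V 0F 0ℤ) (V b (z + 0ℤ))
            re {b} {z} = subst (λ z → G (V 0F 0ℤ) (V b z)) (sym (ℤ.+-identityʳ z))

    module _ (C : Cover G m) where
      open At C

      private
        difference-edge : ∀ {a b i j} → G (V a i) (V b j) → E a b (j - i)
        difference-edge {a} {b} {i} {j} g = subst (λ x → G (V a x) (V b (j - i))) (ℤ.+-inverseʳ i) (translate (- i) g)

        confined : ∀ {a} → (∀ b x → E a b x → b ≡ a) → ∀ {i y} → Reach G (V a i) y → ∃ λ j → y ≡ V a j
        confined h {i} here = i , refl
        confined h (step {v = v} g rest) with V-surj v
        ... | b , j , refl with h b _ (difference-edge g)
        ... | refl = confined h rest

        another : ∀ (a : Fin 3) → ∃ λ b → b ≢ a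
        another 0F = 1F , λ ()
        another 1F = 0F , λ ()
        another 2F = 0F , λ ()

      -- Otherwise all edges at this orbit stay inside it, and connectedness would confine the whole
      -- graph to it.
      leaves : ∀ a → ∃ λ b → ∃ λ x → E a b x × b ≢ a
      leaves a with proj₂ (proj₂ cubic) (V a 0ℤ)
      ... | p , q , s , _ , _ , _ , h with V-surj p | V-surj q | V-surj s
      ... | b , x , refl | c , y , refl | d , z , refl with b F.≟ a | c F.≟ a | d F.≟ a
      ... | no b≢a | _ | _ = b , x , proj₂ (h (V b x)) (inj₁ refl) , b≢a
      ... | _ | no c≢a | _ = c , y , proj₂ (h (V c y)) (inj₂ (inj₁ refl)) , c≢a
      ... | _ | _ | no d≢a = d , z , proj₂ (h (V d z)) (inj₂ (inj₂ refl)) , d≢a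
      ... | yes refl | yes refl | yes refl = ⊥-elim (escape (another a))
        where
          closed : ∀ b x → E a b x → b ≡ a
          closed b x e with proj₁ (h (V b x)) e
          ... | inj₁ f        = proj₁ (V-inj f)
          ... | inj₂ (inj₁ f) = proj₁ (V-inj f)
          ... | inj₂ (inj₂ f) = proj₁ (V-inj f)
          escape : (∃ λ b → b ≢ a) → ⊥
          escape (b , b≢a) = let j , f = confined closed (proj₁ (proj₂ cubic) (V a 0ℤ) (V b 0ℤ)) in b≢a (proj₁ (V-inj f))

      -- The two edges at the centre form a spanning tree of the pregraph, so a change of base
      -- vertices makes both voltages 0.
      fromCentre : ∀ u v w → u ≢ v → u ≢ w → v ≢ w → ∀ {x y} → E u v x → E u w y → HasModel G m
      fromCentre u v w uv uw vw {x} {y} e f = centred (regauge C π π⁻ π⁻π ππ⁻ g)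
          (subst (λ z → G (V u 0ℤ) (V v z)) (sym (ℤ.+-identityˡ x)) e) (subst (λ z → G (V u 0ℤ) (V w z)) (sym (ℤ.+-identityˡ y)) f)
        where
          π π⁻ : Fin 3 → Fin 3
          π 0F = u
          π 1F = v
          π 2F = w
          cover-all : ∀ a → ∃ λ b → π b ≡ a
          cover-all a with distinct-cover u v w uv uw vw a
          ... | inj₁ p        = 0F , sym p
          ... | inj₂ (inj₁ p) = 1F , sym p
          ... | inj₂ (inj₂ p) = 2F , sym p
          π⁻ a = proj₁ (cover-all a)
          ππ⁻ : ∀ a → π (π⁻ a) ≡ a
          ππ⁻ a = proj₂ (cover-all a)
          π⁻π : ∀ a → π⁻ (π a) ≡ a
          π⁻π a = inj₃ {e = π} uv uw vw (ππ⁻ (π a))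
          g : Fin 3 → ℤ
          g 0F = 0ℤ
          g 1F = x
          g 2F = y

      private
        -- The edge leaving c ends at 0 or at b; as 0 and b are joined, that end is adjacent to both
        -- other orbits.
        join : ∀ b c → b ≢ 0F → c ≢ 0F → b ≢ c → ∀ {x} → E 0F b x → (∃ λ d → ∃ λ y → E c d y × d ≢ c) → HasModel G m
        join b c b≢0 c≢0 b≢c e (d , y , f , d≢c) with d F.≟ 0F
        ... | yes refl = fromCentre 0F b c (λ p → b≢0 (sym p)) (λ p → c≢0 (sym p)) b≢c e (E-sym y f)
        ... | no d≢0 with distinct-cover 0F b c (λ p → b≢0 (sym p)) (λ p → c≢0 (sym p)) b≢c d
        ... | inj₁ p           = contradiction p d≢0
        ... | inj₂ (inj₂ p)    = contradiction p d≢c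
        ... | inj₂ (inj₁ refl) = fromCentre b 0F c b≢0 b≢c (λ p → c≢0 (sym p)) (E-sym _ e) (E-sym y f)

      hasModel : HasModel G m
      hasModel with leaves 0F
      ... | 0F , x , e , ne = contradiction refl ne
      ... | 1F , x , e , _  = join 1F 2F (λ ()) (λ ()) (λ ()) e (leaves 2F)
      ... | 2F , x , e , _  = join 2F 1F (λ ()) (λ ()) (λ ()) e (leaves 1F)

  -- The classification

  Conclusion : ∀ {n} → Graph n → ℕ → Set
  Conclusion {n} Γ k = (Odd k × (Γ ≅ X k ⊎ Γ ≅ Y k)) ⊎ ((IsPrism Γ × Odd k) ⊎ IsMobiusLadder Γ) ⊎ (n ℕ.< 54 × InCensusList Γ)

  classification : ∀ {n} {Γ : Graph n} → Cubic Γ → VertexTransitive Γ → Tricirculant Γ →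
                   Σ ℕ λ k → 0 ℕ.< k × n ≡ 6 ℕ.* k × Conclusion Γ k
  classification {n} {Γ} cubic vt (_ , σ , orbits) =
    conclude (Normalise.hasModel cubic {{m≢0}} C)
    where
      m = proj₁ (proj₂ orbits)
      m≢0 : NonZero m
      m≢0 = ℕ.>-nonZero (ℕ.<-trans ℕ.z<s (proj₁ (proj₂ (proj₂ orbits))))
      C : Cover Γ m
      C = cover σ orbits
      order : ∀ k → m ≡ 2 ℕ.* k → n ≡ 6 ℕ.* k
      order k e = trans (labelling-size {{m≢0}} (Cover.labelling C)) (trans (cong (3 ℕ.*_) e) (sym (ℕ.*-assoc 3 2 k)))

      identify : ∀ j → n ≡ 6 ℕ.* suc j → Modelled Γ (suc j) → Conclusion Γ (suc j)
      identify j n≡ (inj₁ (r , s , M)) =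
        [ (λ (odd , iso) → inj₁ (odd , inj₁ iso))
        , (λ (k≡2 , census) → inj₂ (inj₂ (subst (ℕ._< 54) (sym (trans n≡ (cong (6 ℕ.*_) k≡2))) (ℕ.<ᵇ⇒< 12 54 tt) , census))) ]′
        (Identify.identify₁ cubic j (Conclusions.type₁ cubic vt j M))
      identify j n≡ (inj₂ (inj₁ (r , s , M))) =
        let odd , iso = Identify.identify₂ cubic j (Conclusions.type₂ cubic vt j M) in inj₁ (odd , inj₂ iso)
      identify j n≡ (inj₂ (inj₂ (inj₁ (r , M)))) = inj₂ (inj₁ (Identify.identify₃ cubic j M))
      identify j n≡ (inj₂ (inj₂ (inj₂ (r , s , M)))) =
        let k≡5 , census = Identify.identify₄ cubic j (Conclusions.type₄ cubic vt j M) in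
        inj₂ (inj₂ (subst (ℕ._< 54) (sym (trans n≡ (cong (6 ℕ.*_) k≡5))) (ℕ.<ᵇ⇒< 30 54 tt) , census))

      conclude : HasModel Γ m → Σ ℕ λ k → 0 ℕ.< k × n ≡ 6 ℕ.* k × Conclusion Γ k
      conclude (zero , m≡ , _) = contradiction (subst (1 ℕ.<_) m≡ (proj₁ (proj₂ (proj₂ orbits)))) λ ()
      conclude (suc j , m≡ , M) = suc j , ℕ.z<s , order (suc j) m≡ , identify j (order (suc j) m≡) M

open import Data.Nat using (ℕ; _*_; _<_)
open import Data.Fin using (Fin)
open import Data.Product using (Σ; _×_)
open import Data.Sum using (_⊎_)
open import Relation.Binary.PropositionalEquality using (_≡_)

theorem1p1 : (n : ℕ) (Γ : Graph n) →
    Cubic Γ → VertexTransitive Γ → Tricirculant Γ →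
    Σ ℕ λ k → 0 < k × n ≡ 6 * k ×
    ((Odd k × (Γ ≅ X k ⊎ Γ ≅ Y k))
    ⊎ ((IsPrism Γ × Odd k) ⊎ IsMobiusLadder Γ)
    ⊎ (n < 54 × InCensusList Γ))
theorem1p1 n Γ cubic vt tricirculant = Classification.classification cubic vt tricirculant
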